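{- Let $M$ be a finite matroid with non-empty ground set. If it is not the case that every element of $M$ is a loop or a coloop, or if $M$ consists solely of loops, then the minimum contraction-depth of a (finite) matroid $M'$ that contains $M$ as a restriction is equal to the contraction$^*$-depth of $M$ increased by one, i.e., \[\mathrm{c^*d}(M)=\min_{M'\sqsupseteq M}\mathrm{cd}(M')-1.\] In the exceptional case, i.e., when every element of $M$ is a loop or a coloop and $M$ does not consist solely of loops, it holds that $\mathrm{c^*d}(M)=\mathrm{cd}(M)\in\{0,1\}$.
   Context: All matroids are finite with non-empty ground set; a matroid is identified with its ground set. $M\sqsubseteq M'$ (equivalently $M'\sqsupseteq M$) means that $M$ is a restriction of $M'$, i.e., $M=M'|X$ for a subset $X$ of the ground set of $M'$. A matroid is connected if every two distinct elements lie in a common circuit; a component is an inclusion-wise maximal connected restriction. Contraction-depth $\mathrm{cd}(M)$ is defined recursively: if $M$ has a single element, $\mathrm{cd}(M)=1$; if $M$ is not connected, $\mathrm{cd}(M)$ is the maximum contraction-depth of a component of $M$; otherwise $\mathrm{cd}(M)=1+\min_{e\in M}\mathrm{cd}(M/e)$. In a rooted tree $T$, a leaf is a vertex with no children (so the root is a leaf if and only if $|V(T)|=1$). For $A\subseteq V(T)$, $T\langle A\rangle$ is the inclusion-wise smallest subtree of $T$ containing the root and all vertices of $A$. The depth of $T$ is the maximum number of edges on a path from the root to a leaf. A contraction$^*$-decomposition of $M$ is a pair $(T,f)$ where $T$ is a rooted tree with exactly $\mathrm{rank}(M)$ edges and $f$ maps the elements of $M$ to leaves of $T$ such that $|E(T\langle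 f(X)\rangle)|\ge \mathrm{rank}_M(X)$ for every subset $X$ of elements of $M$. Its depth is the depth of $T$. The contraction$^*$-depth $\mathrm{c^*d}(M)$ is the minimum depth of a contraction$^*$-decomposition of $M$. -}

module Defs where

open import Data.Fin.Base using (Fin; zero; suc)
import Data.Fin.Properties as Fin
open import Data.Fin.Subset
  using (Subset; inside; outside; ⊤; ⊥; ⁅_⁆; _∈_; _∉_; _⊆_; _⊂_; _∪_; ∣_∣; Nonempty)
import Data.Fin.Subset.Properties as Subset
open import Data.List.Base using (List; []; _∷_; _++_; map; filter; concatMap; mapMaybe; length; allFin)
open import Data.List.Extrema.Nat using (max; min)
open import Data.List.Membership.Propositional using (find) renaming (_∈_ to _∈ₗ_)
open import Data.List.Relation.Unary.Any as Any using (Any; any?; here; there)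
import Data.Maybe.Base as Maybe
open import Data.Nat.Base using (ℕ; zero; suc; _≤_; _<_)
import Data.Nat.Properties as ℕ
open import Data.Nat.Induction using (Acc; acc; <-wellFounded)
open import Data.Product.Base using (∃; ∃-syntax; Σ-syntax; _×_; _,_)
open import Data.Sum.Base using (_⊎_)
open import Data.Vec.Base using ([]; _∷_; here; there; insertAt; lookup; tabulate)
open import Function.Base using (_∘_)
open import Function.Bundles using (_⇔_; _⤖_; Bijection)
open import Level as Level using (Level; 0ℓ)
open import Relation.Binary.PropositionalEquality
  using (_≡_; _≢_; refl; sym; trans; cong; subst; subst₂)
open import Relation.Nullary.Decidable
  using (Dec; yes; no; does; ¬?; _×-dec_; _→-dec_; map′; decidable-stable; dec⇒maybe)
open import Relation.Nullary.Negation using (¬_; contradiction)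
open import Relation.Unary using (Pred; Decidable)

private
  variable
    ℓ : Level
    m n : ℕ

IsMinimum : Pred ℕ ℓ → Pred ℕ ℓ
IsMinimum P m = P m × (∀ k → P k → m ≤ k)

subsets : ∀ n → List (Subset n)
subsets zero    = [] ∷ []
subsets (suc n) = map (inside ∷_) (subsets n) ++ map (outside ∷_) (subsets n)

allSubset? : {P : Pred (Subset n) ℓ} → Decidable P → Dec (∀ S → P S)
allSubset? P? = map′
  (λ ¬∃¬ S → decidable-stable (P? S) (λ ¬p → ¬∃¬ (S , ¬p)))
  (λ ∀p (S , ¬p) → ¬p (∀p S))
  (¬? (Subset.anySubset? (¬? ∘ P?)))

-- The ground set is Fin n; it is non-empty exactly when n is non-zero.
record Matroid (n : ℕ) : Set₁ where
  field
    Indep   : Pred (Subset n) 0ℓ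
    indep?  : Decidable Indep
    ⊥-indep : Indep ⊥
    ⊆-indep : ∀ {X Y} → X ⊆ Y → Indep Y → Indep X
    augment : ∀ {X Y} → Indep X → Indep Y → ∣ X ∣ < ∣ Y ∣ →
              ∃[ y ] y ∈ Y × y ∉ X × Indep (X ∪ ⁅ y ⁆)

open Matroid public

rank : Matroid n → Subset n → ℕ
rank {n} M X =
  max 0 (map ∣_∣ (filter (λ Y → (Y Subset.⊆? X) ×-dec indep? M Y) (subsets n)))

Basis : Matroid n → Pred (Subset n) 0ℓ
Basis M B = Indep M B × (∀ Y → B ⊂ Y → ¬ Indep M Y)

Circuit : Matroid n → Pred (Subset n) 0ℓ
Circuit M C = ¬ Indep M C × (∀ D → D ⊂ C → Indep M D)

Loop : Matroid n → Pred (Fin n) 0ℓ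
Loop M x = Circuit M ⁅ x ⁆

Coloop : Matroid n → Pred (Fin n) 0ℓ
Coloop M x = ∀ B → Basis M B → x ∈ B

Connected : Matroid n → Set
Connected M = ∀ x y → x ≢ y → ∃[ C ] Circuit M C × x ∈ C × y ∈ C

circuit? : (M : Matroid n) → Decidable (Circuit M)
circuit? M C =
  ¬? (indep? M C) ×-dec allSubset? (λ D → (D Subset.⊂? C) →-dec indep? M D)

connected? : (M : Matroid n) → Dec (Connected M)
connected? M = Fin.all? λ x → Fin.all? λ y → ¬? (x Fin.≟ y) →-dec
  Subset.anySubset? (λ C → circuit? M C ×-dec (x Subset.∈? C) ×-dec (y Subset.∈? C))

-- The elements of S, in increasing order, are renumbered by Fin ∣ S ∣.
-- A subset X of Fin ∣ S ∣ then stands for the following subset of S.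
embed : (S : Subset n) → Subset ∣ S ∣ → Subset n
embed []            X       = []
embed (inside  ∷ S) (x ∷ X) = x ∷ embed S X
embed (outside ∷ S) X       = outside ∷ embed S X

embed-⊥ : (S : Subset n) → embed S ⊥ ≡ ⊥
embed-⊥ []            = refl
embed-⊥ (inside  ∷ S) = cong (outside ∷_) (embed-⊥ S)
embed-⊥ (outside ∷ S) = cong (outside ∷_) (embed-⊥ S)

embed-size : (S : Subset n) (X : Subset ∣ S ∣) → ∣ embed S X ∣ ≡ ∣ X ∣
embed-size []            []            = refl
embed-size (inside  ∷ S) (inside  ∷ X) = cong suc (embed-size S X)
embed-size (inside  ∷ S) (outside ∷ X) = embed-size S X
embed-size (outside ∷ S) X             = embed-size S X

embed-⊆ : (S : Subset n) {X Y : Subset ∣ S ∣} → X ⊆ Y → embed S X ⊆ embed S Y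
embed-⊆ (inside  ∷ S) {_ ∷ _} {_ ∷ _} X⊆Y here with X⊆Y here
... | here = here
embed-⊆ (inside  ∷ S) {_ ∷ _} {_ ∷ _} X⊆Y (there p) =
  there (embed-⊆ S (Subset.drop-∷-⊆ X⊆Y) p)
embed-⊆ (outside ∷ S) X⊆Y (there p) = there (embed-⊆ S X⊆Y p)

embed-⊆⁻ : (S : Subset n) {X Y : Subset ∣ S ∣} → embed S X ⊆ embed S Y → X ⊆ Y
embed-⊆⁻ (inside  ∷ S) {_ ∷ _} {_ ∷ _} e⊆e here with e⊆e here
... | here = here
embed-⊆⁻ (inside  ∷ S) {_ ∷ _} {_ ∷ _} e⊆e (there p) =
  there (embed-⊆⁻ S (Subset.drop-∷-⊆ e⊆e) p)
embed-⊆⁻ (outside ∷ S) e⊆e p = embed-⊆⁻ S (Subset.drop-∷-⊆ e⊆e) p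

embed-∖ : (S : Subset n) {X Y : Subset ∣ S ∣} {y : Fin n} →
          y ∈ embed S Y → y ∉ embed S X →
          ∃[ z ] z ∈ Y × z ∉ X × embed S X ∪ ⁅ y ⁆ ≡ embed S (X ∪ ⁅ z ⁆)
embed-∖ (inside ∷ S) {inside  ∷ _} {_ ∷ _} here y∉ = contradiction here y∉
embed-∖ (inside ∷ S) {outside ∷ X} {_ ∷ _} here y∉ =
  zero , here , (λ ()) , cong (inside ∷_)
    (trans (Subset.∪-identityʳ (embed S X)) (cong (embed S) (sym (Subset.∪-identityʳ X))))
embed-∖ (inside ∷ S) {x ∷ X} {_ ∷ _} (there y∈) y∉
  with embed-∖ S {X} y∈ (y∉ ∘ there)
... | z , z∈ , z∉ , eq =
  suc z , there z∈ , (λ { (there p) → z∉ p }) , cong (_ ∷_) eq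
embed-∖ (outside ∷ S) {X} (there y∈) y∉ with embed-∖ S {X} y∈ (y∉ ∘ there)
... | z , z∈ , z∉ , eq = z , z∈ , z∉ , cong (outside ∷_) eq

infixl 8 _∣_

_∣_ : Matroid n → (S : Subset n) → Matroid ∣ S ∣
M ∣ S = record
  { Indep   = λ X → Indep M (embed S X)
  ; indep?  = λ X → indep? M (embed S X)
  ; ⊥-indep = subst (Indep M) (sym (embed-⊥ S)) (⊥-indep M)
  ; ⊆-indep = λ X⊆Y → ⊆-indep M (embed-⊆ S X⊆Y)
  ; augment = λ {X} {Y} iX iY lt →
      let y , y∈ , y∉ , i = augment M iX iY
            (subst₂ _<_ (sym (embed-size S X)) (sym (embed-size S Y)) lt)
          z , z∈ , z∉ , eq = embed-∖ S y∈ y∉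
      in z , z∈ , z∉ , subst (Indep M) eq i
  }

infix 4 _≅_ _⊑_

_≅_ : Matroid n → Matroid m → Set
_≅_ {n} {m} M N = Σ[ φ ∈ Fin n ⤖ Fin m ]
  (∀ Y → Indep M (tabulate (lookup Y ∘ Bijection.to φ)) ⇔ Indep N Y)

-- Ground sets being of the form Fin n, M is a restriction of M′ up to a
-- relabelling of its elements.
_⊑_ : Matroid n → Matroid m → Set
M ⊑ M′ = ∃[ S ] M ≅ M′ ∣ S

Component : Matroid n → Pred (Subset n) 0ℓ
Component M S =
  Nonempty S × Connected (M ∣ S) × (∀ S′ → S ⊂ S′ → ¬ Connected (M ∣ S′))

component? : (M : Matroid n) → Decidable (Component M)
component? M S = Subset.nonempty? S ×-dec connected? (M ∣ S) ×-dec
  allSubset? (λ S′ → (S Subset.⊂? S′) →-dec ¬? (connected? (M ∣ S′)))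

components : (M : Matroid n) → List (∃ (Component M))
components {n} M =
  mapMaybe (λ S → Maybe.map (S ,_) (dec⇒maybe (component? M S))) (subsets n)

insertAt-outside-⊥ : (e : Fin (suc n)) → insertAt ⊥ e outside ≡ ⊥
insertAt-outside-⊥ zero = refl
insertAt-outside-⊥ {suc n} (suc e) = cong (outside ∷_) (insertAt-outside-⊥ e)

insertAt-inside-⊥ : (e : Fin (suc n)) → insertAt ⊥ e inside ≡ ⁅ e ⁆
insertAt-inside-⊥ zero = refl
insertAt-inside-⊥ {suc n} (suc e) = cong (outside ∷_) (insertAt-inside-⊥ e)

insertAt-⊆ : ∀ {X Y : Subset n} e b → X ⊆ Y → insertAt X e b ⊆ insertAt Y e b
insertAt-⊆ zero b X⊆Y here = here
insertAt-⊆ zero b X⊆Y (there p) = there (X⊆Y p)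
insertAt-⊆ {X = _ ∷ _} {_ ∷ _} (suc e) b X⊆Y here with X⊆Y here
... | here = here
insertAt-⊆ {X = _ ∷ _} {_ ∷ _} (suc e) b X⊆Y (there p) =
  there (insertAt-⊆ e b (Subset.drop-∷-⊆ X⊆Y) p)

insertAt-size : ∀ (X : Subset n) e b → ∣ insertAt X e b ∣ ≡ ∣ b ∷ X ∣
insertAt-size X zero b = refl
insertAt-size (inside  ∷ X) (suc e) inside  = cong suc (insertAt-size X e inside)
insertAt-size (inside  ∷ X) (suc e) outside = cong suc (insertAt-size X e outside)
insertAt-size (outside ∷ X) (suc e) inside  = insertAt-size X e inside
insertAt-size (outside ∷ X) (suc e) outside = insertAt-size X e outside

∷-size-< : ∀ {X Y : Subset n} b → ∣ X ∣ < ∣ Y ∣ → ∣ b ∷ X ∣ < ∣ b ∷ Y ∣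
∷-size-< inside  = ℕ.+-monoʳ-< 1
∷-size-< outside = λ lt → lt

insertAt-∖ : ∀ {X Y : Subset n} e b {y} →
             y ∈ insertAt Y e b → y ∉ insertAt X e b →
             ∃[ z ] z ∈ Y × z ∉ X × insertAt X e b ∪ ⁅ y ⁆ ≡ insertAt (X ∪ ⁅ z ⁆) e b
insertAt-∖ zero b here y∉ = contradiction here y∉
insertAt-∖ zero inside  (there {i = z} p) y∉ = z , p , y∉ ∘ there , refl
insertAt-∖ zero outside (there {i = z} p) y∉ = z , p , y∉ ∘ there , refl
insertAt-∖ {X = inside  ∷ _} {_ ∷ _} (suc e) b here y∉ = contradiction here y∉
insertAt-∖ {X = outside ∷ X} {_ ∷ _} (suc e) b here y∉ =
  zero , here , (λ ()) , cong (inside ∷_)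
    (trans (Subset.∪-identityʳ _) (cong (λ Z → insertAt Z e b) (sym (Subset.∪-identityʳ X))))
insertAt-∖ {X = x ∷ X} {_ ∷ _} (suc e) b (there y∈) y∉
  with insertAt-∖ {X = X} e b y∈ (y∉ ∘ there)
... | z , z∈ , z∉ , eq =
  suc z , there z∈ , (λ { (there p) → z∉ p }) , cong (_ ∷_) eq

infixl 8 _/_

-- X is independent in M / e when X ∪ B is independent in M, where B is the
-- maximal independent subset of ⁅ e ⁆: it is ⁅ e ⁆ itself unless e is a loop.
-- The remaining elements are renumbered by punchIn e.
_/_ : Matroid (suc n) → Fin (suc n) → Matroid n
M / e = record
  { Indep   = λ X → Indep M (insertAt X e b)
  ; indep?  = λ X → indep? M (insertAt X e b)
  ; ⊥-indep = ⊥-indep/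
  ; ⊆-indep = λ X⊆Y → ⊆-indep M (insertAt-⊆ e b X⊆Y)
  ; augment = λ {X} {Y} iX iY lt →
      let y , y∈ , y∉ , i = augment M iX iY
            (subst₂ _<_ (sym (insertAt-size X e b)) (sym (insertAt-size Y e b))
              (∷-size-< {X = X} {Y = Y} b lt))
          z , z∈ , z∉ , eq = insertAt-∖ e b y∈ y∉
      in z , z∈ , z∉ , subst (Indep M) eq i
  }
  where
  b = does (indep? M ⁅ e ⁆)

  ⊥-indep/ : Indep M (insertAt ⊥ e b)
  ⊥-indep/ with indep? M ⁅ e ⁆
  ... | yes i = subst (Indep M) (sym (insertAt-inside-⊥ e)) i
  ... | no  _ = subst (Indep M) (sym (insertAt-outside-⊥ e)) (⊥-indep M)

unembed : (S D : Subset n) → D ⊆ S → ∃[ D′ ] D ≡ embed S D′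
unembed [] [] _ = [] , refl
unembed (inside ∷ S) (d ∷ D) D⊆S with unembed S D (Subset.drop-∷-⊆ D⊆S)
... | D′ , eq = d ∷ D′ , cong (d ∷_) eq
unembed (outside ∷ S) (inside ∷ D) D⊆S with D⊆S here
... | ()
unembed (outside ∷ S) (outside ∷ D) D⊆S with unembed S D (Subset.drop-∷-⊆ D⊆S)
... | D′ , eq = D′ , cong (outside ∷_) eq

index : (S : Subset n) {x : Fin n} → x ∈ S → Fin ∣ S ∣
index (inside  ∷ S) here      = zero
index (inside  ∷ S) (there p) = suc (index S p)
index (outside ∷ S) (there p) = index S p

index-∈ : (S : Subset n) {x : Fin n} (p : x ∈ S) {X : Subset ∣ S ∣} →
          index S p ∈ X → x ∈ embed S X
index-∈ (inside  ∷ S) here      {_ ∷ _} here      = here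
index-∈ (inside  ∷ S) (there p) {_ ∷ _} (there q) = there (index-∈ S p q)
index-∈ (outside ∷ S) (there p)         q         = there (index-∈ S p q)

index-injective : (S : Subset n) {x y : Fin n} (p : x ∈ S) (q : y ∈ S) →
                  index S p ≡ index S q → x ≡ y
index-injective (inside  ∷ S) here      here      _  = refl
index-injective (inside  ∷ S) (there p) (there q) eq =
  cong suc (index-injective S p q (Fin.suc-injective eq))
index-injective (outside ∷ S) (there p) (there q) eq =
  cong suc (index-injective S p q eq)

embed-circuit : (M : Matroid n) (S : Subset n) {C : Subset ∣ S ∣} →
                (∀ {x} → x ∈ S) → Circuit (M ∣ S) C → Circuit M (embed S C)
embed-circuit M S {C} full (dep , minimal) = dep , λ D (D⊆ , y , y∈ , y∉) →
  let D′ , D≡ = unembed S D (λ _ → full)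
      z , z∈ , z∉ , _ = embed-∖ S {D′} y∈ (y∉ ∘ subst (y ∈_) (sym D≡))
  in subst (Indep M) (sym D≡)
       (minimal D′ (embed-⊆⁻ S (D⊆ ∘ subst (_ ∈_) (sym D≡)) , z , z∈ , z∉))

connected⁻ : (M : Matroid n) (S : Subset n) →
             (∀ {x} → x ∈ S) → Connected (M ∣ S) → Connected M
connected⁻ M S full conn x y x≢y
  with conn (index S {x} full) (index S {y} full) (x≢y ∘ index-injective S full full)
... | C , circ , x∈ , y∈ =
  embed S C , embed-circuit M S full circ , index-∈ S full x∈ , index-∈ S full y∈

component-< : (M : Matroid n) → ¬ Connected M → ∀ {S} → Component M S → ∣ S ∣ < n
component-< {n} M ¬conn {S} (_ , conn , _) = ℕ.≤∧≢⇒< (Subset.∣p∣≤n S) λ size →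
  ¬conn (connected⁻ M S (subst (_ ∈_) (sym (Subset.∣p∣≡n⇒p≡⊤ size)) Subset.∈⊤) conn)

-- The clause for the empty ground set is never reached from a non-empty one, as
-- components are non-empty and elements are contracted only if n ≥ 2.  The first
-- arguments of min and max are included in the extremum.
cdAcc : ∀ {n} → Acc _<_ n → Matroid n → ℕ
cdAcc {zero}        _        M = 0
cdAcc {suc zero}    _        M = 1
cdAcc {suc (suc n)} (acc rs) M with connected? M
... | yes _     = suc (min (contract zero) (map contract (allFin (suc (suc n)))))
  where
  contract : Fin (suc (suc n)) → ℕ
  contract e = cdAcc (rs (ℕ.n<1+n (suc n))) (M / e)
... | no  ¬conn = max 0 (map restrict (components M))
  where
  restrict : ∃ (Component M) → ℕ
  restrict (S , comp) = cdAcc (rs (component-< M ¬conn comp)) (M ∣ S)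

cd : Matroid n → ℕ
cd {n} = cdAcc (<-wellFounded n)

data Tree : Set where
  node : ∀ {k} → (Fin k → Tree) → Tree

data Vertex : Tree → Set where
  root  : ∀ {t} → Vertex t
  child : ∀ {k} {ts : Fin k → Tree} (i : Fin k) → Vertex (ts i) → Vertex (node ts)

vertices : (t : Tree) → List (Vertex t)
vertices (node {k} ts) = root ∷ concatMap (λ i → map (child i) (vertices (ts i))) (allFin k)

#children : {t : Tree} → Vertex t → ℕ
#children {node {k} ts} root        = k
#children               (child _ v) = #children v

Leaf : {t : Tree} → Vertex t → Set
Leaf v = #children v ≡ 0

-- The number of edges on the path from the root.
level : {t : Tree} → Vertex t → ℕ
level root        = 0
level (child _ v) = suc (level v)

depth : Tree → ℕ
depth t = max 0 (map level (filter (λ v → #children v ℕ.≟ 0) (vertices t)))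

-- u ◁ v when u is the parent of v.
infix 4 _◁_

data _◁_ : {t : Tree} → Vertex t → Vertex t → Set where
  root  : ∀ {k} {ts : Fin k → Tree} {i : Fin k} → root {node ts} ◁ child i root
  child : ∀ {k} {ts : Fin k → Tree} {i : Fin k} {u v : Vertex (ts i)} →
          u ◁ v → child {ts = ts} i u ◁ child i v

-- u ≼ v when u lies on the path from the root to v.
infix 4 _≼_ _≼?_

data _≼_ : {t : Tree} → Vertex t → Vertex t → Set where
  root  : ∀ {t} {v : Vertex t} → root ≼ v
  child : ∀ {k} {ts : Fin k → Tree} {i : Fin k} {u v : Vertex (ts i)} →
          u ≼ v → child {ts = ts} i u ≼ child i v

_≼?_ : {t : Tree} (u v : Vertex t) → Dec (u ≼ v)
root      ≼? v         = yes root
child i u ≼? root      = no λ ()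
child i u ≼? child j v with i Fin.≟ j
... | no  i≢j  = no λ { (child _) → i≢j refl }
... | yes refl = map′ child (λ { (child p) → p }) (u ≼? v)

root? : {t : Tree} (v : Vertex t) → Dec (v ≡ root)
root? root        = yes refl
root? (child _ _) = no λ ()

-- The vertices of T⟨A⟩: those on the path from the root to some vertex of A.
_∈⟨_⟩ : {t : Tree} → Vertex t → List (Vertex t) → Set
v ∈⟨ A ⟩ = Any (v ≼_) (root ∷ A)

_∈⟨_⟩? : {t : Tree} (v : Vertex t) (A : List (Vertex t)) → Dec (v ∈⟨ A ⟩)
v ∈⟨ A ⟩? = any? (v ≼?_) (root ∷ A)

-- Edges are identified with their lower ends, the vertices other than the root.
edges : Tree → ℕ
edges t = length (filter (¬? ∘ root?) (vertices t))

edges⟨_⟩ : {t : Tree} → List (Vertex t) → ℕ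
edges⟨_⟩ {t} A = length (filter (λ v → ¬? (root? v) ×-dec v ∈⟨ A ⟩?) (vertices t))

-- Membership in a subtree of t containing the root; connectedness amounts to
-- closure under parents.
record RootedSubtree {t : Tree} (P : Pred (Vertex t) 0ℓ) : Set where
  field
    has-root   : P root
    has-parent : ∀ {u v} → u ◁ v → P v → P u

open RootedSubtree public

≼-refl : {t : Tree} (v : Vertex t) → v ≼ v
≼-refl root        = root
≼-refl (child i v) = child (≼-refl v)

≼-trans : {t : Tree} {u v w : Vertex t} → u ≼ v → v ≼ w → u ≼ w
≼-trans root      _         = root
≼-trans (child p) (child q) = child (≼-trans p q)

◁⇒≼ : {t : Tree} {u v : Vertex t} → u ◁ v → u ≼ v
◁⇒≼ root      = root
◁⇒≼ (child p) = child (◁⇒≼ p)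

Closed : {t : Tree} → Pred (Vertex t) 0ℓ → Set
Closed P = ∀ {u v} → u ◁ v → P v → P u

closed-root : {t : Tree} (P : Pred (Vertex t) 0ℓ) → Closed P → ∀ v → P v → P root
closed-root P cl root        p = p
closed-root P cl (child i v) p = cl root (closed-root (P ∘ child i) (cl ∘ child) v p)

closed-≼ : {t : Tree} (P : Pred (Vertex t) 0ℓ) → Closed P → ∀ {u v} → u ≼ v → P v → P u
closed-≼ P cl {v = v} root              p = closed-root P cl v p
closed-≼ P cl         (child {i = i} q) p = closed-≼ (P ∘ child i) (cl ∘ child) q p

⟨⟩-subtree : {t : Tree} (A : List (Vertex t)) → RootedSubtree (_∈⟨ A ⟩)
⟨⟩-subtree A = record
  { has-root   = here root
  ; has-parent = λ u◁v → Any.map (≼-trans (◁⇒≼ u◁v))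
  }

⟨⟩-⊇ : {t : Tree} {A : List (Vertex t)} {a : Vertex t} → a ∈ₗ A → a ∈⟨ A ⟩
⟨⟩-⊇ {a = a} a∈A = there (Any.map (λ { refl → ≼-refl a }) a∈A)

⟨⟩-smallest : {t : Tree} {A : List (Vertex t)} {P : Pred (Vertex t) 0ℓ} → RootedSubtree P →
              (∀ {a} → a ∈ₗ A → P a) → ∀ {v} → v ∈⟨ A ⟩ → P v
⟨⟩-smallest {P = P} R A⊆P v∈ with find v∈
... | _ , here refl , v≼a = closed-≼ P (has-parent R) v≼a (has-root R)
... | _ , there a∈A , v≼a = closed-≼ P (has-parent R) v≼a (A⊆P a∈A)

image : {A : Set} → (Fin n → A) → Subset n → List A
image {n} f X = map f (filter (Subset._∈? X) (allFin n))

record Contraction*Decomposition (M : Matroid n) : Set where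
  field
    tree    : Tree
    edges≡  : edges tree ≡ rank M ⊤
    f       : Fin n → Vertex tree
    f-leaf  : ∀ x → Leaf (f x)
    rank≤   : ∀ X → rank M X ≤ edges⟨ image f X ⟩

open Contraction*Decomposition public

IsContraction*Depth : Matroid n → Pred ℕ 0ℓ
IsContraction*Depth M = IsMinimum λ d → Σ[ D ∈ Contraction*Decomposition M ] depth (tree D) ≡ d

IsMinimumExtensionDepth : Matroid n → Pred ℕ (Level.suc 0ℓ)
IsMinimumExtensionDepth M = IsMinimum λ d → ∃[ m ] Σ[ M′ ∈ Matroid m ] M ⊑ M′ × cd M′ ≡ d

OnlyLoops : Matroid n → Set
OnlyLoops M = ∀ x → Loop M x

OnlyLoopsOrColoops : Matroid n → Set
OnlyLoopsOrColoops M = ∀ x → Loop M x ⊎ Coloop M x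

{-# OPTIONS --safe #-}
module Submission where

-- Both depths are characterised by recursions on rank functions.  The restriction
-- of ρ to S has contraction*-depth at most d (Cd*≤ ρ S d) when its rank is zero, when
-- it is a direct sum of two such matroids, or when it has an elementary quotient of
-- contraction*-depth less than d; the recursion Cd≤ for the contraction-depth replaces
-- elementary quotients by contractions of elements.
--
-- The key step reads off a quotient from a decomposition whose root has a stem of ℓ
-- edges below which the tree branches into two parts with element sets α and β.  If both
-- α and β attain the rank allowed by the tree, then ρ/β ⊕ ρ/α is a quotient of ρ of
-- rank ℓ less, and it obeys the bounds of the tree without the stem.  If β does not,
-- then by submodularity no non-empty subset of β does, so that the last edge of the stem
-- may be moved into the branch of α.
--
-- An elementary quotient σ of ρ is realised by an element p with ρ/p = σ, and an extension
-- of σ lifts, by a Higgs lift, to an extension of ρ + p; hence cd M′ ≤ c*d M + 1 for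
-- some M′ ⊒ M.  Conversely, contractions create no coloops, so after setting the coloops
-- of M′ aside the recursion for M′ ends in loops, which saves the last unit of depth.
-- Since elementary quotients of a finite matroid can be enumerated, c*d is computable,
-- and so its minimum exists.

open import Defs
open import Data.Bool.Base using (Bool; true; false; _∧_; _∨_; not; T; if_then_else_)
import Data.Bool.Properties as Bool
open import Data.Fin.Base using (Fin; zero; suc; _↑ˡ_; _↑ʳ_; splitAt; punchIn; punchOut)
import Data.Fin.Properties as Fin
open import Data.Fin.Subset
  using (Subset; inside; outside; ⊤; ⊥; ∁; ⁅_⁆; _∈_; _∉_; _⊆_; _⊂_; _∪_; _∩_; _─_; ∣_∣; Nonempty; Empty)
open import Data.Fin.Subset.Properties
open import Data.List.Base as List using (List; []; _∷_; _++_; map; filter; concatMap; mapMaybe; length; allFin)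
open import Data.List.Extrema.Nat using (max; min; max≤v⁺; v≤max⁺; min≤v⁺; argmax-sel; argmin-sel)
open import Data.List.Membership.Propositional using (lose) renaming (_∈_ to _∈ₗ_; find to findₗ)
import Data.List.Membership.Propositional.Properties as ∈ₗ
import Data.List.Properties as List
import Data.List.Relation.Unary.All as All
import Data.List.Relation.Unary.All.Properties as All
open import Data.List.Relation.Unary.Any using (here; there)
import Data.Maybe.Base as Maybe
open import Data.Nat.Base using (ℕ; zero; suc; _+_; _*_; _∸_; _≤_; _<_; _≤ᵇ_; z≤n; s≤s; NonZero)
open import Data.Nat.Induction using (Acc; acc; <-wellFounded)
import Data.Nat.Base as ℕ
import Data.Nat.Properties as ℕ
open import Data.Nat.Properties
  using (≤-trans; ≤-reflexive; ≤-antisym; ≤-refl; +-mono-≤; +-monoʳ-≤; +-monoˡ-≤; ≰⇒>; ≮⇒≥; +-suc; +-identityʳ; +-comm)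
open import Data.Nat.Tactic.RingSolver using (solve-∀)
open import Data.Product.Base using (_×_; _,_; proj₁; proj₂; ∃; ∃-syntax; Σ-syntax)
open import Data.Sum.Base using (_⊎_; inj₁; inj₂; [_,_]′)
open import Data.Unit.Base using (tt)
open import Data.Vec.Base as Vec using (Vec; []; _∷_; here; there; lookup; tabulate; insertAt; removeAt)
open import Data.Vec.N-ary using (N-ary; _$ⁿ_)
import Data.Vec.Properties as Vec
open import Function.Base using (_∘_; id)
open import Function.Bundles using (mk⇔; mk⤖; module Equivalence; module Bijection)
open import Function.Consequences.Propositional using (strictlySurjective⇒surjective)
open import Function.Definitions using (Injective)
open import Algebra.Properties.CommutativeSemigroup ℕ.+-commutativeSemigroup using (interchange)
open import Level using (0ℓ)
open import Relation.Binary.PropositionalEquality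
  using (_≡_; _≢_; refl; sym; trans; cong; cong₂; subst; subst₂; module ≡-Reasoning)
open import Relation.Nullary.Decidable
  using (Dec; yes; no; does; map′; _×-dec_; _→-dec_; ¬?; dec-true; dec-false; dec⇒maybe; decidable-stable)
open import Relation.Nullary.Negation using (¬_; contradiction)
open import Relation.Unary using (Decidable; Pred)

-- Rank functions carry the argument because contraction then keeps the ground set, turning
-- contracted elements into loops; renumbering is confined to the passage from and to `Matroid`.
-- Both recursions are more liberal than the notions that they describe: summands may be empty, a
-- quotient may keep the rank, and an element may be contracted from a disconnected set. Bounds are
-- thereby easy to combine, and the recursion of `cd` itself has to be recovered. The obstacle there
-- is that `cd` speaks of circuits and of maximal connected sets, the recursion of separations;
-- Tutte's theorem on deletion and contraction links the two. Contraction-depth is not monotone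
-- under restriction: a circuit of n elements has contraction-depth n, and extensions may lower it.
-- A bound for an extension is therefore turned into a bound for `Cd*≤`, which is monotone, on all
-- subsets at once. The offset of one arises at the ends of the recursions: `Cd*≤` stops at rank
-- zero with depth 0, `Cd≤` at single elements with depth 1. Direct sums and quotients cost the same
-- in both.

private
  variable
    k m n : ℕ
    A B C R S X Y Z : Subset n

-- Automation for inclusions of sets

module SetSolver where

  infixr 7 _⊓_
  infixr 6 _⊔_
  infixl 5 _∖_
  infix  4 _⋐_
  infixr 3 _⇒_
  infix  3 ⊢_

  data Expr (k : ℕ) : Set where
    var         : Fin k → Expr k
    ∅           : Expr k
    _⊓_ _⊔_ _∖_ : Expr k → Expr k → Expr k

  data Inclusion (k : ℕ) : Set where
    _⋐_ : Expr k → Expr k → Inclusion k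

  data Problem (k : ℕ) : Set where
    ⊢_  : Inclusion k → Problem k
    _⇒_ : Inclusion k → Problem k → Problem k

  ⟦_⟧ : Expr k → Vec (Subset n) k → Subset n
  ⟦ var i ⟧ γ = lookup γ i
  ⟦ ∅ ⟧ γ     = ⊥
  ⟦ a ⊓ b ⟧ γ = ⟦ a ⟧ γ ∩ ⟦ b ⟧ γ
  ⟦ a ⊔ b ⟧ γ = ⟦ a ⟧ γ ∪ ⟦ b ⟧ γ
  ⟦ a ∖ b ⟧ γ = ⟦ a ⟧ γ ─ ⟦ b ⟧ γ

  ⟦_⟧ᵖ : Problem k → Vec (Subset n) k → Set
  ⟦ ⊢ a ⋐ b ⟧ᵖ γ   = ⟦ a ⟧ γ ⊆ ⟦ b ⟧ γ
  ⟦ a ⋐ b ⇒ p ⟧ᵖ γ = ⟦ a ⟧ γ ⊆ ⟦ b ⟧ γ → ⟦ p ⟧ᵖ γ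

  eval : Expr k → Vec Bool k → Bool
  eval (var i) v = lookup v i
  eval ∅       v = false
  eval (a ⊓ b) v = eval a v ∧ eval b v
  eval (a ⊔ b) v = eval a v ∨ eval b v
  eval (a ∖ b) v = eval a v ∧ not (eval b v)

  evalᵖ : Problem k → Vec Bool k → Bool
  evalᵖ (⊢ a ⋐ b)   v = not (eval a v) ∨ eval b v
  evalᵖ (a ⋐ b ⇒ p) v = not (not (eval a v) ∨ eval b v) ∨ evalᵖ p v

  valid : ∀ k → (Vec Bool k → Bool) → Bool
  valid zero    p = p []
  valid (suc k) p = valid k (p ∘ (true ∷_)) ∧ valid k (p ∘ (false ∷_))

  valid-sound : ∀ k p → T (valid k p) → ∀ v → T (p v)
  valid-sound zero    p t [] = t
  valid-sound (suc k) p t (true  ∷ v) = valid-sound k _ (proj₁ (Equivalence.to Bool.T-∧ t)) v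
  valid-sound (suc k) p t (false ∷ v) =
    valid-sound k _ (proj₂ (Equivalence.to (Bool.T-∧ {valid k (p ∘ (true ∷_))}) t)) v

  lookup-─ : ∀ (p q : Subset n) i → lookup (p ─ q) i ≡ lookup p i ∧ not (lookup q i)
  lookup-─ (true  ∷ p) (true  ∷ q) zero = refl
  lookup-─ (true  ∷ p) (false ∷ q) zero = refl
  lookup-─ (false ∷ p) (true  ∷ q) zero = refl
  lookup-─ (false ∷ p) (false ∷ q) zero = refl
  lookup-─ (_ ∷ p) (_ ∷ q) (suc i) = lookup-─ p q i

  lookup-eval : ∀ (e : Expr k) (γ : Vec (Subset n) k) i →
                lookup (⟦ e ⟧ γ) i ≡ eval e (Vec.map (λ S → lookup S i) γ)
  lookup-eval (var j) γ i = sym (Vec.lookup-map j (λ S → lookup S i) γ)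
  lookup-eval ∅       γ i = Vec.lookup-replicate i false
  lookup-eval (a ⊓ b) γ i = trans (Vec.lookup-zipWith _∧_ i (⟦ a ⟧ γ) (⟦ b ⟧ γ))
    (cong₂ _∧_ (lookup-eval a γ i) (lookup-eval b γ i))
  lookup-eval (a ⊔ b) γ i = trans (Vec.lookup-zipWith _∨_ i (⟦ a ⟧ γ) (⟦ b ⟧ γ))
    (cong₂ _∨_ (lookup-eval a γ i) (lookup-eval b γ i))
  lookup-eval (a ∖ b) γ i = trans (lookup-─ (⟦ a ⟧ γ) (⟦ b ⟧ γ) i)
    (cong₂ (λ x y → x ∧ not y) (lookup-eval a γ i) (lookup-eval b γ i))

  private
    implies⁺ : ∀ {x y : Bool} → (x ≡ true → y ≡ true) → T (not x ∨ y)
    implies⁺ {false} f = tt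
    implies⁺ {true}  f = Equivalence.from Bool.T-≡ (f refl)

    implies⁻ : ∀ {x y : Bool} → T (not x ∨ y) → T x → T y
    implies⁻ {true} t _ = t

  pointwise : (p : Problem k) (γ : Vec (Subset n) k) →
              (∀ i → T (evalᵖ p (Vec.map (λ S → lookup S i) γ))) → ⟦ p ⟧ᵖ γ
  pointwise (⊢ a ⋐ b) γ t {i} i∈a = Vec.lookup⇒[]= i _ (trans (lookup-eval b γ i)
    (Equivalence.to Bool.T-≡ (implies⁻ (t i) (Equivalence.from Bool.T-≡
      (trans (sym (lookup-eval a γ i)) (Vec.[]=⇒lookup i∈a))))))
  pointwise (a ⋐ b ⇒ p) γ t a⊆b = pointwise p γ λ i → implies⁻ (t i)
    (implies⁺ λ eq → trans (sym (lookup-eval b γ i)) (Vec.[]=⇒lookup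
      (a⊆b (Vec.lookup⇒[]= i _ (trans (lookup-eval a γ i) eq)))))

  -- The implicit argument is the outcome of a truth table over the membership of a single element.
  -- It reduces to the unit type when the table succeeds and is then filled in by eta; an invalid
  -- problem leaves the empty type and does not type-check.
  solve : ∀ k (f : N-ary k (Expr k) (Problem k)) → let p = f $ⁿ Vec.tabulate var in
          {T (valid k (evalᵖ p))} → (γ : Vec (Subset n) k) → ⟦ p ⟧ᵖ γ
  solve k f {t} γ = pointwise p γ λ i → valid-sound k (evalᵖ p) t _
    where p = f $ⁿ Vec.tabulate var

open SetSolver using (_⊓_; _⊔_; _∖_; _⋐_; _⇒_; ⊢_; ∅) renaming (solve to set)

-- Automation for linear inequalities

module LinearSolver where

  infixl 6 _⊕_
  infix  4 _⩽_
  infixr 3 _⇒_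
  infix  3 ⊢_

  data Expr (k : ℕ) : Set where
    var : Fin k → Expr k
    lit : ℕ → Expr k
    _⊕_ : Expr k → Expr k → Expr k

  data Inequality (k : ℕ) : Set where
    _⩽_ : Expr k → Expr k → Inequality k

  data Problem (k : ℕ) : Set where
    ⊢_  : Inequality k → Problem k
    _⇒_ : Inequality k → Problem k → Problem k

  ⟦_⟧ : Expr k → Vec ℕ k → ℕ
  ⟦ var i ⟧ γ = lookup γ i
  ⟦ lit c ⟧ γ = c
  ⟦ a ⊕ b ⟧ γ = ⟦ a ⟧ γ + ⟦ b ⟧ γ

  ⟦_⟧ᵖ : Problem k → Vec ℕ k → Set
  ⟦ ⊢ a ⩽ b ⟧ᵖ γ   = ⟦ a ⟧ γ ≤ ⟦ b ⟧ γ
  ⟦ a ⩽ b ⇒ p ⟧ᵖ γ = ⟦ a ⟧ γ ≤ ⟦ b ⟧ γ → ⟦ p ⟧ᵖ γ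

  unit : Fin k → Vec ℕ k
  unit zero    = 1 ∷ Vec.replicate _ 0
  unit (suc i) = 0 ∷ unit i

  -- The head is the constant term, so that valuations are extended by a leading 1.
  coefficients : Expr k → Vec ℕ (suc k)
  coefficients (var i) = 0 ∷ unit i
  coefficients (lit c) = c ∷ Vec.replicate _ 0
  coefficients (a ⊕ b) = Vec.zipWith _+_ (coefficients a) (coefficients b)

  _∙_ : Vec ℕ k → Vec ℕ k → ℕ
  [] ∙ []             = 0
  (x ∷ xs) ∙ (y ∷ ys) = x * y + xs ∙ ys

  _≤ᵛ_ : Vec ℕ k → Vec ℕ k → Bool
  [] ≤ᵛ []             = true
  (x ∷ xs) ≤ᵛ (y ∷ ys) = (x ≤ᵇ y) ∧ (xs ≤ᵛ ys)

  ∙-mono : ∀ (u v w : Vec ℕ k) → T (u ≤ᵛ v) → u ∙ w ≤ v ∙ w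
  ∙-mono [] [] [] _ = z≤n
  ∙-mono (x ∷ u) (y ∷ v) (z ∷ w) t =
    +-mono-≤ (ℕ.*-monoˡ-≤ z (ℕ.≤ᵇ⇒≤ x y (proj₁ (Equivalence.to Bool.T-∧ t))))
      (∙-mono u v w (proj₂ (Equivalence.to (Bool.T-∧ {x ≤ᵇ y}) t)))

  ∙-zero : ∀ (v : Vec ℕ k) → Vec.replicate k 0 ∙ v ≡ 0
  ∙-zero []      = refl
  ∙-zero (_ ∷ v) = ∙-zero v

  ∙-unit : ∀ (i : Fin k) v → unit i ∙ v ≡ lookup v i
  ∙-unit zero    (x ∷ v) = trans (cong₂ _+_ (ℕ.*-identityˡ x) (∙-zero v)) (+-identityʳ x)
  ∙-unit (suc i) (_ ∷ v) = ∙-unit i v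

  ∙-+ : ∀ (u v w : Vec ℕ k) → Vec.zipWith _+_ u v ∙ w ≡ u ∙ w + v ∙ w
  ∙-+ [] [] [] = refl
  ∙-+ (x ∷ u) (y ∷ v) (z ∷ w) rewrite ∙-+ u v w = shuffle x y z (u ∙ w) (v ∙ w)
    where
    shuffle : ∀ x y z a b → (x + y) * z + (a + b) ≡ x * z + a + (y * z + b)
    shuffle = solve-∀

  coefficients-sound : ∀ (e : Expr k) γ → ⟦ e ⟧ γ ≡ coefficients e ∙ (1 ∷ γ)
  coefficients-sound (var i) γ = sym (∙-unit i γ)
  coefficients-sound (lit c) γ =
    sym (trans (cong₂ _+_ (ℕ.*-identityʳ c) (∙-zero γ)) (+-identityʳ c))
  coefficients-sound (a ⊕ b) γ = trans
    (cong₂ _+_ (coefficients-sound a γ) (coefficients-sound b γ))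
    (sym (∙-+ (coefficients a) (coefficients b) (1 ∷ γ)))

  -- A ⩽ B is the sum of the hypotheses met so far.
  check : Expr k → Expr k → Problem k → Bool
  check A B (⊢ a ⩽ b)   = coefficients (a ⊕ B) ≤ᵛ coefficients (b ⊕ A)
  check A B (a ⩽ b ⇒ p) = check (A ⊕ a) (B ⊕ b) p

  check-sound : ∀ (A B : Expr k) p γ → T (check A B p) → ⟦ A ⟧ γ ≤ ⟦ B ⟧ γ → ⟦ p ⟧ᵖ γ
  check-sound A B (⊢ a ⩽ b) γ t A≤B = ℕ.+-cancelʳ-≤ (⟦ B ⟧ γ) _ _ (begin
    ⟦ a ⟧ γ + ⟦ B ⟧ γ               ≡⟨ coefficients-sound (a ⊕ B) γ ⟩
    coefficients (a ⊕ B) ∙ (1 ∷ γ)  ≤⟨ ∙-mono (coefficients (a ⊕ B)) (coefficients (b ⊕ A)) (1 ∷ γ) t ⟩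
    coefficients (b ⊕ A) ∙ (1 ∷ γ)  ≡⟨ coefficients-sound (b ⊕ A) γ ⟨
    ⟦ b ⟧ γ + ⟦ A ⟧ γ               ≤⟨ +-monoʳ-≤ (⟦ b ⟧ γ) A≤B ⟩
    ⟦ b ⟧ γ + ⟦ B ⟧ γ               ∎)
    where open ℕ.≤-Reasoning
  check-sound A B (a ⩽ b ⇒ p) γ t A≤B a≤b =
    check-sound (A ⊕ a) (B ⊕ b) p γ t (+-mono-≤ A≤B a≤b)

  -- A Farkas certificate with all multipliers equal to one: the sum of the hypotheses has to yield
  -- the conclusion coefficient by coefficient. Contradictions are obtained as the conclusion
  -- `lit 1 ⩽ lit 0`.
  solve : ∀ k (f : N-ary k (Expr k) (Problem k)) → let p = f $ⁿ Vec.tabulate var in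
          {T (check (lit 0) (lit 0) p)} → (γ : Vec ℕ k) → ⟦ p ⟧ᵖ γ
  solve k f {t} γ = check-sound (lit 0) (lit 0) _ γ t z≤n

open LinearSolver using (_⊕_; _⩽_; _⇒_; ⊢_; lit) renaming (solve to lin)

-- Finite sets and their sizes

∈⇒⁅⁆⊆ : ∀ {x : Fin n} → x ∈ X → ⁅ x ⁆ ⊆ X
∈⇒⁅⁆⊆ {x = x} x∈X y∈ rewrite x∈⁅y⁆⇒x≡y x y∈ = x∈X

∉⇒⁅⁆∩⊆⊥ : ∀ {x : Fin n} → x ∉ X → ⁅ x ⁆ ∩ X ⊆ ⊥
∉⇒⁅⁆∩⊆⊥ {X = X} {x} x∉X y∈ with x∈p∩q⁻ ⁅ x ⁆ X y∈
... | y∈x , y∈X rewrite x∈⁅y⁆⇒x≡y x y∈x = contradiction y∈X x∉X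

Empty⇒⊆⊥ : Empty X → X ⊆ ⊥
Empty⇒⊆⊥ e x∈X = contradiction (_ , x∈X) e

x∈p─q⇒x∉q : ∀ {x} (p q : Subset n) → x ∈ p ─ q → x ∉ q
x∈p─q⇒x∉q {x = x} p q x∈ x∈q = ∉⊥ (set 2 (λ p q → ⊢ (p ∖ q) ⊓ q ⋐ ∅) (p ∷ q ∷ [])
  (x∈p∩q⁺ (x∈ , x∈q)))

⊆∩∪─ : ∀ (S A : Subset n) → S ⊆ S ∩ A ∪ (S ─ A)
⊆∩∪─ S A = set 2 (λ S A → ⊢ S ⋐ S ⊓ A ⊔ (S ∖ A)) (S ∷ A ∷ [])

∣∪∣+∣∩∣ : ∀ (X Y : Subset n) → ∣ X ∪ Y ∣ + ∣ X ∩ Y ∣ ≡ ∣ X ∣ + ∣ Y ∣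
∣∪∣+∣∩∣ []            []            = refl
∣∪∣+∣∩∣ (inside  ∷ X) (inside  ∷ Y) =
  cong suc (trans (+-suc _ _) (trans (cong suc (∣∪∣+∣∩∣ X Y)) (sym (+-suc _ _))))
∣∪∣+∣∩∣ (inside  ∷ X) (outside ∷ Y) = cong suc (∣∪∣+∣∩∣ X Y)
∣∪∣+∣∩∣ (outside ∷ X) (inside  ∷ Y) = trans (cong suc (∣∪∣+∣∩∣ X Y)) (sym (+-suc _ _))
∣∪∣+∣∩∣ (outside ∷ X) (outside ∷ Y) = ∣∪∣+∣∩∣ X Y

∣∣-supermodular : A ∪ B ⊆ C → A ∩ B ⊆ X → ∣ A ∣ + ∣ B ∣ ≤ ∣ C ∣ + ∣ X ∣
∣∣-supermodular {A = A} {B} ∪⊆ ∩⊆ = ≤-trans (≤-reflexive (sym (∣∪∣+∣∩∣ A B)))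
  (+-mono-≤ (p⊆q⇒∣p∣≤∣q∣ ∪⊆) (p⊆q⇒∣p∣≤∣q∣ ∩⊆))

∣∣-disjoint : ∀ {n} {A B C : Subset n} → A ∪ B ⊆ C → A ∩ B ⊆ ⊥ → ∣ A ∣ + ∣ B ∣ ≤ ∣ C ∣
∣∣-disjoint {n} {A} {B} {C} ∪⊆ ∩⊆ = subst (∣ A ∣ + ∣ B ∣ ≤_)
  (trans (cong (∣ C ∣ +_) (∣⊥∣≡0 n)) (+-identityʳ _)) (∣∣-supermodular {X = ⊥} ∪⊆ ∩⊆)

⊆∧∣∣≤⇒⊇ : X ⊆ Y → ∣ Y ∣ ≤ ∣ X ∣ → Y ⊆ X
⊆∧∣∣≤⇒⊇ {X = X} {Y} X⊆Y ∣Y∣≤ {x} x∈Y with x ∈? X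
... | yes x∈X = x∈X
... | no  x∉X = contradiction ∣Y∣≤ (ℕ.<⇒≱ (p⊂q⇒∣p∣<∣q∣ (X⊆Y , x , x∈Y , x∉X)))

subset-induction : ∀ {n} {ℓ} (P : Subset n → Set ℓ) → P ⊥ →
                   (∀ {X x} → x ∉ X → P X → P (X ∪ ⁅ x ⁆)) → ∀ X → P X
subset-induction {zero} P base step []  = base
subset-induction {suc n} P base step (b ∷ X) = go b
  where
  out : P (outside ∷ X)
  out = subset-induction (P ∘ (outside ∷_)) base
    (λ x∉ → step (x∉ ∘ drop-there)) X
  go : ∀ b → P (b ∷ X)
  go outside = out
  go inside  = subst (P ∘ (inside ∷_)) (∪-identityʳ X) (step {outside ∷ X} {zero} (λ ()) out)

-- Rank functions

-- The unit bound is asked of singletons only; submodularity spreads it to `rk≤∣∣`, so that these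
-- are exactly the rank functions of matroids on `Fin n`. Restrictions are expressed by carrying a
-- set `S` along.
record RankFunction (n : ℕ) : Set where
  field
    rk      : Subset n → ℕ
    rk-⊥    : rk ⊥ ≡ 0
    rk-⁅⁆   : ∀ x → rk ⁅ x ⁆ ≤ 1
    rk-mono : ∀ {X Y} → X ⊆ Y → rk X ≤ rk Y
    rk-sub  : ∀ X Y → rk (X ∪ Y) + rk (X ∩ Y) ≤ rk X + rk Y

  -- Inclusions instead of equalities spare all set identities: both premises are goals for the set
  -- solver.
  submodular : C ⊆ A ∪ B → X ⊆ A ∩ B → rk C + rk X ≤ rk A + rk B
  submodular {A = A} {B} C⊆ X⊆ =
    ≤-trans (+-mono-≤ (rk-mono C⊆) (rk-mono X⊆)) (rk-sub A B)

  subadditive : C ⊆ A ∪ B → rk C ≤ rk A + rk B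
  subadditive C⊆ = ≤-trans (ℕ.m≤m+n _ _) (submodular C⊆ ⊥⊆)

  rk-⊆⊥ : X ⊆ ⊥ → rk X ≡ 0
  rk-⊆⊥ X⊆⊥ = ℕ.n≤0⇒n≡0 (≤-trans (rk-mono X⊆⊥) (≤-reflexive rk-⊥))

  rk-∪⁅⁆ : ∀ X x → rk (X ∪ ⁅ x ⁆) ≤ suc (rk X)
  rk-∪⁅⁆ X x = ≤-trans (subadditive id)
    (≤-trans (+-monoʳ-≤ (rk X) (rk-⁅⁆ x)) (≤-reflexive (+-comm (rk X) 1)))

  rk-subsingleton : (∀ {x y} → x ∈ X → y ∈ X → x ≡ y) → rk X ≤ 1
  rk-subsingleton {X} sub with nonempty? X
  ... | yes (x , x∈X) = ≤-trans
    (rk-mono (λ y∈X → subst (_∈ ⁅ x ⁆) (sub x∈X y∈X) (x∈⁅x⁆ x))) (rk-⁅⁆ x)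
  ... | no  empty     = ≤-trans (≤-reflexive (rk-⊆⊥ (Empty⇒⊆⊥ empty))) z≤n

  rk≤∣∣ : ∀ X → rk X ≤ ∣ X ∣
  rk≤∣∣ = subset-induction _ (≤-trans (≤-reflexive rk-⊥) z≤n) λ {X} {x} x∉X le →
    ≤-trans (rk-∪⁅⁆ X x) (≤-trans (s≤s le)
      (p⊂q⇒∣p∣<∣q∣ (p⊆p∪q _ , x , x∈p∪q⁺ (inj₂ (x∈⁅x⁆ x)) , x∉X)))

  -- If `X ∪ Y` and `X ∪ ⁅ y ⁆` both have the rank of X, then so has their union, by submodularity
  -- over the common part X.
  rk-closure : (∀ {y} → y ∈ Y → rk (X ∪ ⁅ y ⁆) ≤ rk X) → rk (X ∪ Y) ≤ rk X
  rk-closure {Y} {X} = subset-induction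
    (λ Y → (∀ {y} → y ∈ Y → rk (X ∪ ⁅ y ⁆) ≤ rk X) → rk (X ∪ Y) ≤ rk X)
    (λ _ → rk-mono (set 1 (λ X → ⊢ X ⊔ ∅ ⋐ X) (X ∷ [])))
    (λ {Y} {y} _ ih h → lin 4 (λ a b c d → a ⊕ b ⩽ c ⊕ d ⇒ c ⩽ b ⇒ d ⩽ b ⇒ ⊢ a ⩽ b)
      (_ ∷ _ ∷ _ ∷ _ ∷ [])
      (submodular {C = X ∪ Y ∪ ⁅ y ⁆} {X ∪ Y} {X ∪ ⁅ y ⁆}
        (set 3 (λ X Y y → ⊢ X ⊔ Y ⊔ y ⋐ (X ⊔ Y) ⊔ X ⊔ y) (X ∷ Y ∷ ⁅ y ⁆ ∷ []))
        (set 3 (λ X Y y → ⊢ X ⋐ (X ⊔ Y) ⊓ (X ⊔ y)) (X ∷ Y ∷ ⁅ y ⁆ ∷ [])))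
      (ih (h ∘ p⊆p∪q _)) (h (q⊆p∪q Y _ (x∈⁅x⁆ y)))) Y

open RankFunction

-- The opposite inequality is subadditivity, so this says that ρ restricted to S is a direct sum. A
-- need not lie in S, and either part may be empty.
Separates : RankFunction n → Subset n → Subset n → Set
Separates ρ S A = rk ρ (S ∩ A) + rk ρ (S ─ A) ≤ rk ρ S

-- Submodularity is applied twice, passing between S and X through `(S ∩ A) ∪ X`: once for the part
-- in A and once for the rest.
Separates-⊆ : ∀ (ρ : RankFunction n) → Separates ρ S A → X ⊆ S → Separates ρ X A
Separates-⊆ {S = S} {A} {X} ρ sep X⊆S =
  lin 7 (λ α β s x xα xβ u → α ⊕ β ⩽ s ⇒ u ⊕ xα ⩽ α ⊕ x ⇒ s ⊕ xβ ⩽ u ⊕ β ⇒ ⊢ xα ⊕ xβ ⩽ x)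
    (_ ∷ _ ∷ _ ∷ rk ρ X ∷ _ ∷ _ ∷ rk ρ ((S ∩ A) ∪ X) ∷ []) sep
    (submodular ρ {C = (S ∩ A) ∪ X} {S ∩ A} {X} {X ∩ A} id
      (set 3 (λ S A X → X ⋐ S ⇒ ⊢ X ⊓ A ⋐ (S ⊓ A) ⊓ X) (S ∷ A ∷ X ∷ []) X⊆S))
    (submodular ρ {C = S} {(S ∩ A) ∪ X} {S ─ A} {X ─ A}
      (set 3 (λ S A X → ⊢ S ⋐ (S ⊓ A ⊔ X) ⊔ (S ∖ A)) (S ∷ A ∷ X ∷ []))
      (set 3 (λ S A X → X ⋐ S ⇒ ⊢ X ∖ A ⋐ (S ⊓ A ⊔ X) ⊓ (S ∖ A)) (S ∷ A ∷ X ∷ []) X⊆S))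

Separates-∁ : ∀ (ρ : RankFunction n) → Separates ρ S A → Separates ρ S (S ─ A)
Separates-∁ {S = S} {A} ρ sep = ≤-trans (≤-reflexive (+-comm (rk ρ (S ∩ (S ─ A))) _))
  (≤-trans (+-mono-≤
    (rk-mono ρ (set 2 (λ S A → ⊢ S ∖ (S ∖ A) ⋐ S ⊓ A) (S ∷ A ∷ [])))
    (rk-mono ρ (set 2 (λ S A → ⊢ S ⊓ (S ∖ A) ⋐ S ∖ A) (S ∷ A ∷ [])))) sep)

cardinality : ∀ n → RankFunction n
cardinality n = record
  { rk      = ∣_∣
  ; rk-⊥    = ∣⊥∣≡0 n
  ; rk-⁅⁆   = λ x → ≤-reflexive (∣⁅x⁆∣≡1 x)
  ; rk-mono = p⊆q⇒∣p∣≤∣q∣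
  ; rk-sub  = λ X Y → ≤-reflexive (∣∪∣+∣∩∣ X Y)
  }

restrict : Subset n → RankFunction n → RankFunction n
restrict S ρ = record
  { rk      = λ X → rk ρ (X ∩ S)
  ; rk-⊥    = rk-⊆⊥ ρ (p∩q⊆p ⊥ S)
  ; rk-⁅⁆   = λ x → ≤-trans (rk-mono ρ (p∩q⊆p ⁅ x ⁆ S)) (rk-⁅⁆ ρ x)
  ; rk-mono = λ {X} {Y} X⊆Y → rk-mono ρ
      (set 3 (λ X Y S → X ⋐ Y ⇒ ⊢ X ⊓ S ⋐ Y ⊓ S) (X ∷ Y ∷ S ∷ []) X⊆Y)
  ; rk-sub  = λ X Y → submodular ρ
      (set 3 (λ X Y S → ⊢ (X ⊔ Y) ⊓ S ⋐ X ⊓ S ⊔ Y ⊓ S) (X ∷ Y ∷ S ∷ []))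
      (set 3 (λ X Y S → ⊢ (X ⊓ Y) ⊓ S ⋐ (X ⊓ S) ⊓ (Y ⊓ S)) (X ∷ Y ∷ S ∷ []))
  }

-- The ground set is kept: the elements of B become loops.
contract : Subset n → RankFunction n → RankFunction n
contract B ρ = record
  { rk      = λ X → rk ρ (X ∪ B) ∸ rk ρ B
  ; rk-⊥    = ℕ.m≤n⇒m∸n≡0 (rk-mono ρ (set 1 (λ B → ⊢ ∅ ⊔ B ⋐ B) (B ∷ [])))
  ; rk-⁅⁆   = λ x → ℕ.m≤n+o⇒m∸n≤o _ (rk ρ B) (≤-trans (≤-trans (rk-mono ρ
      (set 2 (λ B x → ⊢ x ⊔ B ⋐ B ⊔ x) (B ∷ ⁅ x ⁆ ∷ []))) (rk-∪⁅⁆ ρ B x))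
      (≤-reflexive (+-comm 1 _)))
  ; rk-mono = λ {X} {Y} X⊆Y → ℕ.∸-monoˡ-≤ (rk ρ B) (rk-mono ρ
      (set 3 (λ X Y B → X ⋐ Y ⇒ ⊢ X ⊔ B ⋐ Y ⊔ B) (X ∷ Y ∷ B ∷ []) X⊆Y))
  ; rk-sub  = λ X Y → ℕ.+-cancelˡ-≤ (rk ρ B + rk ρ B) _ _ (subst₂ _≤_
      (recombine (X ∪ Y) (X ∩ Y)) (recombine X Y) (submodular ρ {C = (X ∪ Y) ∪ B} {X ∪ B} {Y ∪ B}
        (set 3 (λ X Y B → ⊢ (X ⊔ Y) ⊔ B ⋐ (X ⊔ B) ⊔ (Y ⊔ B)) (X ∷ Y ∷ B ∷ []))
        (set 3 (λ X Y B → ⊢ (X ⊓ Y) ⊔ B ⋐ (X ⊔ B) ⊓ (Y ⊔ B)) (X ∷ Y ∷ B ∷ []))))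
  }
  where
  recombine : ∀ X Y → rk ρ (X ∪ B) + rk ρ (Y ∪ B) ≡
              rk ρ B + rk ρ B + ((rk ρ (X ∪ B) ∸ rk ρ B) + (rk ρ (Y ∪ B) ∸ rk ρ B))
  recombine X Y = trans
    (sym (cong₂ _+_ (ℕ.m+[n∸m]≡n (rk-mono ρ (q⊆p∪q X B))) (ℕ.m+[n∸m]≡n (rk-mono ρ (q⊆p∪q Y B)))))
    (interchange (rk ρ B) _ (rk ρ B) _)

rk-contract : ∀ (ρ : RankFunction n) B X → rk ρ (X ∪ B) ≡ rk ρ B + rk (contract B ρ) X
rk-contract ρ B X = sym (ℕ.m+[n∸m]≡n (rk-mono ρ (q⊆p∪q X B)))

directSum : Subset n → RankFunction n → RankFunction n → RankFunction n
directSum A ρ σ = record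
  { rk      = λ X → rk ρ (X ∩ A) + rk σ (X ─ A)
  ; rk-⊥    = cong₂ _+_ (rk-⊆⊥ ρ (p∩q⊆p ⊥ A)) (rk-⊆⊥ σ (p─q⊆p ⊥ A))
  ; rk-⁅⁆   = unit
  ; rk-mono = λ {X} {Y} X⊆Y → +-mono-≤
      (rk-mono ρ (set 3 (λ X Y A → X ⋐ Y ⇒ ⊢ X ⊓ A ⋐ Y ⊓ A) (X ∷ Y ∷ A ∷ []) X⊆Y))
      (rk-mono σ (set 3 (λ X Y A → X ⋐ Y ⇒ ⊢ X ∖ A ⋐ Y ∖ A) (X ∷ Y ∷ A ∷ []) X⊆Y))
  ; rk-sub  = λ X Y → lin 8 (λ a b c d a' b' c' d' →
      a ⊕ b ⩽ c ⊕ d ⇒ a' ⊕ b' ⩽ c' ⊕ d' ⇒ ⊢ (a ⊕ a') ⊕ (b ⊕ b') ⩽ (c ⊕ c') ⊕ (d ⊕ d'))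
      (rk ρ ((X ∪ Y) ∩ A) ∷ rk ρ ((X ∩ Y) ∩ A) ∷ rk ρ (X ∩ A) ∷ rk ρ (Y ∩ A) ∷
       rk σ ((X ∪ Y) ─ A) ∷ rk σ ((X ∩ Y) ─ A) ∷ rk σ (X ─ A) ∷ rk σ (Y ─ A) ∷ [])
      (submodular ρ {C = (X ∪ Y) ∩ A} {X ∩ A} {Y ∩ A} {(X ∩ Y) ∩ A}
        (set 3 (λ X Y A → ⊢ (X ⊔ Y) ⊓ A ⋐ X ⊓ A ⊔ Y ⊓ A) (X ∷ Y ∷ A ∷ []))
        (set 3 (λ X Y A → ⊢ (X ⊓ Y) ⊓ A ⋐ (X ⊓ A) ⊓ (Y ⊓ A)) (X ∷ Y ∷ A ∷ [])))
      (submodular σ {C = (X ∪ Y) ─ A} {X ─ A} {Y ─ A} {(X ∩ Y) ─ A}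
        (set 3 (λ X Y A → ⊢ (X ⊔ Y) ∖ A ⋐ (X ∖ A) ⊔ (Y ∖ A)) (X ∷ Y ∷ A ∷ []))
        (set 3 (λ X Y A → ⊢ (X ⊓ Y) ∖ A ⋐ (X ∖ A) ⊓ (Y ∖ A)) (X ∷ Y ∷ A ∷ [])))
  }
  where
  unit : ∀ x → rk ρ (⁅ x ⁆ ∩ A) + rk σ (⁅ x ⁆ ─ A) ≤ 1
  unit x with x ∈? A
  ... | yes x∈A = lin 3 (λ a b c → a ⩽ c ⇒ b ⩽ lit 0 ⇒ c ⩽ lit 1 ⇒ ⊢ a ⊕ b ⩽ lit 1)
    (_ ∷ _ ∷ _ ∷ []) (rk-mono ρ (p∩q⊆p ⁅ x ⁆ A))
    (≤-reflexive (rk-⊆⊥ σ (set 2 (λ x A → x ⋐ A ⇒ ⊢ x ∖ A ⋐ ∅) (⁅ x ⁆ ∷ A ∷ []) (∈⇒⁅⁆⊆ x∈A))))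
    (rk-⁅⁆ ρ x)
  ... | no  x∉A = +-mono-≤
    (≤-reflexive (rk-⊆⊥ ρ (∉⇒⁅⁆∩⊆⊥ x∉A)))
    (≤-trans (rk-mono σ (p─q⊆p ⁅ x ⁆ A)) (rk-⁅⁆ σ x))

-- Strong maps and Higgs lifts

infix 4 _↠_

-- The identity is a strong map from ρ to σ.
_↠_ : RankFunction n → RankFunction n → Set
ρ ↠ σ = ∀ {X Y} → X ⊆ Y → rk σ Y + rk ρ X ≤ rk σ X + rk ρ Y

↠⇒≤ : ∀ (ρ σ : RankFunction n) → ρ ↠ σ → ∀ X → rk σ X ≤ rk ρ X
↠⇒≤ ρ σ q X = lin 4 (λ a b c d → a ⊕ b ⩽ c ⊕ d ⇒ c ⩽ lit 0 ⇒ ⊢ a ⩽ d)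
  (_ ∷ rk ρ ⊥ ∷ _ ∷ _ ∷ []) (q ⊥⊆) (≤-reflexive (rk-⊥ σ))

-- The Higgs lift of σ towards ρ by c. Submodularity could only fail where the minimum is attained
-- by ρ at X and by σ at Y; there the strong map, applied to Y inside `X ∪ Y`, exchanges an increase
-- of σ for one of ρ.
higgs : (ρ σ : RankFunction n) → ρ ↠ σ → ℕ → RankFunction n
higgs ρ σ q c = record
  { rk      = λ X → rk ρ X ℕ.⊓ (rk σ X + c)
  ; rk-⊥    = ℕ.n≤0⇒n≡0 (≤-trans (ℕ.m⊓n≤m (rk ρ ⊥) _) (≤-reflexive (rk-⊥ ρ)))
  ; rk-⁅⁆   = λ x → ≤-trans (ℕ.m⊓n≤m _ _) (rk-⁅⁆ ρ x)
  ; rk-mono = λ X⊆Y → ℕ.⊓-mono-≤ (rk-mono ρ X⊆Y) (+-monoˡ-≤ c (rk-mono σ X⊆Y))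
  ; rk-sub  = sub
  }
  where
  r s : Subset _ → ℕ
  r = rk ρ
  s X = rk σ X + c

  r≤ : ∀ X → r X ℕ.⊓ s X ≤ r X
  r≤ X = ℕ.m⊓n≤m (r X) (s X)

  s≤ : ∀ X → r X ℕ.⊓ s X ≤ s X
  s≤ X = ℕ.m⊓n≤n (r X) (s X)

  mixed : ∀ X Y → r (X ∪ Y) ℕ.⊓ s (X ∪ Y) + r (X ∩ Y) ℕ.⊓ s (X ∩ Y) ≤ r X + s Y
  mixed X Y = lin 9 (λ u i ru ri rx ry su sy c → u ⩽ su ⊕ c ⇒ i ⩽ ri ⇒
      ru ⊕ ri ⩽ rx ⊕ ry ⇒ su ⊕ ry ⩽ sy ⊕ ru ⇒ ⊢ u ⊕ i ⩽ rx ⊕ (sy ⊕ c))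
    (_ ∷ _ ∷ r (X ∪ Y) ∷ r (X ∩ Y) ∷ _ ∷ r Y ∷ rk σ (X ∪ Y) ∷ rk σ Y ∷ c ∷ [])
    (s≤ (X ∪ Y)) (r≤ (X ∩ Y)) (rk-sub ρ X Y) (q (q⊆p∪q X Y))

  sub : ∀ X Y → r (X ∪ Y) ℕ.⊓ s (X ∪ Y) + r (X ∩ Y) ℕ.⊓ s (X ∩ Y) ≤ r X ℕ.⊓ s X + r Y ℕ.⊓ s Y
  sub X Y with ℕ.⊓-sel (r X) (s X) | ℕ.⊓-sel (r Y) (s Y)
  ... | inj₁ ex | inj₁ ey rewrite ex | ey =
    ≤-trans (+-mono-≤ (r≤ (X ∪ Y)) (r≤ (X ∩ Y))) (rk-sub ρ X Y)
  ... | inj₁ ex | inj₂ ey rewrite ex | ey = mixed X Y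
  ... | inj₂ ex | inj₁ ey rewrite ex | ey = ≤-trans
    (subst₂ (λ U I → r (X ∪ Y) ℕ.⊓ s (X ∪ Y) + r (X ∩ Y) ℕ.⊓ s (X ∩ Y) ≤ r U ℕ.⊓ s U + r I ℕ.⊓ s I)
      (∪-comm X Y) (∩-comm X Y) ≤-refl)
    (≤-trans (mixed Y X) (≤-reflexive (+-comm (r Y) (s X))))
  ... | inj₂ ex | inj₂ ey rewrite ex | ey = ≤-trans
    (+-mono-≤ (s≤ (X ∪ Y)) (s≤ (X ∩ Y)))
    (lin 5 (λ u i x y c → u ⊕ i ⩽ x ⊕ y ⇒ ⊢ (u ⊕ c) ⊕ (i ⊕ c) ⩽ (x ⊕ c) ⊕ (y ⊕ c))
      (rk σ (X ∪ Y) ∷ rk σ (X ∩ Y) ∷ rk σ X ∷ rk σ Y ∷ c ∷ []) (rk-sub σ X Y))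

-- Transport of rank functions along maps of ground sets

preimage : (Fin n → Fin m) → Subset m → Subset n
preimage φ Y = tabulate (lookup Y ∘ φ)

∈-preimage⁺ : ∀ (φ : Fin n → Fin m) {Y i} → φ i ∈ Y → i ∈ preimage φ Y
∈-preimage⁺ φ {Y} {i} p = Vec.lookup⇒[]= i _
  (trans (Vec.lookup∘tabulate (lookup Y ∘ φ) i) (Vec.[]=⇒lookup p))

∈-preimage⁻ : ∀ (φ : Fin n → Fin m) {Y i} → i ∈ preimage φ Y → φ i ∈ Y
∈-preimage⁻ φ {Y} {i} p = Vec.lookup⇒[]= (φ i) Y
  (trans (sym (Vec.lookup∘tabulate (lookup Y ∘ φ) i)) (Vec.[]=⇒lookup p))

image? : ∀ (φ : Fin n → Fin m) X j → Dec (∃[ i ] i ∈ X × φ i ≡ j)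
image? φ X j = Fin.any? λ i → (i ∈? X) ×-dec (φ i Fin.≟ j)

imageˢ : (Fin n → Fin m) → Subset n → Subset m
imageˢ φ X = tabulate λ j → does (image? φ X j)

∈-image⁺ : ∀ (φ : Fin n → Fin m) {X i} → i ∈ X → φ i ∈ imageˢ φ X
∈-image⁺ φ {X} {i} i∈X = Vec.lookup⇒[]= (φ i) _ (trans
  (Vec.lookup∘tabulate (λ j → does (image? φ X j)) (φ i)) (dec-true (image? φ X (φ i)) (i , i∈X , refl)))

∈-image⁻ : ∀ (φ : Fin n → Fin m) {X j} → j ∈ imageˢ φ X → ∃[ i ] i ∈ X × φ i ≡ j
∈-image⁻ φ {X} {j} p with image? φ X j | trans (sym (Vec.[]=⇒lookup p)) (Vec.lookup∘tabulate (λ j → does (image? φ X j)) j)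
... | yes q | _  = q
... | no  _ | ()

module _ (φ : Fin n → Fin m) (inj : Injective _≡_ _≡_ φ) where

  ∈-image⁻′ : ∀ {X i} → φ i ∈ imageˢ φ X → i ∈ X
  ∈-image⁻′ p with ∈-image⁻ φ p
  ... | k , k∈X , eq rewrite inj eq = k∈X

  pullback : RankFunction m → RankFunction n
  pullback ρ = record
    { rk      = rk ρ ∘ imageˢ φ
    ; rk-⊥    = rk-⊆⊥ ρ λ p → contradiction (proj₁ (proj₂ (∈-image⁻ φ p))) ∉⊥
    ; rk-⁅⁆   = λ x → rk-subsingleton ρ λ p q →
        let i , i∈ , ei = ∈-image⁻ φ p
            j , j∈ , ej = ∈-image⁻ φ q
        in trans (sym ei) (trans (cong φ (trans (x∈⁅y⁆⇒x≡y x i∈) (sym (x∈⁅y⁆⇒x≡y x j∈)))) ej)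
    ; rk-mono = λ X⊆Y → rk-mono ρ (mono X⊆Y)
    ; rk-sub  = λ X Y → submodular ρ
        (λ p → let i , i∈ , ei = ∈-image⁻ φ p in
          subst (_∈ _) ei ([ x∈p∪q⁺ ∘ inj₁ ∘ ∈-image⁺ φ , x∈p∪q⁺ ∘ inj₂ ∘ ∈-image⁺ φ ]′ (x∈p∪q⁻ X Y i∈)))
        (λ p → x∈p∩q⁺ (mono (p∩q⊆p X Y) p , mono (p∩q⊆q X Y) p))
    }
    where
    mono : ∀ {X Y} → X ⊆ Y → imageˢ φ X ⊆ imageˢ φ Y
    mono X⊆Y p with ∈-image⁻ φ p
    ... | i , i∈ , refl = ∈-image⁺ φ (X⊆Y i∈)

  -- The elements outside the image of φ are loops.
  pushforward : RankFunction n → RankFunction m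
  pushforward ρ = record
    { rk      = rk ρ ∘ preimage φ
    ; rk-⊥    = rk-⊆⊥ ρ λ p → contradiction (∈-preimage⁻ φ p) ∉⊥
    ; rk-⁅⁆   = λ x → rk-subsingleton ρ λ p q →
        inj (trans (x∈⁅y⁆⇒x≡y x (∈-preimage⁻ φ p)) (sym (x∈⁅y⁆⇒x≡y x (∈-preimage⁻ φ q))))
    ; rk-mono = λ X⊆Y → rk-mono ρ (mono X⊆Y)
    ; rk-sub  = λ X Y → submodular ρ
        (λ p → x∈p∪q⁺ ([ inj₁ ∘ ∈-preimage⁺ φ , inj₂ ∘ ∈-preimage⁺ φ ]′ (x∈p∪q⁻ X Y (∈-preimage⁻ φ p))))
        (λ p → x∈p∩q⁺ (mono (p∩q⊆p X Y) p , mono (p∩q⊆q X Y) p))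
    }
    where
    mono : ∀ {X Y} → X ⊆ Y → preimage φ X ⊆ preimage φ Y
    mono X⊆Y = ∈-preimage⁺ φ ∘ X⊆Y ∘ ∈-preimage⁻ φ

⊆⇒∩≡ : X ⊆ A → X ∩ A ≡ X
⊆⇒∩≡ {X = X} {A} X⊆A = ⊆-antisym (p∩q⊆p X A) λ x∈ → x∈p∩q⁺ (x∈ , X⊆A x∈)

infix 4 _↠[_]_

_↠[_]_ : RankFunction n → Subset n → RankFunction n → Set
ρ ↠[ S ] σ = ∀ {X Y} → X ⊆ Y → Y ⊆ S → rk σ Y + rk ρ X ≤ rk σ X + rk ρ Y

restrict-↠ : ∀ (ρ σ : RankFunction n) → ρ ↠[ S ] σ → restrict S ρ ↠ restrict S σ
restrict-↠ {S = S} ρ σ q {X} {Y} X⊆Y =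
  q (set 3 (λ X Y S → X ⋐ Y ⇒ ⊢ X ⊓ S ⋐ Y ⊓ S) (X ∷ Y ∷ S ∷ []) X⊆Y) (p∩q⊆q Y S)

-- Contraction*-depth of rank functions

data Cd*≤ {n} (ρ : RankFunction n) (S : Subset n) : ℕ → Set where
  flat     : ∀ {d} → rk ρ S ≡ 0 → Cd*≤ ρ S d
  split    : ∀ {d} A → Separates ρ S A → Cd*≤ ρ (S ∩ A) d → Cd*≤ ρ (S ─ A) d → Cd*≤ ρ S d
  quotient : ∀ {d} σ → ρ ↠[ S ] σ → rk ρ S ≤ suc (rk σ S) → Cd*≤ σ S d → Cd*≤ ρ S (suc d)

Cd*≤-mono : ∀ {ρ : RankFunction n} {c d} → c ≤ d → Cd*≤ ρ S c → Cd*≤ ρ S d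
Cd*≤-mono c≤d       (flat z)           = flat z
Cd*≤-mono c≤d       (split A sep k l)  = split A sep (Cd*≤-mono c≤d k) (Cd*≤-mono c≤d l)
Cd*≤-mono (s≤s c≤d) (quotient σ q b k) = quotient σ q b (Cd*≤-mono c≤d k)

Cd*≤-cong : ∀ {ρ σ : RankFunction n} {d} → (∀ {X} → X ⊆ S → rk ρ X ≡ rk σ X) →
            Cd*≤ ρ S d → Cd*≤ σ S d
Cd*≤-cong {S = S} eq (flat z) = flat (trans (sym (eq id)) z)
Cd*≤-cong {S = S} eq (split A sep k l) = split A
  (subst₂ _≤_ (cong₂ _+_ (eq (p∩q⊆p S A)) (eq (p─q⊆p S A))) (eq id) sep)
  (Cd*≤-cong (λ {X} X⊆ → eq {X} (⊆-trans {_} {X} X⊆ (p∩q⊆p S A))) k) (Cd*≤-cong (λ {X} X⊆ → eq {X} (⊆-trans {_} {X} X⊆ (p─q⊆p S A))) l)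
Cd*≤-cong {S = S} eq (quotient τ q b k) = quotient τ
  (λ {X} {Y} X⊆Y Y⊆S → subst₂ _≤_ (cong (rk τ Y +_) (eq (Y⊆S ∘ X⊆Y))) (cong (rk τ X +_) (eq Y⊆S)) (q X⊆Y Y⊆S))
  (subst (_≤ _) (eq id) b) k

↠⇒≥ : ∀ (ρ σ : RankFunction n) → ρ ↠[ S ] σ → X ⊆ S → rk σ X ≤ rk ρ X
↠⇒≥ {X = X} ρ σ q X⊆S = lin 4 (λ a b c d → a ⊕ b ⩽ c ⊕ d ⇒ c ⩽ lit 0 ⇒ ⊢ a ⩽ d)
  (rk σ X ∷ rk ρ ⊥ ∷ rk σ ⊥ ∷ rk ρ X ∷ []) (q ⊥⊆ X⊆S) (≤-reflexive (rk-⊥ σ))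

-- The intermediate elementary quotients are Higgs lifts.
quotient-by : ∀ ℓ {ρ σ : RankFunction n} {d} → ρ ↠[ S ] σ → rk ρ S ≤ ℓ + rk σ S →
              Cd*≤ σ S d → Cd*≤ ρ S (ℓ + d)
quotient-by {S = S} zero {ρ} {σ} q ρ≤σ k = Cd*≤-cong
  -- The drop from ρ to σ is monotone in the set, so that no drop at S means no drop at any subset
  -- of S.
  (λ {X} X⊆S → ≤-antisym (↠⇒≥ ρ σ q X⊆S)
    (lin 4 (λ a b c d → a ⊕ b ⩽ c ⊕ d ⇒ d ⩽ a ⇒ ⊢ b ⩽ c)
      (rk σ S ∷ rk ρ X ∷ rk σ X ∷ rk ρ S ∷ []) (q X⊆S id) ρ≤σ)) k
quotient-by {S = S} (suc ℓ) {ρ} {σ} q ρ≤σ k = quotient τ ρ↠τ ρ≤τ (quotient-by ℓ τ↠σ τ≤σ k)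
  where
  τ = higgs (restrict S ρ) (restrict S σ) (restrict-↠ ρ σ q) ℓ

  rk-τ : ∀ {X} → X ⊆ S → rk τ X ≡ rk ρ X ℕ.⊓ (rk σ X + ℓ)
  rk-τ X⊆S rewrite ⊆⇒∩≡ X⊆S = refl

  ρ↠τ : ρ ↠[ S ] τ
  ρ↠τ {X} {Y} X⊆Y Y⊆S rewrite rk-τ Y⊆S | rk-τ (⊆-trans {_} {X} X⊆Y Y⊆S)
    with ℕ.⊓-sel (rk ρ X) (rk σ X + ℓ)
  ... | inj₁ e rewrite e =
    ≤-trans (+-monoˡ-≤ (rk ρ X) (ℕ.m⊓n≤m (rk ρ Y) _)) (≤-reflexive (+-comm (rk ρ Y) _))
  ... | inj₂ e rewrite e = lin 6 (λ m rX sX l sY rY → m ⩽ sY ⊕ l ⇒ sY ⊕ rX ⩽ sX ⊕ rY ⇒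
      ⊢ m ⊕ rX ⩽ (sX ⊕ l) ⊕ rY)
    (_ ∷ rk ρ X ∷ rk σ X ∷ ℓ ∷ rk σ Y ∷ rk ρ Y ∷ []) (ℕ.m⊓n≤n (rk ρ Y) _) (q X⊆Y Y⊆S)

  ρ≤τ : rk ρ S ≤ suc (rk τ S)
  ρ≤τ rewrite rk-τ {S} id with ℕ.⊓-sel (rk ρ S) (rk σ S + ℓ)
  ... | inj₁ e rewrite e = ℕ.n≤1+n _
  ... | inj₂ e rewrite e = ≤-trans ρ≤σ (s≤s (≤-reflexive (+-comm ℓ _)))

  τ↠σ : τ ↠[ S ] σ
  τ↠σ {X} {Y} X⊆Y Y⊆S rewrite rk-τ Y⊆S | rk-τ (⊆-trans {_} {X} X⊆Y Y⊆S)
    with ℕ.⊓-sel (rk ρ Y) (rk σ Y + ℓ)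
  ... | inj₁ e rewrite e = ≤-trans (+-monoʳ-≤ (rk σ Y) (ℕ.m⊓n≤m (rk ρ X) _)) (q X⊆Y Y⊆S)
  ... | inj₂ e rewrite e = lin 4 (λ m sX l sY → m ⩽ sX ⊕ l ⇒ ⊢ sY ⊕ m ⩽ sX ⊕ (sY ⊕ l))
    (_ ∷ rk σ X ∷ ℓ ∷ rk σ Y ∷ []) (ℕ.m⊓n≤n (rk ρ X) _)

  τ≤σ : rk τ S ≤ ℓ + rk σ S
  τ≤σ rewrite rk-τ {S} id = ≤-trans (ℕ.m⊓n≤n (rk ρ S) _) (≤-reflexive (+-comm _ ℓ))

-- Shapes of decompositions, and the quotients read off from them

-- join A t u merges the roots of the trees of t and u, which hold the elements
-- inside and outside A; up t puts an edge above the root of t.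
data Shape (n : ℕ) : Set where
  nil  : Shape n
  up   : Shape n → Shape n
  join : Subset n → Shape n → Shape n → Shape n

height ups : Shape n → ℕ
height nil          = 0
height (up t)       = suc (height t)
height (join A t u) = height t ℕ.⊔ height u
ups nil          = 0
ups (up t)       = suc (ups t)
ups (join A t u) = ups t + ups u

-- A stem of a edges on top of a tree in which X spans h X edges.
stem : ℕ → (Subset n → ℕ) → Subset n → ℕ
stem a h X = if does (nonempty? X) then a + h X else 0

-- |E(T⟨f(X)⟩)| for the tree T and the placement f described by the shape.
span : Shape n → Subset n → ℕ
span nil          X = 0
span (up t)       X = stem 1 (span t) X
span (join A t u) X = span t (X ∩ A) + span u (X ─ A)

stem-nonempty : ∀ a (h : Subset n → ℕ) → Nonempty X → stem a h X ≡ a + h X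
stem-nonempty {X = X} a h ne with nonempty? X
... | yes _     = refl
... | no  empty = contradiction ne empty

stem-⊆⊥ : ∀ a (h : Subset n → ℕ) → X ⊆ ⊥ → stem a h X ≡ 0
stem-⊆⊥ {X = X} a h X⊆⊥ with nonempty? X
... | yes (x , x∈X) = contradiction (X⊆⊥ x∈X) ∉⊥
... | no  _         = refl

stem≤ : ∀ a (h : Subset n → ℕ) X → stem a h X ≤ a + h X
stem≤ a h X with nonempty? X
... | yes _ = ≤-refl
... | no  _ = z≤n

stem-suc : ∀ a (h : Subset n → ℕ) → Nonempty X → stem (suc a) h X ≡ suc (stem a h X)
stem-suc a h ne rewrite stem-nonempty (suc a) h ne | stem-nonempty a h ne = refl

span≤ups : ∀ (t : Shape n) X → span t X ≤ ups t
span≤ups nil          X = z≤n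
span≤ups (up t)       X = ≤-trans (stem≤ 1 (span t) X) (s≤s (span≤ups t X))
span≤ups (join A t u) X = +-mono-≤ (span≤ups t (X ∩ A)) (span≤ups u (X ─ A))

span-⊆⊥ : ∀ (t : Shape n) → X ⊆ ⊥ → span t X ≡ 0
span-⊆⊥ nil              X⊆⊥ = refl
span-⊆⊥ (up t)           X⊆⊥ = stem-⊆⊥ 1 (span t) X⊆⊥
span-⊆⊥ {X = X} (join A t u) X⊆⊥ = cong₂ _+_
  (span-⊆⊥ t (⊆-trans {_} {X ∩ A} (p∩q⊆p X A) X⊆⊥)) (span-⊆⊥ u (⊆-trans {_} {X ─ A} (p─q⊆p X A) X⊆⊥))

span≤stem : ∀ (t : Shape n) X → span t X ≤ stem 0 (span t) X
span≤stem t X with nonempty? X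
... | yes _     = ≤-refl
... | no  empty = ≤-reflexive (span-⊆⊥ t (Empty⇒⊆⊥ empty))

stem≤ups : ∀ a (t : Shape n) X → stem a (span t) X ≤ a + ups t
stem≤ups a t X = ≤-trans (stem≤ a (span t) X) (+-monoʳ-≤ a (span≤ups t X))

Bounded : ℕ → Shape n → RankFunction n → Subset n → Set
Bounded ℓ t ρ S = ∀ {X} → X ⊆ S → Nonempty X → rk ρ X ≤ ℓ + span t X

-- The tree considered is t below a stem of ℓ edges; the last premise says that it has no more edges
-- than the rank of S. Generality in ℓ drives the induction: the edge of an `up` joins the stem, so
-- that only `join` requires work.
Realizes : Shape n → Set
Realizes t = ∀ ℓ ρ S → Bounded ℓ t ρ S → ℓ + ups t ≤ rk ρ S → Cd*≤ ρ S (ℓ + height t)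

module _ (A : Subset n) {t u : Shape n} (t-realizes : Realizes t) (u-realizes : Realizes u) where

  private
    -- Below the common stem, the two branches carry private stems of lengths a and b, which collect
    -- the edges handed down from the common one.
    bound : ℕ → ℕ → Subset n → ℕ
    bound a b X = stem a (span t) (X ∩ A) + stem b (span u) (X ─ A)

    total : ℕ → ℕ → ℕ
    total a b = (a + ups t) + (b + ups u)

  module Split ℓ a b (ρ : RankFunction n) (S : Subset n)
               (bounded : ∀ {X} → X ⊆ S → rk ρ X ≤ ℓ + bound a b X)
               (full : ℓ + total a b ≤ rk ρ S) where

    α β : Subset n
    α = S ∩ A
    β = S ─ A

    bound-α : ∀ {X} → X ⊆ A → bound a b X ≤ a + span t X
    bound-α {X} X⊆A rewrite ⊆⇒∩≡ X⊆A
      | stem-⊆⊥ b (span u) (set 2 (λ X A → X ⋐ A ⇒ ⊢ X ∖ A ⋐ ∅) (X ∷ A ∷ []) X⊆A)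
      | +-identityʳ (stem a (span t) X) = stem≤ a (span t) X

    bound-β : ∀ {X} → X ∩ A ⊆ ⊥ → bound a b X ≤ b + span u X
    bound-β {X} X∩A⊆⊥ rewrite stem-⊆⊥ a (span t) X∩A⊆⊥
      | ⊆-antisym (p─q⊆p X A) (set 2 (λ X A → X ⊓ A ⋐ ∅ ⇒ ⊢ X ⋐ X ∖ A) (X ∷ A ∷ []) X∩A⊆⊥)
      = stem≤ b (span u) X

    β∩A⊆⊥ : β ∩ A ⊆ ⊥
    β∩A⊆⊥ = set 2 (λ S A → ⊢ (S ∖ A) ⊓ A ⋐ ∅) (S ∷ A ∷ [])

    rk-α≤ : rk ρ α ≤ ℓ + (a + ups t)
    rk-α≤ = ≤-trans (bounded (p∩q⊆p S A)) (+-monoʳ-≤ ℓ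
      (≤-trans (bound-α (p∩q⊆q S A)) (+-monoʳ-≤ a (span≤ups t α))))

    rk-β≤ : rk ρ β ≤ ℓ + (b + ups u)
    rk-β≤ = ≤-trans (bounded (p─q⊆p S A)) (+-monoʳ-≤ ℓ
      (≤-trans (bound-β β∩A⊆⊥) (+-monoʳ-≤ b (span≤ups u β))))

    S⊆ : S ⊆ α ∪ β
    S⊆ = ⊆∩∪─ S A

    -- The quotient is the direct sum of the contractions of ρ by β and by α.
    module Tight (tight-α : ℓ + (a + ups t) ≤ rk ρ α) (tight-β : ℓ + (b + ups u) ≤ rk ρ β) where

      σ : RankFunction n
      σ = directSum A (contract β ρ) (contract α ρ)

      ρ↠σ : ρ ↠[ S ] σ
      ρ↠σ {X} {Y} X⊆Y Y⊆S = lin 12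
        (λ ya yb xa xb ra rb cya cyb cxa cxb x y →
          rb ⊕ cya ⩽ ya ⇒ ra ⊕ cyb ⩽ yb ⇒ xa ⩽ rb ⊕ cxa ⇒ xb ⩽ ra ⊕ cxb ⇒
          (ya ⊕ yb) ⊕ x ⩽ (xa ⊕ xb) ⊕ y ⇒ ⊢ (cya ⊕ cyb) ⊕ x ⩽ (cxa ⊕ cxb) ⊕ y)
        (rk ρ (Y ∩ A ∪ β) ∷ rk ρ ((Y ─ A) ∪ α) ∷ rk ρ (X ∩ A ∪ β) ∷ rk ρ ((X ─ A) ∪ α) ∷
         rk ρ α ∷ rk ρ β ∷ rk (contract β ρ) (Y ∩ A) ∷ rk (contract α ρ) (Y ─ A) ∷
         rk (contract β ρ) (X ∩ A) ∷ rk (contract α ρ) (X ─ A) ∷ rk ρ X ∷ rk ρ Y ∷ [])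
        (≤-reflexive (sym (rk-contract ρ β (Y ∩ A)))) (≤-reflexive (sym (rk-contract ρ α (Y ─ A))))
        (≤-reflexive (rk-contract ρ β (X ∩ A))) (≤-reflexive (rk-contract ρ α (X ─ A)))
        -- X grows to Y in two stages, through `X ∪ Y ∩ A`. In each stage the opposite side of S has
        -- been contracted, which by submodularity can only lower the increase of the rank.
        (lin 7 (λ ya yb xa xb x y z → ya ⊕ x ⩽ xa ⊕ z ⇒ yb ⊕ z ⩽ xb ⊕ y ⇒
            ⊢ (ya ⊕ yb) ⊕ x ⩽ (xa ⊕ xb) ⊕ y)
          (rk ρ (Y ∩ A ∪ β) ∷ rk ρ ((Y ─ A) ∪ α) ∷ rk ρ (X ∩ A ∪ β) ∷ rk ρ ((X ─ A) ∪ α) ∷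
           rk ρ X ∷ rk ρ Y ∷ rk ρ (X ∪ Y ∩ A) ∷ [])
          (submodular ρ {C = Y ∩ A ∪ β} {X ∩ A ∪ β} {X ∪ Y ∩ A} {X}
            (set 4 (λ X Y S A → ⊢ Y ⊓ A ⊔ (S ∖ A) ⋐ (X ⊓ A ⊔ (S ∖ A)) ⊔ (X ⊔ Y ⊓ A)) (X ∷ Y ∷ S ∷ A ∷ []))
            (set 4 (λ X Y S A → X ⋐ Y ⇒ Y ⋐ S ⇒ ⊢ X ⋐ (X ⊓ A ⊔ (S ∖ A)) ⊓ (X ⊔ Y ⊓ A))
              (X ∷ Y ∷ S ∷ A ∷ []) X⊆Y Y⊆S))
          (submodular ρ {C = (Y ─ A) ∪ α} {(X ─ A) ∪ α} {Y} {X ∪ Y ∩ A}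
            (set 4 (λ X Y S A → ⊢ (Y ∖ A) ⊔ S ⊓ A ⋐ ((X ∖ A) ⊔ S ⊓ A) ⊔ Y) (X ∷ Y ∷ S ∷ A ∷ []))
            (set 4 (λ X Y S A → X ⋐ Y ⇒ Y ⋐ S ⇒ ⊢ X ⊔ Y ⊓ A ⋐ ((X ∖ A) ⊔ S ⊓ A) ⊓ Y)
              (X ∷ Y ∷ S ∷ A ∷ []) X⊆Y Y⊆S)))

      -- The contraction leaves to α the rank of S minus that of β, and β has at most the rank that
      -- the stem and its own branch allow. With `ℓβ≤` this gives `ρ≤σ`: only the stem is lost.
      ℓα≤ : a + ups t ≤ rk (contract β ρ) α
      ℓα≤ = lin 6 (λ l p q s rb c → l ⊕ (p ⊕ q) ⩽ s ⇒ s ⩽ rb ⊕ c ⇒ rb ⩽ l ⊕ q ⇒ ⊢ p ⩽ c)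
        (ℓ ∷ a + ups t ∷ b + ups u ∷ rk ρ S ∷ rk ρ β ∷ rk (contract β ρ) α ∷ []) full
        (≤-trans (rk-mono ρ S⊆) (≤-reflexive (rk-contract ρ β α))) rk-β≤

      ℓβ≤ : b + ups u ≤ rk (contract α ρ) β
      ℓβ≤ = lin 6 (λ l p q s ra c → l ⊕ (p ⊕ q) ⩽ s ⇒ s ⩽ ra ⊕ c ⇒ ra ⩽ l ⊕ p ⇒ ⊢ q ⩽ c)
        (ℓ ∷ a + ups t ∷ b + ups u ∷ rk ρ S ∷ rk ρ α ∷ rk (contract α ρ) β ∷ []) full
        (≤-trans (rk-mono ρ (set 2 (λ S A → ⊢ S ⋐ (S ∖ A) ⊔ S ⊓ A) (S ∷ A ∷ [])))
          (≤-reflexive (rk-contract ρ α β))) rk-α≤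

      ρ≤σ : rk ρ S ≤ ℓ + rk σ S
      ρ≤σ = lin 6 (λ l p q s c d → s ⩽ l ⊕ (p ⊕ q) ⇒ p ⩽ c ⇒ q ⩽ d ⇒ ⊢ s ⩽ l ⊕ (c ⊕ d))
        (ℓ ∷ a + ups t ∷ b + ups u ∷ rk ρ S ∷ rk (contract β ρ) α ∷ rk (contract α ρ) β ∷ [])
        (≤-trans (bounded id) (+-monoʳ-≤ ℓ (+-mono-≤ (stem≤ups a t α) (stem≤ups b u β))))
        ℓα≤ ℓβ≤

      σ-α : ∀ {X} → X ⊆ A → rk σ X ≤ rk (contract β ρ) X
      σ-α {X} X⊆A = lin 3 (λ p q r → p ⩽ r ⇒ q ⩽ lit 0 ⇒ ⊢ p ⊕ q ⩽ r)
        (rk (contract β ρ) (X ∩ A) ∷ rk (contract α ρ) (X ─ A) ∷ _ ∷ [])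
        (rk-mono (contract β ρ) (p∩q⊆p X A))
        (≤-reflexive (rk-⊆⊥ (contract α ρ) (set 2 (λ X A → X ⋐ A ⇒ ⊢ X ∖ A ⋐ ∅) (X ∷ A ∷ []) X⊆A)))

      σ-β : ∀ {X} → X ∩ A ⊆ ⊥ → rk σ X ≤ rk (contract α ρ) X
      σ-β {X} X∩A⊆⊥ = +-mono-≤ (≤-reflexive (rk-⊆⊥ (contract β ρ) X∩A⊆⊥))
        (rk-mono (contract α ρ) (p─q⊆p X A))

      separates : Separates σ S A
      separates = +-mono-≤ (σ-α (p∩q⊆q S A)) (σ-β β∩A⊆⊥)

      -- Here tightness of β enters: subtracting its rank from the bound for `X ∪ β` pays for the
      -- whole stem and for all edges of the branch of β, which leaves X with its own branch only.
      σ-bounded-α : Bounded a t σ α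
      σ-bounded-α {X} X⊆α _ = ≤-trans (σ-α (⊆-trans {_} {X} X⊆α (p∩q⊆q S A)))
        (lin 7 (λ c r rb l p q s → rb ⊕ c ⩽ r ⇒ r ⩽ l ⊕ (p ⊕ q) ⇒ l ⊕ q ⩽ rb ⇒ p ⩽ s ⇒ ⊢ c ⩽ s)
          (rk (contract β ρ) X ∷ rk ρ (X ∪ β) ∷ rk ρ β ∷ ℓ ∷ a + span t X ∷ b + ups u ∷ a + span t X ∷ [])
          (≤-reflexive (sym (rk-contract ρ β X)))
          (≤-trans (bounded X∪β⊆S) (+-monoʳ-≤ ℓ (+-mono-≤
            (≤-trans (stem≤ a (span t) _) (≤-reflexive (cong (λ Z → a + span t Z) (⊆-antisym
              (set 3 (λ X S A → ⊢ (X ⊔ (S ∖ A)) ⊓ A ⋐ X) (X ∷ S ∷ A ∷ []))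
              (set 3 (λ X S A → X ⋐ S ⊓ A ⇒ ⊢ X ⋐ (X ⊔ (S ∖ A)) ⊓ A) (X ∷ S ∷ A ∷ []) X⊆α)))))
            (stem≤ups b u _)))) tight-β ≤-refl)
        where
        X∪β⊆S : X ∪ β ⊆ S
        X∪β⊆S = set 3 (λ X S A → X ⋐ S ⊓ A ⇒ ⊢ X ⊔ (S ∖ A) ⋐ S) (X ∷ S ∷ A ∷ []) X⊆α

      σ-bounded-β : Bounded b u σ β
      σ-bounded-β {X} X⊆β _ = ≤-trans
        (σ-β (set 3 (λ X S A → X ⋐ S ∖ A ⇒ ⊢ X ⊓ A ⋐ ∅) (X ∷ S ∷ A ∷ []) X⊆β))
        (lin 6 (λ c r ra l p q → ra ⊕ c ⩽ r ⇒ r ⩽ l ⊕ (p ⊕ q) ⇒ l ⊕ p ⩽ ra ⇒ ⊢ c ⩽ q)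
          (rk (contract α ρ) X ∷ rk ρ (X ∪ α) ∷ rk ρ α ∷ ℓ ∷ a + ups t ∷ b + span u X ∷ [])
          (≤-reflexive (sym (rk-contract ρ α X)))
          (≤-trans (bounded X∪α⊆S) (+-monoʳ-≤ ℓ (+-mono-≤ (stem≤ups a t _)
            (≤-trans (stem≤ b (span u) _) (≤-reflexive (cong (λ Z → b + span u Z) (⊆-antisym
              (set 3 (λ X S A → ⊢ (X ⊔ S ⊓ A) ∖ A ⋐ X) (X ∷ S ∷ A ∷ []))
              (set 3 (λ X S A → X ⋐ S ∖ A ⇒ ⊢ X ⋐ (X ⊔ S ⊓ A) ∖ A) (X ∷ S ∷ A ∷ []) X⊆β)))))))) tight-α)
        where
        X∪α⊆S : X ∪ α ⊆ S
        X∪α⊆S = set 3 (λ X S A → X ⋐ S ∖ A ⇒ ⊢ X ⊔ S ⊓ A ⋐ S) (X ∷ S ∷ A ∷ []) X⊆β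

      cd*≤ : Cd*≤ ρ S (ℓ + ((a + height t) ℕ.⊔ (b + height u)))
      cd*≤ = quotient-by ℓ ρ↠σ ρ≤σ (split A separates
        (Cd*≤-mono (ℕ.m≤m⊔n _ _) (t-realizes a σ α σ-bounded-α
          (≤-trans ℓα≤ (≤-trans
            (rk-mono (contract β ρ) (set 2 (λ S A → ⊢ S ⊓ A ⋐ (S ⊓ A) ⊓ A) (S ∷ A ∷ [])))
            (ℕ.m≤m+n _ _)))))
        (Cd*≤-mono (ℕ.m≤n⊔m (a + height t) _) (u-realizes b σ β σ-bounded-β
          (≤-trans ℓβ≤ (≤-trans
            (rk-mono (contract α ρ) (set 2 (λ S A → ⊢ S ∖ A ⋐ (S ∖ A) ∖ A) (S ∷ A ∷ [])))
            (ℕ.m≤n+m _ _))))))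

  -- Induction on the common stem. Either the quotient consumes the whole stem at once, or one edge
  -- of it moves into a branch; in the latter case ℓ decreases, a or b increases, and no path from
  -- the root becomes longer.
  join-realizes : ∀ ℓ a b (ρ : RankFunction n) S →
                  (∀ {X} → X ⊆ S → rk ρ X ≤ ℓ + bound a b X) → ℓ + total a b ≤ rk ρ S →
                  Cd*≤ ρ S (ℓ + ((a + height t) ℕ.⊔ (b + height u)))
  -- Without a common stem the branches bound the ranks of α and β by numbers whose sum is at most
  -- the rank of S, so that A separates ρ itself.
  join-realizes zero a b ρ S bounded full = split A
    (≤-trans (+-mono-≤ rk-α≤ rk-β≤) full)
    (Cd*≤-mono (ℕ.m≤m⊔n _ _) (t-realizes a ρ α
      (λ {X} X⊆α _ → ≤-trans (bounded (⊆-trans {_} {X} X⊆α (p∩q⊆p S A)))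
        (bound-α (⊆-trans {_} {X} X⊆α (p∩q⊆q S A))))
      (lin 5 (λ p q s x y → p ⊕ q ⩽ s ⇒ s ⩽ x ⊕ y ⇒ y ⩽ q ⇒ ⊢ p ⩽ x)
        (a + ups t ∷ b + ups u ∷ rk ρ S ∷ rk ρ α ∷ rk ρ β ∷ []) full (subadditive ρ S⊆) rk-β≤)))
    (Cd*≤-mono (ℕ.m≤n⊔m (a + height t) _) (u-realizes b ρ β
      (λ {X} X⊆β _ → ≤-trans (bounded (⊆-trans {_} {X} X⊆β (p─q⊆p S A)))
        (bound-β (set 3 (λ X S A → X ⋐ S ∖ A ⇒ ⊢ X ⊓ A ⋐ ∅) (X ∷ S ∷ A ∷ []) X⊆β)))
      (lin 5 (λ p q s x y → p ⊕ q ⩽ s ⇒ s ⩽ x ⊕ y ⇒ x ⩽ p ⇒ ⊢ q ⩽ y)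
        (a + ups t ∷ b + ups u ∷ rk ρ S ∷ rk ρ α ∷ rk ρ β ∷ []) full (subadditive ρ S⊆) rk-α≤)))
    where open Split zero a b ρ S bounded full
  join-realizes (suc ℓ) a b ρ S bounded full
    with suc ℓ + (a + ups t) ℕ.≤? rk ρ (S ∩ A) | suc ℓ + (b + ups u) ℕ.≤? rk ρ (S ─ A)
  ... | yes tight-α | yes tight-β =
    Split.Tight.cd*≤ (suc ℓ) a b ρ S bounded full tight-α tight-β
  -- No subset of β spans all its edges, as otherwise β would: an edge of the stem
  -- can be handed over to t.
  ... | _           | no  slack-β = Cd*≤-mono
    (≤-trans (+-monoʳ-≤ ℓ (ℕ.⊔-lub (s≤s (ℕ.m≤m⊔n (a + height t) (b + height u)))
      (ℕ.m≤n⇒m≤1+n (ℕ.m≤n⊔m (a + height t) (b + height u))))) (≤-reflexive (+-suc ℓ _)))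
    (join-realizes ℓ (suc a) b ρ S bounded′
      (≤-trans (≤-reflexive (+-suc ℓ _)) full))
    where
    open Split (suc ℓ) a b ρ S bounded full
    bounded′ : ∀ {X} → X ⊆ S → rk ρ X ≤ ℓ + bound (suc a) b X
    bounded′ {X} X⊆S = go (nonempty? (X ∩ A))
      where
      go : Dec (Nonempty (X ∩ A)) → rk ρ X ≤ ℓ + bound (suc a) b X
      -- X meets A, so it spans the moved edge in the new place as it did in the old one.
      go (yes ne) = ≤-trans (bounded X⊆S) (≤-reflexive (trans (sym (+-suc ℓ _))
        (cong (λ s → ℓ + (s + stem b (span u) (X ─ A))) (sym (stem-suc a (span t) ne)))))
      go (no empty) rewrite stem-⊆⊥ (suc a) (span t) (Empty⇒⊆⊥ empty) = ≮⇒≥ λ tight →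
        ℕ.<-irrefl refl (lin 8 (λ l p q w s x r y →
          s ⊕ x ⩽ r ⊕ y ⇒ r ⩽ lit 1 ⊕ l ⊕ (p ⊕ w) ⇒ lit 1 ⊕ y ⩽ lit 1 ⊕ l ⊕ q ⇒
          lit 1 ⊕ l ⊕ (p ⊕ q) ⩽ s ⇒ lit 1 ⊕ (l ⊕ w) ⩽ x ⇒ ⊢ lit 1 ⩽ lit 0)
        (ℓ ∷ a + ups t ∷ b + ups u ∷ stem b (span u) (X ─ A) ∷ rk ρ S ∷ rk ρ X ∷ rk ρ (X ∪ α) ∷ rk ρ β ∷ [])
        (submodular ρ {C = S} {X ∪ α} {β} {X}
          (set 3 (λ S A X → ⊢ S ⋐ (X ⊔ S ⊓ A) ⊔ (S ∖ A)) (S ∷ A ∷ X ∷ []))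
          (set 3 (λ S A X → X ⋐ S ⇒ X ⊓ A ⋐ ∅ ⇒ ⊢ X ⋐ (X ⊔ S ⊓ A) ⊓ (S ∖ A)) (S ∷ A ∷ X ∷ [])
            X⊆S (Empty⇒⊆⊥ empty)))
        (≤-trans (bounded (set 3 (λ S A X → X ⋐ S ⇒ ⊢ X ⊔ S ⊓ A ⋐ S) (S ∷ A ∷ X ∷ []) X⊆S))
          (+-monoʳ-≤ (suc ℓ) (+-mono-≤ (stem≤ups a t _) (≤-reflexive (cong (stem b (span u))
            (⊆-antisym (set 3 (λ S A X → ⊢ (X ⊔ S ⊓ A) ∖ A ⋐ X ∖ A) (S ∷ A ∷ X ∷ []))
              (set 3 (λ S A X → ⊢ X ∖ A ⋐ (X ⊔ S ⊓ A) ∖ A) (S ∷ A ∷ X ∷ []))))))))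
        (≰⇒> slack-β) full tight)
  ... | no  slack-α | _           = Cd*≤-mono
    (≤-trans (+-monoʳ-≤ ℓ (ℕ.⊔-lub (ℕ.m≤n⇒m≤1+n (ℕ.m≤m⊔n (a + height t) (b + height u)))
      (s≤s (ℕ.m≤n⊔m (a + height t) (b + height u))))) (≤-reflexive (+-suc ℓ _)))
    (join-realizes ℓ a (suc b) ρ S bounded′
      (≤-trans (≤-reflexive (trans (cong (ℓ +_) (+-suc (a + ups t) _)) (+-suc ℓ _))) full))
    where
    open Split (suc ℓ) a b ρ S bounded full
    bounded′ : ∀ {X} → X ⊆ S → rk ρ X ≤ ℓ + bound a (suc b) X
    bounded′ {X} X⊆S = go (nonempty? (X ─ A))
      where
      go : Dec (Nonempty (X ─ A)) → rk ρ X ≤ ℓ + bound a (suc b) X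
      go (yes ne) = ≤-trans (bounded X⊆S) (≤-reflexive (trans (sym (+-suc ℓ _))
        (cong (ℓ +_) (trans (sym (+-suc (stem a (span t) (X ∩ A)) _))
          (cong (stem a (span t) (X ∩ A) +_) (sym (stem-suc b (span u) ne)))))))
      go (no empty) rewrite stem-⊆⊥ (suc b) (span u) (Empty⇒⊆⊥ empty)
                          | +-identityʳ (stem a (span t) (X ∩ A)) = ≮⇒≥ λ tight →
        ℕ.<-irrefl refl (lin 8 (λ l p q w s x r y →
          s ⊕ x ⩽ r ⊕ y ⇒ r ⩽ lit 1 ⊕ l ⊕ (w ⊕ q) ⇒ lit 1 ⊕ y ⩽ lit 1 ⊕ l ⊕ p ⇒
          lit 1 ⊕ l ⊕ (p ⊕ q) ⩽ s ⇒ lit 1 ⊕ (l ⊕ w) ⩽ x ⇒ ⊢ lit 1 ⩽ lit 0)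
        (ℓ ∷ a + ups t ∷ b + ups u ∷ stem a (span t) (X ∩ A) ∷ rk ρ S ∷ rk ρ X ∷ rk ρ (X ∪ β) ∷ rk ρ α ∷ [])
        (submodular ρ {C = S} {X ∪ β} {α} {X}
          (set 3 (λ S A X → ⊢ S ⋐ (X ⊔ (S ∖ A)) ⊔ S ⊓ A) (S ∷ A ∷ X ∷ []))
          (set 3 (λ S A X → X ⋐ S ⇒ X ∖ A ⋐ ∅ ⇒ ⊢ X ⋐ (X ⊔ (S ∖ A)) ⊓ (S ⊓ A)) (S ∷ A ∷ X ∷ [])
            X⊆S (Empty⇒⊆⊥ empty)))
        (≤-trans (bounded (set 3 (λ S A X → X ⋐ S ⇒ ⊢ X ⊔ (S ∖ A) ⋐ S) (S ∷ A ∷ X ∷ []) X⊆S))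
          (+-monoʳ-≤ (suc ℓ) (+-mono-≤ (≤-reflexive (cong (stem a (span t))
            (⊆-antisym (set 3 (λ S A X → ⊢ (X ⊔ (S ∖ A)) ⊓ A ⋐ X ⊓ A) (S ∷ A ∷ X ∷ []))
              (set 3 (λ S A X → ⊢ X ⊓ A ⋐ (X ⊔ (S ∖ A)) ⊓ A) (S ∷ A ∷ X ∷ []))))) (stem≤ups b u _))))
        (≰⇒> slack-α) full tight)

zeroRank : RankFunction n
zeroRank = record
  { rk      = λ _ → 0
  ; rk-⊥    = refl
  ; rk-⁅⁆   = λ _ → z≤n
  ; rk-mono = λ _ → z≤n
  ; rk-sub  = λ _ _ → z≤n
  }

realizes : ∀ (t : Shape n) → Realizes t
-- Only the stem remains. Its ℓ edges pay for lowering the rank all the way to zero.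
realizes nil ℓ ρ S bounded full = quotient-by ℓ {σ = zeroRank}
  (λ X⊆Y _ → rk-mono ρ X⊆Y) (ρ≤ (nonempty? S)) (flat refl)
  where
  ρ≤ : Dec (Nonempty S) → rk ρ S ≤ ℓ + 0
  ρ≤ (yes ne)   = bounded id ne
  ρ≤ (no empty) = ≤-trans (≤-reflexive (rk-⊆⊥ ρ (Empty⇒⊆⊥ empty))) z≤n
realizes (up t) ℓ ρ S bounded full = subst (Cd*≤ ρ S) (sym (+-suc ℓ (height t)))
  (realizes t (suc ℓ) ρ S
    (λ X⊆S ne → ≤-trans (bounded X⊆S ne) (≤-reflexive
      (trans (cong (ℓ +_) (stem-nonempty 1 (span t) ne)) (+-suc ℓ _))))
    (≤-trans (≤-reflexive (sym (+-suc ℓ (ups t)))) full))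
realizes (join A t u) ℓ ρ S bounded full =
  join-realizes A {t} {u} (realizes t) (realizes u) ℓ 0 0 ρ S bounded′ full
  where
  bounded′ : ∀ {X} → X ⊆ S → rk ρ X ≤ ℓ + (stem 0 (span t) (X ∩ A) + stem 0 (span u) (X ─ A))
  bounded′ {X} X⊆S with nonempty? X
  ... | yes ne    = ≤-trans (bounded X⊆S ne)
    (+-monoʳ-≤ ℓ (+-mono-≤ (span≤stem t (X ∩ A)) (span≤stem u (X ─ A))))
  ... | no  empty = ≤-trans (≤-reflexive (rk-⊆⊥ ρ (Empty⇒⊆⊥ empty))) z≤n

-- The number of edges has to equal the rank exactly. A quotient that keeps the rank of S must
-- therefore add no edge; since the drop is monotone in the set, σ and ρ then agree on S. Otherwise
-- the new edge accounts for the drop by one at S, and every non-empty set spans it.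
spanning-shape : ∀ {ρ : RankFunction n} {d} → Cd*≤ ρ S d →
  Σ[ t ∈ Shape n ] height t ≤ d × ups t ≡ rk ρ S × (∀ {X} → X ⊆ S → rk ρ X ≤ span t X)
spanning-shape {ρ = ρ} (flat z) =
  nil , z≤n , sym z , λ X⊆S → ≤-trans (rk-mono ρ X⊆S) (≤-reflexive z)
spanning-shape {S = S} {ρ = ρ} (split A sep k l) with spanning-shape k | spanning-shape l
... | t , ht , ut , bt | u , hu , uu , bu =
  join A t u , ℕ.⊔-lub ht hu ,
  trans (cong₂ _+_ ut uu) (≤-antisym sep
    (subadditive ρ (⊆∩∪─ S A))) ,
  λ {X} X⊆S → ≤-trans
    (subadditive ρ {A = X ∩ A} {X ─ A} (⊆∩∪─ X A))
    (+-mono-≤ (bt (set 3 (λ X S A → X ⋐ S ⇒ ⊢ X ⊓ A ⋐ S ⊓ A) (X ∷ S ∷ A ∷ []) X⊆S))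
      (bu (set 3 (λ X S A → X ⋐ S ⇒ ⊢ X ∖ A ⋐ S ∖ A) (X ∷ S ∷ A ∷ []) X⊆S)))
spanning-shape {S = S} {ρ = ρ} (quotient σ q ρ≤σ k) with spanning-shape k | rk ρ S ℕ.≤? rk σ S
... | t , ht , ut , bt | yes ρ≤ = t , ℕ.m≤n⇒m≤1+n ht ,
  trans ut (≤-antisym (↠⇒≥ ρ σ q id) ρ≤) ,
  λ {X} X⊆S → ≤-trans (lin 4 (λ a b c d → a ⊕ b ⩽ c ⊕ d ⇒ d ⩽ a ⇒ ⊢ b ⩽ c)
    (rk σ S ∷ rk ρ X ∷ rk σ X ∷ rk ρ S ∷ []) (q X⊆S id) ρ≤) (bt X⊆S)
... | t , ht , ut , bt | no  ρ≰ = up t , s≤s ht ,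
  trans (cong suc ut) (≤-antisym (≰⇒> ρ≰) ρ≤σ) ,
  λ {X} X⊆S → go X⊆S (nonempty? X)
  where
  go : ∀ {X} → X ⊆ S → Dec (Nonempty X) → rk ρ X ≤ stem 1 (span t) X
  go {X} X⊆S (yes ne) rewrite stem-nonempty 1 (span t) ne =
    lin 5 (λ a b c d e → a ⊕ b ⩽ c ⊕ d ⇒ d ⩽ lit 1 ⊕ a ⇒ c ⩽ e ⇒ ⊢ b ⩽ lit 1 ⊕ e)
      (rk σ S ∷ rk ρ X ∷ rk σ X ∷ rk ρ S ∷ _ ∷ []) (q X⊆S id) ρ≤σ (bt X⊆S)
  go X⊆S (no empty) = ≤-trans (≤-reflexive (rk-⊆⊥ ρ (Empty⇒⊆⊥ empty))) z≤n

-- Decidability of contraction*-depth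

Table : ℕ → Set
Table zero    = Bool
Table (suc n) = Table n × Table n

lookupᵗ : Table n → Subset n → Bool
lookupᵗ {zero}  b       []            = b
lookupᵗ {suc n} (t , u) (inside  ∷ X) = lookupᵗ t X
lookupᵗ {suc n} (t , u) (outside ∷ X) = lookupᵗ u X

tabulateᵗ : (Subset n → Bool) → Table n
tabulateᵗ {zero}  f = f []
tabulateᵗ {suc n} f = tabulateᵗ (f ∘ (inside ∷_)) , tabulateᵗ (f ∘ (outside ∷_))

lookupᵗ∘tabulateᵗ : ∀ (f : Subset n → Bool) X → lookupᵗ (tabulateᵗ f) X ≡ f X
lookupᵗ∘tabulateᵗ f []            = refl
lookupᵗ∘tabulateᵗ f (inside  ∷ X) = lookupᵗ∘tabulateᵗ (f ∘ (inside ∷_)) X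
lookupᵗ∘tabulateᵗ f (outside ∷ X) = lookupᵗ∘tabulateᵗ (f ∘ (outside ∷_)) X

-- Tables are searched in place of functions on subsets, which could be enumerated only up to
-- pointwise equality.
anyTable? : ∀ {n} {P : Table n → Set} → Decidable P → Dec (∃ P)
anyTable? {zero} P? with P? true | P? false
... | yes p | _     = yes (true , p)
... | no  _ | yes p = yes (false , p)
... | no ¬p | no ¬q = no λ { (true , p) → ¬p p ; (false , q) → ¬q q }
anyTable? {suc n} P? = map′ (λ (t , u , p) → (t , u) , p) (λ ((t , u) , p) → t , u , p)
  (anyTable? λ t → anyTable? λ u → P? (t , u))

IsRankFunction : (Subset n → ℕ) → Set
IsRankFunction r = r ⊥ ≡ 0 × (∀ x → r ⁅ x ⁆ ≤ 1) × (∀ X Y → X ⊆ Y → r X ≤ r Y) ×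
                   (∀ X Y → r (X ∪ Y) + r (X ∩ Y) ≤ r X + r Y)

isRankFunction? : ∀ (r : Subset n → ℕ) → Dec (IsRankFunction r)
isRankFunction? r = (r ⊥ ℕ.≟ 0) ×-dec Fin.all? (λ x → r ⁅ x ⁆ ℕ.≤? 1) ×-dec
  allSubset? (λ X → allSubset? λ Y → (X ⊆? Y) →-dec (r X ℕ.≤? r Y)) ×-dec
  allSubset? (λ X → allSubset? λ Y → r (X ∪ Y) + r (X ∩ Y) ℕ.≤? r X + r Y)

fromRank : ∀ {r : Subset n → ℕ} → IsRankFunction r → RankFunction n
fromRank {r = r} (z , u , mono , sub) = record
  { rk = r ; rk-⊥ = z ; rk-⁅⁆ = u ; rk-mono = λ {X} {Y} → mono X Y ; rk-sub = sub }

isRankFunction : ∀ (ρ : RankFunction n) {r : Subset n → ℕ} → (∀ X → rk ρ X ≡ r X) → IsRankFunction r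
isRankFunction ρ eq = trans (sym (eq ⊥)) (rk-⊥ ρ) , (λ x → subst (_≤ 1) (eq ⁅ x ⁆) (rk-⁅⁆ ρ x)) ,
  (λ X Y X⊆Y → subst₂ _≤_ (eq X) (eq Y) (rk-mono ρ X⊆Y)) ,
  λ X Y → subst₂ _≤_ (cong₂ _+_ (eq (X ∪ Y)) (eq (X ∩ Y))) (cong₂ _+_ (eq X) (eq Y)) (rk-sub ρ X Y)

-- Elementary quotients of ρ on S are given by the sets at which the rank drops,
-- so they can be searched for.
lowered : RankFunction n → Subset n → Table n → Subset n → ℕ
lowered ρ S t X = rk ρ (X ∩ S) ∸ (if lookupᵗ t X then 1 else 0)

module _ (ρ : RankFunction n) (S : Subset n) where

  Quotient : ℕ → (Subset n → ℕ) → Set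
  Quotient d r = Σ[ rank ∈ IsRankFunction r ] ρ ↠[ S ] fromRank rank × rk ρ S ≤ suc (r S) ×
                 Cd*≤ (fromRank rank) S d

  -- The drop at `X ∩ S` is at most the drop at S, hence zero or one, and a single bit records it.
  lowering : ∀ (σ : RankFunction n) → ρ ↠[ S ] σ → rk ρ S ≤ suc (rk σ S) →
             ∃[ t ] (∀ X → rk σ (X ∩ S) ≡ lowered ρ S t X)
  lowering σ q ρ≤σ = tabulateᵗ drops , λ X → eq X (rk σ (X ∩ S) ℕ.<? rk ρ (X ∩ S)) refl
    where
    drops : Subset n → Bool
    drops X = does (rk σ (X ∩ S) ℕ.<? rk ρ (X ∩ S))
    eq : ∀ X (d : Dec (rk σ (X ∩ S) < rk ρ (X ∩ S))) → does d ≡ drops X →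
         rk σ (X ∩ S) ≡ lowered ρ S (tabulateᵗ drops) X
    eq X d e rewrite lookupᵗ∘tabulateᵗ drops X | sym e with d
    ... | yes lt = ≤-antisym (ℕ.m+n≤o⇒m≤o∸n _ (subst (_≤ rk ρ (X ∩ S)) (+-comm 1 (rk σ (X ∩ S))) lt))
      (ℕ.m≤n+o⇒m∸n≤o _ 1 (lin 4 (λ a b c d → a ⊕ b ⩽ c ⊕ d ⇒ d ⩽ lit 1 ⊕ a ⇒ ⊢ b ⩽ lit 1 ⊕ c)
        (rk σ S ∷ rk ρ (X ∩ S) ∷ rk σ (X ∩ S) ∷ rk ρ S ∷ []) (q (p∩q⊆q X S) id) ρ≤σ))
    ... | no  ≮  = ≤-antisym (↠⇒≥ ρ σ q (p∩q⊆q X S)) (≮⇒≥ ≮)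

  -- One layer of `Cd*≤` in a form fit for searching: both parts of a split are non-empty, hence
  -- smaller than S, and the quotient comes from a table.
  data Step (d : ℕ) : Set where
    flat     : rk ρ S ≡ 0 → Step d
    split    : ∀ A → Separates ρ S A → Nonempty (S ∩ A) → Nonempty (S ─ A) →
               Cd*≤ ρ (S ∩ A) d → Cd*≤ ρ (S ─ A) d → Step d
    quotient : ∀ {c} → d ≡ suc c → (t : Table n) → Quotient c (lowered ρ S t) → Step d

step⇒cd*≤ : ∀ {ρ : RankFunction n} {d} → Step ρ S d → Cd*≤ ρ S d
step⇒cd*≤ (flat z)              = flat z
step⇒cd*≤ (split A sep _ _ k l) = split A sep k l
step⇒cd*≤ (quotient refl t (rank , q , ρ≤ , k)) = quotient (fromRank rank) q ρ≤ k

cd*≤⇒step : ∀ {ρ : RankFunction n} {d} → Cd*≤ ρ S d → Step ρ S d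
cd*≤⇒step (flat z) = flat z
cd*≤⇒step {S = S} {ρ} {d} (split A sep k l) with nonempty? (S ∩ A) | nonempty? (S ─ A)
... | yes ne  | yes ne′  = split A sep ne ne′ k l
... | no  e   | _        = subst (λ S → Step ρ S d)
  (⊆-antisym (p─q⊆p S A) (set 2 (λ S A → S ⊓ A ⋐ ∅ ⇒ ⊢ S ⋐ S ∖ A) (S ∷ A ∷ []) (Empty⇒⊆⊥ e)))
  (cd*≤⇒step l)
... | yes _   | no e     = subst (λ S → Step ρ S d)
  (⊆-antisym (p∩q⊆p S A) (set 2 (λ S A → S ∖ A ⋐ ∅ ⇒ ⊢ S ⋐ S ⊓ A) (S ∷ A ∷ []) (Empty⇒⊆⊥ e)))
  (cd*≤⇒step k)
cd*≤⇒step {S = S} {ρ} (quotient σ q ρ≤σ k) with lowering ρ S σ q ρ≤σ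
... | t , eq = quotient refl t
  ( isRankFunction (restrict S σ) eq
  , (λ X⊆Y Y⊆S → subst₂ _≤_ (cong (_+ _) (eq′ Y⊆S)) (cong (_+ _) (eq′ (Y⊆S ∘ X⊆Y))) (q X⊆Y Y⊆S))
  , subst (λ r → rk ρ S ≤ suc r) (eq′ id) ρ≤σ
  , Cd*≤-cong eq′ k )
  where
  eq′ : ∀ {X} → X ⊆ S → rk σ X ≡ lowered ρ S t X
  eq′ {X} X⊆S = trans (cong (rk σ) (sym (⊆⇒∩≡ X⊆S))) (eq X)

-- Termination is lexicographic: a split keeps d and makes S smaller, a quotient keeps S and makes d
-- smaller, so that the recursion on the size starts afresh.
cd*≤? : ∀ d (ρ : RankFunction n) S → Acc _<_ (∣ S ∣) → Dec (Cd*≤ ρ S d)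
cd*≤? {n} d ρ S (acc rs) with rk ρ S ℕ.≟ 0 | anySubset? split? | quotient? d
  where
  Split : Subset n → Set
  Split A = Separates ρ S A × Nonempty (S ∩ A) × Nonempty (S ─ A) × Cd*≤ ρ (S ∩ A) d × Cd*≤ ρ (S ─ A) d

  split? : ∀ A → Dec (Split A)
  split? A with rk ρ (S ∩ A) + rk ρ (S ─ A) ℕ.≤? rk ρ S | nonempty? (S ∩ A) | nonempty? (S ─ A)
  ... | no ¬sep | _      | _      = no (¬sep ∘ proj₁)
  ... | yes _   | no  e  | _      = no (e ∘ proj₁ ∘ proj₂)
  ... | yes _   | yes _  | no  e  = no (e ∘ proj₁ ∘ proj₂ ∘ proj₂)
  ... | yes sep | yes (x , x∈) | yes (y , y∈) = map′
    (λ (k , l) → sep , (x , x∈) , (y , y∈) , k , l) (proj₂ ∘ proj₂ ∘ proj₂)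
    (cd*≤? d ρ (S ∩ A) (rs (p⊂q⇒∣p∣<∣q∣ (p∩q⊆p S A , y , p─q⊆p S A y∈ ,
        λ y∈∩ → x∈p─q⇒x∉q S A y∈ (p∩q⊆q S A y∈∩))))
     ×-dec
     cd*≤? d ρ (S ─ A) (rs (p⊂q⇒∣p∣<∣q∣ (p─q⊆p S A , x , p∩q⊆p S A x∈ ,
        λ x∈─ → x∈p─q⇒x∉q S A x∈─ (p∩q⊆q S A x∈)))))

  quotient? : ∀ d → Dec (∃[ c ] d ≡ suc c × ∃ λ t → Quotient ρ S c (lowered ρ S t))
  quotient? zero    = no λ ()
  quotient? (suc c) = map′ (λ p → c , refl , p) (λ { (_ , refl , p) → p }) (anyTable? lowered?)
    where
    lowered? : ∀ t → Dec (Quotient ρ S c (lowered ρ S t))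
    lowered? t with isRankFunction? (lowered ρ S t)
    ... | no  ¬rank = no (¬rank ∘ proj₁)
    ... | yes rank  = map′ (λ (q , ρ≤ , k) → rank , (λ {X} {Y} → q X Y) , ρ≤ , k)
      -- The given proof that the values form a rank function may differ from the one found, but
      -- `Cd*≤-cong` looks at the values alone.
      (λ (_ , q , ρ≤ , k) → (λ X Y → q) , ρ≤ , Cd*≤-cong (λ _ → refl) k)
      (allSubset? (λ X → allSubset? λ Y → (X ⊆? Y) →-dec ((Y ⊆? S) →-dec
        (lowered ρ S t Y + rk ρ X ℕ.≤? lowered ρ S t X + rk ρ Y)))
       ×-dec (rk ρ S ℕ.≤? suc (lowered ρ S t S))
       ×-dec cd*≤? c (fromRank rank) S (<-wellFounded (∣ S ∣)))
... | yes z | _ | _ = yes (flat z)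
... | no _ | yes (A , sep , _ , _ , k , l) | _ = yes (split A sep k l)
... | no _ | no _ | yes (c , refl , t , q) = yes (step⇒cd*≤ (quotient refl t q))
... | no ¬z | no ¬s | no ¬q = no λ k → refute (cd*≤⇒step k)
  where
  refute : ¬ Step ρ S d
  refute (flat z)                  = ¬z z
  refute (split A sep ne ne′ k l)  = ¬s (A , sep , ne , ne′ , k , l)
  refute (quotient eq t q)         = ¬q (_ , eq , t , q)

cd*≤-rank : ∀ (ρ : RankFunction n) S → Cd*≤ ρ S (rk ρ S)
cd*≤-rank ρ S = subst (Cd*≤ ρ S) (+-identityʳ _)
  (quotient-by (rk ρ S) {σ = zeroRank} (λ X⊆Y _ → rk-mono ρ X⊆Y) (ℕ.m≤m+n _ _) (flat refl))

least : ∀ {P : ℕ → Set} → Decidable P → ∀ {m} → P m → ∃ (IsMinimum P)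
least {P} P? {m} p = go m 0 (λ _ ()) (+-identityʳ m)
  where
  go : ∀ fuel k → (∀ j → j < k → ¬ P j) → fuel + k ≡ m → ∃ (IsMinimum P)
  go fuel k below eq with P? k
  ... | yes pk = k , pk , λ j pj → ≮⇒≥ λ j<k → below j j<k pj
  go zero k below refl | no ¬pk = contradiction p ¬pk
  go (suc fuel) k below eq | no ¬pk = go fuel (suc k) below′ (trans (+-suc fuel k) eq)
    where
    below′ : ∀ j → j < suc k → ¬ P j
    below′ j j<1+k pj with ℕ.m<1+n⇒m<n∨m≡n j<1+k
    ... | inj₁ j<k  = below j j<k pj
    ... | inj₂ refl = ¬pk pj

least-cd* : ∀ (ρ : RankFunction n) S → ∃ (IsMinimum (Cd*≤ ρ S))
least-cd* ρ S = least (λ d → cd*≤? d ρ S (<-wellFounded (∣ S ∣))) (cd*≤-rank ρ S)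

-- Trees

∑ : (Fin k → ℕ) → ℕ
∑ {zero}  f = 0
∑ {suc k} f = f zero + ∑ (f ∘ suc)

∑-mono : {f g : Fin k → ℕ} → (∀ i → f i ≤ g i) → ∑ f ≤ ∑ g
∑-mono {zero}  f≤g = z≤n
∑-mono {suc k} f≤g = +-mono-≤ (f≤g zero) (∑-mono (f≤g ∘ suc))

∑-cong : {f g : Fin k → ℕ} → (∀ i → f i ≡ g i) → ∑ f ≡ ∑ g
∑-cong {zero}  f≡g = refl
∑-cong {suc k} f≡g = cong₂ _+_ (f≡g zero) (∑-cong (f≡g ∘ suc))

∑-tabulate : ∀ {A : Set} {B : Set} {P : Pred B 0ℓ} (P? : Decidable P) (g : A → List B) (h : Fin k → A) →
             length (filter P? (concatMap g (List.tabulate h))) ≡ ∑ (λ i → length (filter P? (g (h i))))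
∑-tabulate {zero}  P? g h = refl
∑-tabulate {suc k} P? g h = begin
  length (filter P? (g (h zero) ++ rest))                    ≡⟨ cong length (List.filter-++ P? (g (h zero)) rest) ⟩
  length (filter P? (g (h zero)) ++ filter P? rest)          ≡⟨ List.length-++ (filter P? (g (h zero))) ⟩
  length (filter P? (g (h zero))) + length (filter P? rest)  ≡⟨ cong (length (filter P? (g (h zero))) +_) (∑-tabulate P? g (h ∘ suc)) ⟩
  ∑ (λ i → length (filter P? (g (h i))))                     ∎
  where
  open ≡-Reasoning
  rest = concatMap g (List.tabulate (h ∘ suc))

length-filter-map : ∀ {A B : Set} {P : Pred B 0ℓ} (P? : Decidable P) (h : A → B) xs →
                    length (filter P? (map h xs)) ≡ length (filter (P? ∘ h) xs)
length-filter-map P? h []       = refl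
length-filter-map P? h (x ∷ xs) with does (P? (h x))
... | true  = cong suc (length-filter-map P? h xs)
... | false = length-filter-map P? h xs

does⁻ : ∀ {P : Set} (d : Dec P) → T (does d) → P
does⁻ (yes p) _ = p

does⁺ : ∀ {P : Set} (d : Dec P) → P → T (does d)
does⁺ d p rewrite dec-true d p = tt

bit : Bool → ℕ
bit b = if b then 1 else 0

bit-mono : ∀ {a b} → (T a → T b) → bit a ≤ bit b
bit-mono {false}         f = z≤n
bit-mono {true}  {true}  f = ≤-refl
bit-mono {true}  {false} f = contradiction (f tt) id

-- Edges are given by their lower ends.
count count⁺ : (t : Tree) → (Vertex t → Bool) → ℕ
count  (node ts) p = bit (p root) + ∑ λ i → count (ts i) (p ∘ child i)
count⁺ (node ts) p = ∑ λ i → count (ts i) (p ∘ child i)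

count≡ : ∀ t (p : Vertex t → Bool) → count t p ≡ bit (p root) + count⁺ t p
count≡ (node ts) p = refl

count-filter : ∀ t {P : Pred (Vertex t) 0ℓ} (P? : Decidable P) →
               length (filter P? (vertices t)) ≡ count t (does ∘ P?)
count-filter (node {k} ts) P? = begin
  length (filter P? (root ∷ rest))                 ≡⟨ head ⟩
  bit (does (P? root)) + length (filter P? rest)   ≡⟨ cong (bit (does (P? root)) +_) (trans
    (∑-tabulate P? (λ i → map (child i) (vertices (ts i))) id)
    (∑-cong λ i → trans (length-filter-map P? (child i) (vertices (ts i))) (count-filter (ts i) (P? ∘ child i)))) ⟩
  count (node ts) (does ∘ P?)                      ∎
  where
  open ≡-Reasoning
  rest = concatMap (λ i → map (child i) (vertices (ts i))) (allFin k)
  head : length (filter P? (root ∷ rest)) ≡ bit (does (P? root)) + length (filter P? rest)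
  head with does (P? root)
  ... | true  = refl
  ... | false = refl

count-mono : ∀ t {p q : Vertex t → Bool} → (∀ v → T (p v) → T (q v)) → count t p ≤ count t q
count-mono (node ts) p⇒q = +-mono-≤ (bit-mono (p⇒q root)) (∑-mono λ i → count-mono (ts i) (p⇒q ∘ child i))

count⁺-mono : ∀ t {p q : Vertex t → Bool} → (∀ v → v ≢ root → T (p v) → T (q v)) → count⁺ t p ≤ count⁺ t q
count⁺-mono (node ts) p⇒q = ∑-mono λ i → count-mono (ts i) λ v → p⇒q (child i v) λ ()

count-none : ∀ t {p : Vertex t → Bool} → (∀ v → ¬ T (p v)) → count t p ≡ 0
count-none (node ts) {p} none = cong₂ _+_ (ℕ.n≤0⇒n≡0 (bit-mono {b = false} (none root))) (∑-zero λ i → count-none (ts i) (none ∘ child i))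
  where
  ∑-zero : {f : Fin k → ℕ} → (∀ i → f i ≡ 0) → ∑ f ≡ 0
  ∑-zero {zero}  z = refl
  ∑-zero {suc k} z = cong₂ _+_ (z zero) (∑-zero (z ∘ suc))

edges≡count⁺ : ∀ t → edges t ≡ count⁺ t (λ _ → true)
edges≡count⁺ t@(node ts) = count-filter t (¬? ∘ root?)

spanned : {t : Tree} → (Fin n → Vertex t) → Subset n → Vertex t → Bool
spanned f X v = does (v ∈⟨ image f X ⟩?)

edges⟨⟩≡count⁺ : ∀ t (f : Fin n → Vertex t) X → edges⟨ image f X ⟩ ≡ count⁺ t (spanned f X)
edges⟨⟩≡count⁺ t@(node ts) f X = count-filter t (λ v → ¬? (root? v) ×-dec v ∈⟨ image f X ⟩?)

spanned⁺ : ∀ {t} (f : Fin n → Vertex t) {X v x} → x ∈ X → v ≼ f x → T (spanned f X v)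
spanned⁺ f {X} {v} {x} x∈X v≼ = does⁺ (v ∈⟨ image f X ⟩?) (there (lose
  (∈ₗ.∈-map⁺ f (∈ₗ.∈-filter⁺ (_∈? X) (∈ₗ.∈-allFin x) x∈X)) v≼))

spanned⁻ : ∀ {t} (f : Fin n → Vertex t) X v → T (spanned f X v) → v ≡ root ⊎ ∃[ x ] x ∈ X × v ≼ f x
spanned⁻ {n} f X v s with does⁻ (v ∈⟨ image f X ⟩?) s
... | here root   = inj₁ refl
... | there v∈ with findₗ v∈
... | y , y∈ , v≼y with ∈ₗ.∈-map⁻ f {xs = filter (_∈? X) (allFin n)} y∈
... | x , x∈ , refl = inj₂ (x , proj₂ (∈ₗ.∈-filter⁻ (_∈? X) {xs = allFin n} x∈) , v≼y)

spanned⁻′ : ∀ {t} (f : Fin n → Vertex t) X v → v ≢ root → T (spanned f X v) → ∃[ x ] x ∈ X × v ≼ f x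
spanned⁻′ f X v v≢root s with spanned⁻ f X v s
... | inj₁ v≡root = contradiction v≡root v≢root
... | inj₂ r      = r

leaf-below : ∀ t (v : Vertex t) → ∃[ w ] Leaf w × v ≼ w
leaf-below (node {zero}  ts) root = root , refl , root
leaf-below (node {suc k} ts) root with leaf-below (ts zero) root
... | w , leaf , _ = child zero w , leaf , root
leaf-below (node ts) (child i v) with leaf-below (ts i) v
... | w , leaf , v≼w = child i w , leaf , child v≼w

level-mono : ∀ {t} {u v : Vertex t} → u ≼ v → level u ≤ level v
level-mono root      = z≤n
level-mono (child p) = s≤s (level-mono p)

∈-vertices : ∀ t (v : Vertex t) → v ∈ₗ vertices t
∈-vertices (node ts) root        = here refl
∈-vertices (node ts) (child i v) = there (∈ₗ.∈-concatMap⁺ (λ i → map (child i) (vertices (ts i)))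
  (lose (∈ₗ.∈-allFin i) (∈ₗ.∈-map⁺ (child i) (∈-vertices (ts i) v))))

level≤depth : ∀ t (v : Vertex t) → level v ≤ depth t
level≤depth t v with leaf-below t v
... | w , leaf , v≼w = v≤max⁺ 0 (map level (filter (λ v → #children v ℕ.≟ 0) (vertices t))) (inj₂ (lose
  (∈ₗ.∈-map⁺ level (∈ₗ.∈-filter⁺ (λ v → #children v ℕ.≟ 0) (∈-vertices t w) leaf)) (level-mono v≼w)))

depth≤ : ∀ t {d} → (∀ (v : Vertex t) → level v ≤ d) → depth t ≤ d
depth≤ t level≤d = max≤v⁺ {xs = map level (filter (λ v → #children v ℕ.≟ 0) (vertices t))} z≤n
  (All.map⁺ (All.tabulate λ {v} _ → level≤d v))

-- From trees to shapes

part : {ts : Fin k → Tree} (i : Fin k) → Vertex (node ts) → Vertex (ts i)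
part i root = root
part i (child j v) with j Fin.≟ i
... | yes refl = v
-- The default is immaterial: in `shape`, the branch of child i is only ever asked about elements of
-- `inside-child f i`.
... | no  _    = root

part-child : {ts : Fin k → Tree} (i : Fin k) (v : Vertex (ts i)) → part {ts = ts} i (child i v) ≡ v
part-child i v with i Fin.≟ i
... | yes refl = refl
... | no  i≢i  = contradiction refl i≢i

InChild : {ts : Fin k → Tree} → Fin k → Vertex (node ts) → Set
InChild {ts = ts} i w = ∃[ v ] w ≡ child {ts = ts} i v

inChild? : {ts : Fin k → Tree} (i : Fin k) (w : Vertex (node ts)) → Dec (InChild i w)
inChild? i root = no λ ()
inChild? i (child j v) with j Fin.≟ i
... | yes refl = yes (v , refl)
... | no  j≢i  = no λ { (_ , refl) → j≢i refl }

inside-child : {ts : Fin k → Tree} → (Fin n → Vertex (node ts)) → Fin k → Subset n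
inside-child f i = tabulate λ x → does (inChild? i (f x))

∈-child⁺ : {ts : Fin k → Tree} (f : Fin n → Vertex (node ts)) (i : Fin k) {x : Fin n} →
           InChild i (f x) → x ∈ inside-child f i
∈-child⁺ f i {x} c = Vec.lookup⇒[]= x _ (trans (Vec.lookup∘tabulate _ x) (dec-true (inChild? i (f x)) c))

∈-child⁻ : {ts : Fin k → Tree} (f : Fin n → Vertex (node ts)) (i : Fin k) {x : Fin n} →
           x ∈ inside-child f i → InChild i (f x)
∈-child⁻ f i {x} x∈ = does⁻ (inChild? i (f x)) (subst T
  (trans (sym (Vec.[]=⇒lookup x∈)) (Vec.lookup∘tabulate (λ x → does (inChild? i (f x))) x)) tt)

-- Elements placed at the root belong to no child and fall through to the final `nil`, where they
-- span nothing.
joinAll : (Fin k → Subset n) → (Fin k → Shape n) → Shape n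
joinAll {zero}  A s = nil
joinAll {suc k} A s = join (A zero) (up (s zero)) (joinAll (A ∘ suc) (s ∘ suc))

ups-joinAll : ∀ (A : Fin k → Subset n) s → ups (joinAll A s) ≡ ∑ (λ i → suc (ups (s i)))
ups-joinAll {zero}  A s = refl
ups-joinAll {suc k} A s = cong (suc (ups (s zero)) +_) (ups-joinAll (A ∘ suc) (s ∘ suc))

height-joinAll : ∀ (A : Fin k → Subset n) s {d} → (∀ i → suc (height (s i)) ≤ d) → height (joinAll A s) ≤ d
height-joinAll {zero}  A s h = z≤n
height-joinAll {suc k} A s h = ℕ.⊔-lub (h zero) (height-joinAll (A ∘ suc) (s ∘ suc) (h ∘ suc))

-- A `join` removes `A zero` from what the later branches see; disjointness guarantees that they
-- lose nothing by it.
span-joinAll : ∀ (A : Fin k → Subset n) s X → (∀ {i j x} → x ∈ A i → x ∈ A j → i ≡ j) →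
               ∑ (λ i → span (up (s i)) (X ∩ A i)) ≤ span (joinAll A s) X
span-joinAll {zero}  A s X disjoint = z≤n
span-joinAll {suc k} A s X disjoint = +-monoʳ-≤ (span (up (s zero)) (X ∩ A zero)) (≤-trans
  (≤-reflexive (∑-cong λ i → cong (span (up (s (suc i)))) (later i)))
  (span-joinAll (A ∘ suc) (s ∘ suc) (X ─ A zero) λ p q → Fin.suc-injective (disjoint p q)))
  where
  later : ∀ i → X ∩ A (suc i) ≡ (X ─ A zero) ∩ A (suc i)
  later i = ⊆-antisym
    (λ p → let p₁ , p₂ = x∈p∩q⁻ X (A (suc i)) p in
      x∈p∩q⁺ (x∈p∧x∉q⇒x∈p─q p₁ (λ p₀ → Fin.0≢1+n (disjoint p₀ p₂)) , p₂))
    (set 3 (λ X A B → ⊢ (X ∖ A) ⊓ B ⋐ X ⊓ B) (X ∷ A zero ∷ A (suc i) ∷ []))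

shape : (t : Tree) → (Fin n → Vertex t) → Shape n
shape (node ts) f = joinAll (inside-child f) (λ i → shape (ts i) (part i ∘ f))

ups-shape : ∀ t (f : Fin n → Vertex t) → ups (shape t f) ≡ count⁺ t (λ _ → true)
ups-shape (node ts) f = trans (ups-joinAll (inside-child f) _) (∑-cong λ i →
  trans (cong suc (ups-shape (ts i) (part i ∘ f))) (sym (count≡ (ts i) _)))

height-shape : ∀ t (f : Fin n → Vertex t) {d} → (∀ (v : Vertex t) → level v ≤ d) → height (shape t f) ≤ d
height-shape (node ts) f {d} level≤d = height-joinAll (inside-child f) _ λ i → go i d level≤d
  where
  go : ∀ i d → (∀ v → level v ≤ d) → suc (height (shape (ts i) (part i ∘ f))) ≤ d
  go i zero    l = contradiction (l (child i root)) λ ()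
  go i (suc d) l = s≤s (height-shape (ts i) (part i ∘ f) λ v → ℕ.≤-pred (l (child i v)))

span-shape : ∀ t (f : Fin n → Vertex t) X → count⁺ t (spanned f X) ≤ span (shape t f) X
span-shape {n} t@(node {k} ts) f X = ≤-trans (∑-mono bound)
  (span-joinAll (inside-child f) s X disjoint)
  where
  s : Fin k → Shape n
  s i = shape (ts i) (part i ∘ f)

  disjoint : ∀ {i j x} → x ∈ inside-child f i → x ∈ inside-child f j → i ≡ j
  disjoint {i} {j} p q with ∈-child⁻ f i p | ∈-child⁻ f j q
  ... | v , eq | w , eq′ with trans (sym eq) eq′
  ... | refl = refl

  reach : ∀ i v → T (spanned f X (child i v)) →
          ∃[ x ] x ∈ X ∩ inside-child f i × v ≼ part i (f x)
  reach i v sp with spanned⁻′ f X (child i v) (λ ()) sp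
  ... | x , x∈X , v≼ with f x in eq
  reach i v sp | x , x∈X , child {v = w} v≼w | child .i .w =
    x , x∈p∩q⁺ (x∈X , ∈-child⁺ f i (w , eq)) , subst (v ≼_) (sym (trans (cong (part i) eq) (part-child i w))) v≼w

  bound : ∀ i → count (ts i) (λ v → spanned f X (child i v)) ≤ span (up (s i)) (X ∩ inside-child f i)
  bound i with nonempty? (X ∩ inside-child f i)
  ... | no empty = ≤-reflexive (count-none (ts i) λ v sp →
    let x , x∈ , _ = reach i v sp in empty (x , x∈))
  ... | yes _ = ≤-trans (≤-reflexive (count≡ (ts i) _)) (+-mono-≤ (bit-mono {b = true} _)
    (≤-trans (count⁺-mono (ts i) λ v _ sp → let x , x∈ , v≼ = reach i v sp in spanned⁺ (part i ∘ f) x∈ v≼)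
      (span-shape (ts i) (part i ∘ f) (X ∩ inside-child f i))))

-- From shapes to trees

graft : Tree → Tree → Tree
graft s (node {k} ts) = node {suc k} λ { zero → s ; (suc i) → ts i }

graft-new : ∀ {s u} → Vertex s → Vertex (graft s u)
graft-new {u = node ts} v = child zero v

graft-old : ∀ {s u} → Vertex u → Vertex (graft s u)
graft-old              root        = root
graft-old {u = node _} (child i v) = child (suc i) v

graft-new-≼ : ∀ {s u} {v w : Vertex s} → v ≼ w → graft-new {s} {u} v ≼ graft-new {s} {u} w
graft-new-≼ {u = node ts} p = child p

graft-old-≼ : ∀ {s u} {v w : Vertex u} → v ≼ w → graft-old {s} {u} v ≼ graft-old {s} {u} w
graft-old-≼              root      = root
graft-old-≼ {u = node _} (child p) = child p

count⁺-graft : ∀ s u (p : Vertex (graft s u) → Bool) →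
               count⁺ (graft s u) p ≡ count s (p ∘ graft-new {s} {u}) + count⁺ u (p ∘ graft-old {s} {u})
count⁺-graft s (node us) p = refl

level-graft : ∀ s u {d} → (∀ (v : Vertex s) → suc (level v) ≤ d) → (∀ (v : Vertex u) → level v ≤ d) →
              ∀ (v : Vertex (graft s u)) → level v ≤ d
level-graft s (node us) ls lu root              = z≤n
level-graft s (node us) ls lu (child zero v)    = ls v
level-graft s (node us) ls lu (child (suc i) v) = lu (child i v)

-- The roots of `node ts` and u are identified. Grafting one child at a time keeps the child indices
-- free of arithmetic.
merge : (Fin k → Tree) → Tree → Tree
merge {zero}  ts u = u
merge {suc k} ts u = graft (ts zero) (merge (ts ∘ suc) u)

left : ∀ (ts : Fin k → Tree) u → Vertex (node ts) → Vertex (merge ts u)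
left ts u root = root
left {suc k} ts u (child zero v)    = graft-new {ts zero} {merge (ts ∘ suc) u} v
left {suc k} ts u (child (suc i) v) = graft-old {ts zero} (left (ts ∘ suc) u (child i v))

right : ∀ (ts : Fin k → Tree) u → Vertex u → Vertex (merge ts u)
right {zero}  ts u v = v
right {suc k} ts u v = graft-old {ts zero} (right (ts ∘ suc) u v)

left-≼ : ∀ (ts : Fin k → Tree) u {v w} → v ≼ w → left ts u v ≼ left ts u w
left-≼ ts u root = root
left-≼ {suc k} ts u (child {i = zero}  p) = graft-new-≼ {ts zero} {merge (ts ∘ suc) u} p
left-≼ {suc k} ts u (child {i = suc i} p) = graft-old-≼ {ts zero} (left-≼ (ts ∘ suc) u (child {i = i} p))

right-≼ : ∀ (ts : Fin k → Tree) u {v w} → v ≼ w → right ts u v ≼ right ts u w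
right-≼ {zero}  ts u p = p
right-≼ {suc k} ts u p = graft-old-≼ {ts zero} (right-≼ (ts ∘ suc) u p)

count⁺-merge : ∀ (ts : Fin k → Tree) u (p : Vertex (merge ts u) → Bool) →
               count⁺ (merge ts u) p ≡ count⁺ (node ts) (p ∘ left ts u) + count⁺ u (p ∘ right ts u)
count⁺-merge {zero}  ts u p = refl
count⁺-merge {suc k} ts u p = trans (count⁺-graft (ts zero) (merge (ts ∘ suc) u) p)
  (trans (cong (count (ts zero) (p ∘ graft-new {ts zero} {merge (ts ∘ suc) u}) +_)
    (count⁺-merge (ts ∘ suc) u (p ∘ graft-old {ts zero})))
  (sym (ℕ.+-assoc (count (ts zero) (p ∘ graft-new {ts zero} {merge (ts ∘ suc) u})) _ _)))

level-merge : ∀ (ts : Fin k → Tree) u {d} → (∀ (v : Vertex (node ts)) → level v ≤ d) →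
              (∀ (v : Vertex u) → level v ≤ d) → ∀ (v : Vertex (merge ts u)) → level v ≤ d
level-merge {zero}  ts u lt lu = lu
level-merge {suc k} ts u lt lu = level-graft (ts zero) (merge (ts ∘ suc) u) (lt ∘ child zero)
  (level-merge (ts ∘ suc) u (λ { root → z≤n ; (child i v) → lt (child (suc i) v) }) lu)

-- Positions may be inner vertices. They are moved down to leaves only in `decomposition`, which can
-- but enlarge the spanned subtrees.
record Placement (t : Shape n) : Set where
  field
    tree      : Tree
    position  : Fin n → Vertex tree
    edges-ups : count⁺ tree (λ _ → true) ≡ ups t
    level-≤   : ∀ (v : Vertex tree) → level v ≤ height t
    span-≤    : ∀ X → span t X ≤ count⁺ tree (spanned position X)

placement : ∀ (t : Shape n) → Placement t
placement nil = record
  { tree      = node {0} λ ()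
  ; position  = λ _ → root
  ; edges-ups = refl
  ; level-≤   = λ { root → z≤n ; (child () _) }
  ; span-≤    = λ _ → z≤n
  }
placement {n} (up t) = record
  { tree      = node ts
  ; position  = position
  ; edges-ups = trans (+-identityʳ _) (trans (count≡ (p .tree) _) (cong suc (p .edges-ups)))
  ; level-≤   = λ { root → z≤n ; (child zero v) → s≤s (p .level-≤ v) }
  ; span-≤    = bound
  }
  where
  open Placement using (tree; edges-ups; level-≤; span-≤)
  p = placement t
  ts : Fin 1 → Tree
  ts _ = p .tree
  position : Fin n → Vertex (node ts)
  position x = child zero (Placement.position p x)
  bound : ∀ X → stem 1 (span t) X ≤ count⁺ (node ts) (spanned position X)
  bound X with nonempty? X
  ... | no _ = z≤n
  ... | yes (x , x∈X) = ≤-trans (+-mono-≤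
    (bit-mono {b = spanned position X (child zero root)} λ _ → spanned⁺ position x∈X (child root))
    (≤-trans (p .span-≤ X) (count⁺-mono (p .tree) λ v v≢ sp →
      let x , x∈ , v≼ = spanned⁻′ (Placement.position p) X v v≢ sp in spanned⁺ position x∈ (child v≼))))
    (≤-reflexive (trans (sym (count≡ (p .tree) _)) (sym (+-identityʳ _))))
placement {n} (join A t u) with placement t | placement u
... | record { tree = node ts ; position = f ; edges-ups = et ; level-≤ = lt ; span-≤ = st }
    | record { tree = U ; position = g ; edges-ups = eu ; level-≤ = lu ; span-≤ = su } = record
  { tree      = merge ts U
  ; position  = h
  ; edges-ups = trans (count⁺-merge ts U _) (cong₂ _+_ et eu)
  ; level-≤   = level-merge ts U (λ v → ≤-trans (lt v) (ℕ.m≤m⊔n _ _))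
                  (λ v → ≤-trans (lu v) (ℕ.m≤n⊔m (height t) _))
  ; span-≤    = λ X → ≤-trans
      (+-mono-≤ (≤-trans (st (X ∩ A)) (count⁺-mono (node ts) (from-left X)))
        (≤-trans (su (X ─ A)) (count⁺-mono U (from-right X))))
      (≤-reflexive (sym (count⁺-merge ts U _)))
  }
  where
  h : Fin n → Vertex (merge ts U)
  h x = if does (x ∈? A) then left ts U (f x) else right ts U (g x)

  from-left : ∀ X v → v ≢ root → T (spanned f (X ∩ A) v) → T (spanned h X (left ts U v))
  from-left X v v≢ sp with spanned⁻′ f (X ∩ A) v v≢ sp
  ... | x , x∈ , v≼ = spanned⁺ h (p∩q⊆p X A x∈) (subst (left ts U v ≼_) h-x (left-≼ ts U v≼))
    where
    h-x : left ts U (f x) ≡ h x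
    h-x rewrite dec-true (x ∈? A) (p∩q⊆q X A x∈) = refl

  from-right : ∀ X v → v ≢ root → T (spanned g (X ─ A) v) → T (spanned h X (right ts U v))
  from-right X v v≢ sp with spanned⁻′ g (X ─ A) v v≢ sp
  ... | x , x∈ , v≼ = spanned⁺ h (p─q⊆p X A x∈) (subst (right ts U v ≼_) h-x (right-≼ ts U v≼))
    where
    h-x : right ts U (g x) ≡ h x
    h-x rewrite dec-false (x ∈? A) (x∈p─q⇒x∉q X A x∈) = refl

decomposition : ∀ (M : Matroid n) (ρ : RankFunction n) → (∀ X → rank M X ≡ rk ρ X) → ∀ {d} → Cd*≤ ρ ⊤ d →
                Σ[ D ∈ Contraction*Decomposition M ] depth (tree D) ≤ d
decomposition {n} M ρ M≡ρ k with spanning-shape k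
... | t , ht , ut , bt = record
  { tree   = P.tree
  ; edges≡ = trans (edges≡count⁺ P.tree) (trans P.edges-ups (trans ut (sym (M≡ρ ⊤))))
  ; f      = f′
  ; f-leaf = λ x → proj₁ (proj₂ (leaf-below P.tree (P.position x)))
  ; rank≤  = λ X → ≤-trans (≤-reflexive (M≡ρ X)) (≤-trans (bt ⊆⊤) (≤-trans (P.span-≤ X)
      (≤-trans (count⁺-mono P.tree (λ v v≢ sp →
        let x , x∈ , v≼ = spanned⁻′ P.position X v v≢ sp in
        spanned⁺ f′ x∈ (≼-trans v≼ (proj₂ (proj₂ (leaf-below P.tree (P.position x)))))))
      (≤-reflexive (sym (edges⟨⟩≡count⁺ P.tree f′ X))))))
  } , ≤-trans (depth≤ P.tree P.level-≤) ht
  where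
  module P = Placement (placement t)
  f′ : Fin n → Vertex P.tree
  f′ x = proj₁ (leaf-below P.tree (P.position x))

cd*≤-depth : ∀ (M : Matroid n) (ρ : RankFunction n) → (∀ X → rank M X ≡ rk ρ X) →
             ∀ (D : Contraction*Decomposition M) → Cd*≤ ρ ⊤ (depth (tree D))
cd*≤-depth M ρ M≡ρ D = Cd*≤-mono (height-shape (tree D) (f D) (level≤depth (tree D)))
  (realizes (shape (tree D) (f D)) 0 ρ ⊤
    (λ {X} _ _ → ≤-trans (≤-reflexive (sym (M≡ρ X))) (≤-trans (rank≤ D X)
      (≤-trans (≤-reflexive (edges⟨⟩≡count⁺ (tree D) (f D) X)) (span-shape (tree D) (f D) X))))
    (≤-reflexive (trans (ups-shape (tree D) (f D)) (trans (sym (edges≡count⁺ (tree D)))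
      (trans (edges≡ D) (M≡ρ ⊤))))))

-- Contraction-depth of rank functions

-- The choice of steps is free: connected or not, a set may be split or have an element contracted.
-- That this freedom never beats `cd` is the content of `cd-sound`. A `point` may also be empty, as
-- arises from a sum with an empty part.
data Cd≤ {n} (ρ : RankFunction n) (S : Subset n) : ℕ → Set where
  point       : ∀ {k} → (∀ {x y} → x ∈ S → y ∈ S → x ≡ y) → Cd≤ ρ S (suc k)
  sum         : ∀ {k} A → Separates ρ S A → Cd≤ ρ (S ∩ A) k → Cd≤ ρ (S ─ A) k → Cd≤ ρ S k
  contraction : ∀ {k p} → p ∈ S → Cd≤ (contract ⁅ p ⁆ ρ) (S ─ ⁅ p ⁆) k → Cd≤ ρ S (suc k)

Cd≤-mono : ∀ {ρ : RankFunction n} {j k} → j ≤ k → Cd≤ ρ S j → Cd≤ ρ S k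
Cd≤-mono (s≤s j≤k) (point sub)         = point sub
Cd≤-mono j≤k       (sum A sep c d)     = sum A sep (Cd≤-mono j≤k c) (Cd≤-mono j≤k d)
Cd≤-mono (s≤s j≤k) (contraction p∈S c) = contraction p∈S (Cd≤-mono j≤k c)

Cd≤-positive : ∀ {ρ : RankFunction n} → Cd≤ ρ S k → 1 ≤ k
Cd≤-positive (point _)         = s≤s z≤n
Cd≤-positive (sum _ _ c _)     = Cd≤-positive c
Cd≤-positive (contraction _ _) = s≤s z≤n

Cd≤-cong : ∀ {ρ σ : RankFunction n} → (∀ {X} → X ⊆ S → rk ρ X ≡ rk σ X) → Cd≤ ρ S k → Cd≤ σ S k
Cd≤-cong eq (point sub) = point sub
Cd≤-cong {S = S} eq (sum A sep c d) = sum A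
  (subst₂ _≤_ (cong₂ _+_ (eq (p∩q⊆p S A)) (eq (p─q⊆p S A))) (eq id) sep)
  (Cd≤-cong (λ {X} X⊆ → eq (⊆-trans {_} {X} X⊆ (p∩q⊆p S A))) c)
  (Cd≤-cong (λ {X} X⊆ → eq (⊆-trans {_} {X} X⊆ (p─q⊆p S A))) d)
Cd≤-cong {S = S} eq (contraction {p = p} p∈S c) = contraction p∈S (Cd≤-cong
  (λ {X} X⊆ → cong₂ _∸_ (eq (set 3 (λ X S P → X ⋐ S ∖ P ⇒ P ⋐ S ⇒ ⊢ X ⊔ P ⋐ S) (X ∷ S ∷ ⁅ p ⁆ ∷ []) X⊆ (∈⇒⁅⁆⊆ p∈S)))
    (eq (∈⇒⁅⁆⊆ p∈S))) c)

separates-contract : ∀ (ρ : RankFunction n) {p} → p ∈ S → Separates ρ S A →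
                     Separates (contract ⁅ p ⁆ ρ) (S ─ ⁅ p ⁆) A
separates-contract {S = S} {A} ρ {p} p∈S sep with p ∈? A
... | yes p∈A = lin 7 (λ c sa sb s ca cb cs →
    sa ⊕ sb ⩽ s ⇒ c ⊕ ca ⩽ sa ⇒ c ⊕ cb ⩽ sb ⊕ c ⇒ s ⩽ c ⊕ cs ⇒ ⊢ ca ⊕ cb ⩽ cs)
  (rk ρ ⁅ p ⁆ ∷ rk ρ (S ∩ A) ∷ rk ρ (S ─ A) ∷ rk ρ S ∷ rk σ ((S ─ ⁅ p ⁆) ∩ A) ∷ rk σ ((S ─ ⁅ p ⁆) ─ A) ∷ rk σ (S ─ ⁅ p ⁆) ∷ [])
  sep
  (≤-trans (≤-reflexive (sym (rk-contract ρ ⁅ p ⁆ ((S ─ ⁅ p ⁆) ∩ A)))) (rk-mono ρ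
    (set 3 (λ S A P → P ⋐ S ⇒ P ⋐ A ⇒ ⊢ (S ∖ P) ⊓ A ⊔ P ⋐ S ⊓ A) (S ∷ A ∷ ⁅ p ⁆ ∷ []) (∈⇒⁅⁆⊆ p∈S) (∈⇒⁅⁆⊆ p∈A))))
  (≤-trans (≤-reflexive (sym (rk-contract ρ ⁅ p ⁆ ((S ─ ⁅ p ⁆) ─ A)))) (subadditive ρ
    (set 3 (λ S A P → ⊢ ((S ∖ P) ∖ A) ⊔ P ⋐ (S ∖ A) ⊔ P) (S ∷ A ∷ ⁅ p ⁆ ∷ []))))
  (≤-trans (rk-mono ρ (set 2 (λ S P → ⊢ S ⋐ (S ∖ P) ⊔ P) (S ∷ ⁅ p ⁆ ∷ []))) (≤-reflexive (rk-contract ρ ⁅ p ⁆ (S ─ ⁅ p ⁆))))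
  where σ = contract ⁅ p ⁆ ρ
... | no  p∉A = lin 7 (λ c sa sb s ca cb cs →
    sa ⊕ sb ⩽ s ⇒ c ⊕ ca ⩽ sa ⊕ c ⇒ c ⊕ cb ⩽ sb ⇒ s ⩽ c ⊕ cs ⇒ ⊢ ca ⊕ cb ⩽ cs)
  (rk ρ ⁅ p ⁆ ∷ rk ρ (S ∩ A) ∷ rk ρ (S ─ A) ∷ rk ρ S ∷ rk σ ((S ─ ⁅ p ⁆) ∩ A) ∷ rk σ ((S ─ ⁅ p ⁆) ─ A) ∷ rk σ (S ─ ⁅ p ⁆) ∷ [])
  sep
  (≤-trans (≤-reflexive (sym (rk-contract ρ ⁅ p ⁆ ((S ─ ⁅ p ⁆) ∩ A)))) (subadditive ρ
    (set 3 (λ S A P → ⊢ (S ∖ P) ⊓ A ⊔ P ⋐ S ⊓ A ⊔ P) (S ∷ A ∷ ⁅ p ⁆ ∷ []))))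
  (≤-trans (≤-reflexive (sym (rk-contract ρ ⁅ p ⁆ ((S ─ ⁅ p ⁆) ─ A)))) (rk-mono ρ
    (set 3 (λ S A P → P ⋐ S ⇒ P ⊓ A ⋐ ∅ ⇒ ⊢ ((S ∖ P) ∖ A) ⊔ P ⋐ S ∖ A) (S ∷ A ∷ ⁅ p ⁆ ∷ []) (∈⇒⁅⁆⊆ p∈S) (∉⇒⁅⁆∩⊆⊥ p∉A))))
  (≤-trans (rk-mono ρ (set 2 (λ S P → ⊢ S ⋐ (S ∖ P) ⊔ P) (S ∷ ⁅ p ⁆ ∷ []))) (≤-reflexive (rk-contract ρ ⁅ p ⁆ (S ─ ⁅ p ⁆))))
  where σ = contract ⁅ p ⁆ ρ

Cd≤-∩ : ∀ {ρ : RankFunction n} → Separates ρ S A → Cd≤ ρ S k → Cd≤ ρ (S ∩ A) k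
Cd≤-∩ {S = S} {A} sep (point sub) = point λ p q → sub (p∩q⊆p S A p) (p∩q⊆p S A q)
Cd≤-∩ {S = S} {A} {ρ = ρ} sep (sum B sepB c d) = sum B
  (Separates-⊆ ρ sepB (p∩q⊆p S A))
  (subst (λ T → Cd≤ ρ T _)
    (⊆-antisym (set 3 (λ S A B → ⊢ (S ⊓ B) ⊓ A ⋐ (S ⊓ A) ⊓ B) (S ∷ A ∷ B ∷ []))
               (set 3 (λ S A B → ⊢ (S ⊓ A) ⊓ B ⋐ (S ⊓ B) ⊓ A) (S ∷ A ∷ B ∷ [])))
    (Cd≤-∩ (Separates-⊆ ρ sep (p∩q⊆p S B)) c))
  (subst (λ T → Cd≤ ρ T _)
    (⊆-antisym (set 3 (λ S A B → ⊢ (S ∖ B) ⊓ A ⋐ (S ⊓ A) ∖ B) (S ∷ A ∷ B ∷ []))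
               (set 3 (λ S A B → ⊢ (S ⊓ A) ∖ B ⋐ (S ∖ B) ⊓ A) (S ∷ A ∷ B ∷ [])))
    (Cd≤-∩ (Separates-⊆ ρ sep (p─q⊆p S B)) d))
Cd≤-∩ {S = S} {A} {ρ = ρ} sep (contraction {p = p} p∈S c) with p ∈? A
... | yes p∈A = contraction (x∈p∩q⁺ (p∈S , p∈A)) (subst (λ T → Cd≤ (contract ⁅ p ⁆ ρ) T _)
  (⊆-antisym (set 3 (λ S A P → ⊢ (S ∖ P) ⊓ A ⋐ (S ⊓ A) ∖ P) (S ∷ A ∷ ⁅ p ⁆ ∷ []))
             (set 3 (λ S A P → ⊢ (S ⊓ A) ∖ P ⋐ (S ∖ P) ⊓ A) (S ∷ A ∷ ⁅ p ⁆ ∷ [])))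
  (Cd≤-∩ (separates-contract ρ p∈S sep) c))
... | no  p∉A = Cd≤-mono (ℕ.n≤1+n _) (Cd≤-cong unchanged (subst (λ T → Cd≤ (contract ⁅ p ⁆ ρ) T _)
  (⊆-antisym (set 3 (λ S A P → ⊢ (S ∖ P) ⊓ A ⋐ S ⊓ A) (S ∷ A ∷ ⁅ p ⁆ ∷ []))
             (set 3 (λ S A P → P ⊓ A ⋐ ∅ ⇒ ⊢ S ⊓ A ⋐ (S ∖ P) ⊓ A) (S ∷ A ∷ ⁅ p ⁆ ∷ []) (∉⇒⁅⁆∩⊆⊥ p∉A)))
  (Cd≤-∩ (separates-contract ρ p∈S sep) c)))
  where
  P = ⁅ p ⁆
  unchanged : ∀ {X} → X ⊆ S ∩ A → rk (contract P ρ) X ≡ rk ρ X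
  unchanged {X} X⊆ = ≤-antisym
    (ℕ.m≤n+o⇒m∸n≤o _ (rk ρ P) (subadditive ρ (set 2 (λ X P → ⊢ X ⊔ P ⋐ P ⊔ X) (X ∷ P ∷ []))))
    (lin 6 (λ x p xa xb u c → xa ⊕ xb ⩽ u ⇒ x ⩽ xa ⇒ p ⩽ xb ⇒ u ⩽ p ⊕ c ⇒ ⊢ x ⩽ c)
      (rk ρ X ∷ rk ρ P ∷ rk ρ ((X ∪ P) ∩ A) ∷ rk ρ ((X ∪ P) ─ A) ∷ rk ρ (X ∪ P) ∷ rk (contract P ρ) X ∷ [])
      (Separates-⊆ ρ sep (set 4 (λ X P S A → X ⋐ S ⊓ A ⇒ P ⋐ S ⇒ ⊢ X ⊔ P ⋐ S) (X ∷ P ∷ S ∷ A ∷ []) X⊆ (∈⇒⁅⁆⊆ p∈S)))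
      (rk-mono ρ (set 4 (λ X P S A → X ⋐ S ⊓ A ⇒ ⊢ X ⋐ (X ⊔ P) ⊓ A) (X ∷ P ∷ S ∷ A ∷ []) X⊆))
      (rk-mono ρ (set 4 (λ X P S A → P ⊓ A ⋐ ∅ ⇒ ⊢ P ⋐ (X ⊔ P) ∖ A) (X ∷ P ∷ S ∷ A ∷ []) (∉⇒⁅⁆∩⊆⊥ p∉A)))
      (≤-reflexive (rk-contract ρ P X)))

Cd≤-─ : ∀ {ρ : RankFunction n} → Separates ρ S A → Cd≤ ρ S k → Cd≤ ρ (S ─ A) k
Cd≤-─ {S = S} {A} {ρ = ρ} sep c = subst (λ T → Cd≤ ρ T _)
  (⊆-antisym (p∩q⊆q S (S ─ A)) (set 2 (λ S A → ⊢ S ∖ A ⋐ S ⊓ (S ∖ A)) (S ∷ A ∷ [])))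
  (Cd≤-∩ (Separates-∁ {S = S} {A} ρ sep) c)

-- Coloops, and the comparison of the two recursions

-- Every element of S is a loop or a coloop of the restriction to S.
Discrete : RankFunction n → Subset n → Set
Discrete ρ S = ∀ {x} → x ∈ S → Separates ρ S ⁅ x ⁆

discrete-⊆ : ∀ (ρ : RankFunction n) → Discrete ρ S → R ⊆ S → Discrete ρ R
discrete-⊆ ρ disc R⊆S x∈R = Separates-⊆ ρ (disc (R⊆S x∈R)) R⊆S

discrete⇒cd≤ : ∀ (ρ : RankFunction n) S → Discrete ρ S → Acc _<_ (∣ S ∣) → Cd≤ ρ S 1
discrete⇒cd≤ ρ S disc (acc rs) with nonempty? S
... | no  empty     = point λ x∈S → contradiction (_ , x∈S) empty
... | yes (x , x∈S) = sum ⁅ x ⁆ (disc x∈S)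
  (point λ p q → trans (x∈⁅y⁆⇒x≡y x (p∩q⊆q S _ p)) (sym (x∈⁅y⁆⇒x≡y x (p∩q⊆q S _ q))))
  (discrete⇒cd≤ ρ (S ─ ⁅ x ⁆) (discrete-⊆ ρ disc (p─q⊆p S ⁅ x ⁆)) (rs (x∈p⇒∣p-x∣<∣p∣ x∈S)))

cd*≤-∩⁅⁆ : ∀ (ρ : RankFunction n) S x {d} → Cd*≤ ρ (S ∩ ⁅ x ⁆) (suc d)
cd*≤-∩⁅⁆ ρ S x = Cd*≤-mono (≤-trans (rk-mono ρ (p∩q⊆q S ⁅ x ⁆)) (≤-trans (rk-⁅⁆ ρ x) (s≤s z≤n)))
  (cd*≤-rank ρ (S ∩ ⁅ x ⁆))

discrete⇒cd*≤ : ∀ (ρ : RankFunction n) S → Discrete ρ S → Acc _<_ (∣ S ∣) → Cd*≤ ρ S 1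
discrete⇒cd*≤ ρ S disc (acc rs) with nonempty? S
... | no  empty     = flat (rk-⊆⊥ ρ (Empty⇒⊆⊥ empty))
... | yes (x , x∈S) = split ⁅ x ⁆ (disc x∈S) (cd*≤-∩⁅⁆ ρ S x)
  (discrete⇒cd*≤ ρ (S ─ ⁅ x ⁆) (discrete-⊆ ρ disc (p─q⊆p S ⁅ x ⁆)) (rs (x∈p⇒∣p-x∣<∣p∣ x∈S)))

cd≤⇒discrete : ∀ (ρ : RankFunction n) {S} → Cd≤ ρ S 1 → Discrete ρ S
cd≤⇒discrete ρ {S} (point sub) {x} x∈S = ≤-trans
  (+-mono-≤ {v = 0} (rk-mono ρ (p∩q⊆p S ⁅ x ⁆))
    (≤-reflexive (rk-⊆⊥ ρ (Empty⇒⊆⊥ λ (y , y∈) →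
      x∈p─q⇒x∉q S ⁅ x ⁆ y∈ (subst (_∈ ⁅ x ⁆) (sub x∈S (p─q⊆p S ⁅ x ⁆ y∈)) (x∈⁅x⁆ x))))))
  (≤-reflexive (+-identityʳ _))
cd≤⇒discrete ρ {S} (sum A sep c d) {x} x∈S with x ∈? A
... | yes x∈A = lin 6 (λ a b s x u w → a ⊕ b ⩽ s ⇒ x ⊕ u ⩽ a ⇒ w ⩽ u ⊕ b ⇒ ⊢ x ⊕ w ⩽ s)
  (rk ρ (S ∩ A) ∷ rk ρ (S ─ A) ∷ rk ρ S ∷ rk ρ (S ∩ ⁅ x ⁆) ∷ rk ρ ((S ∩ A) ─ ⁅ x ⁆) ∷ rk ρ (S ─ ⁅ x ⁆) ∷ []) sep
  (≤-trans (+-monoˡ-≤ _ (rk-mono ρ (set 3 (λ S A X → X ⋐ A ⇒ ⊢ S ⊓ X ⋐ (S ⊓ A) ⊓ X) (S ∷ A ∷ ⁅ x ⁆ ∷ []) (∈⇒⁅⁆⊆ x∈A))))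
    (cd≤⇒discrete ρ c (x∈p∩q⁺ (x∈S , x∈A))))
  (subadditive ρ (set 3 (λ S A X → ⊢ S ∖ X ⋐ ((S ⊓ A) ∖ X) ⊔ (S ∖ A)) (S ∷ A ∷ ⁅ x ⁆ ∷ [])))
... | no x∉A = lin 6 (λ a b s x u w → a ⊕ b ⩽ s ⇒ x ⊕ u ⩽ b ⇒ w ⩽ a ⊕ u ⇒ ⊢ x ⊕ w ⩽ s)
  (rk ρ (S ∩ A) ∷ rk ρ (S ─ A) ∷ rk ρ S ∷ rk ρ (S ∩ ⁅ x ⁆) ∷ rk ρ ((S ─ A) ─ ⁅ x ⁆) ∷ rk ρ (S ─ ⁅ x ⁆) ∷ []) sep
  (≤-trans (+-monoˡ-≤ _ (rk-mono ρ (set 3 (λ S A X → X ⊓ A ⋐ ∅ ⇒ ⊢ S ⊓ X ⋐ (S ∖ A) ⊓ X) (S ∷ A ∷ ⁅ x ⁆ ∷ []) (∉⇒⁅⁆∩⊆⊥ x∉A))))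
    (cd≤⇒discrete ρ d (x∈p∧x∉q⇒x∈p─q x∈S x∉A)))
  (subadditive ρ (set 3 (λ S A X → ⊢ S ∖ X ⋐ S ⊓ A ⊔ ((S ∖ A) ∖ X)) (S ∷ A ∷ ⁅ x ⁆ ∷ [])))
cd≤⇒discrete ρ (contraction _ c) = contradiction (Cd≤-positive c) λ ()

ColoopFree : RankFunction n → Subset n → Set
ColoopFree ρ S = ∀ {x} → x ∈ S → rk ρ S ≤ rk ρ (S ─ ⁅ x ⁆)

-- Contractions create no coloops, so that in the coloop-free case the recursion
-- bottoms out at loops, for which no edge is needed.
coloopFree⇒cd*≤ : ∀ {ρ : RankFunction n} {S d} → Cd≤ ρ S (suc d) → ColoopFree ρ S →
                  ∀ {R} → R ⊆ S → Cd*≤ ρ R d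
coloopFree⇒cd*≤ {ρ = ρ} {S} (point sub) free R⊆S = flat (ℕ.n≤0⇒n≡0 (≤-trans (rk-mono ρ R⊆S) (S-flat (nonempty? S))))
  where
  S-flat : Dec (Nonempty S) → rk ρ S ≤ 0
  S-flat (no empty)      = ≤-reflexive (rk-⊆⊥ ρ (Empty⇒⊆⊥ empty))
  S-flat (yes (x , x∈S)) = ≤-trans (free x∈S) (≤-reflexive (rk-⊆⊥ ρ (Empty⇒⊆⊥ λ (y , y∈) →
    x∈p─q⇒x∉q S ⁅ x ⁆ y∈ (subst (_∈ ⁅ x ⁆) (sub x∈S (p─q⊆p S ⁅ x ⁆ y∈)) (x∈⁅x⁆ x)))))
coloopFree⇒cd*≤ {ρ = ρ} {S} (sum A sep c d) free {R} R⊆S = split A (Separates-⊆ ρ sep R⊆S)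
  (coloopFree⇒cd*≤ c
    (λ {x} x∈ → lin 5 (λ a b s w u → a ⊕ b ⩽ s ⇒ s ⩽ w ⇒ w ⩽ u ⊕ b ⇒ ⊢ a ⩽ u)
      (rk ρ (S ∩ A) ∷ rk ρ (S ─ A) ∷ rk ρ S ∷ rk ρ (S ─ ⁅ x ⁆) ∷ rk ρ ((S ∩ A) ─ ⁅ x ⁆) ∷ []) sep
      (free (p∩q⊆p S A x∈))
      (subadditive ρ (set 3 (λ S A X → ⊢ S ∖ X ⋐ ((S ⊓ A) ∖ X) ⊔ (S ∖ A)) (S ∷ A ∷ ⁅ x ⁆ ∷ []))))
    (set 3 (λ S A R → R ⋐ S ⇒ ⊢ R ⊓ A ⋐ S ⊓ A) (S ∷ A ∷ R ∷ []) R⊆S))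
  (coloopFree⇒cd*≤ d
    (λ {x} x∈ → lin 5 (λ a b s w u → a ⊕ b ⩽ s ⇒ s ⩽ w ⇒ w ⩽ a ⊕ u ⇒ ⊢ b ⩽ u)
      (rk ρ (S ∩ A) ∷ rk ρ (S ─ A) ∷ rk ρ S ∷ rk ρ (S ─ ⁅ x ⁆) ∷ rk ρ ((S ─ A) ─ ⁅ x ⁆) ∷ []) sep
      (free (p─q⊆p S A x∈))
      (subadditive ρ (set 3 (λ S A X → ⊢ S ∖ X ⋐ S ⊓ A ⊔ ((S ∖ A) ∖ X)) (S ∷ A ∷ ⁅ x ⁆ ∷ []))))
    (set 3 (λ S A R → R ⋐ S ⇒ ⊢ R ∖ A ⋐ S ∖ A) (S ∷ A ∷ R ∷ []) R⊆S))
coloopFree⇒cd*≤ {d = zero} (contraction _ c) free R⊆S = contradiction (Cd≤-positive c) λ ()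
coloopFree⇒cd*≤ {ρ = ρ} {S} {d = suc d} (contraction {p = p} p∈S c) free {R} R⊆S =
  quotient σ
    (λ {X} {Y} X⊆Y _ → lin 7 (λ q yp xp x y cx cy → yp ⊕ x ⩽ xp ⊕ y ⇒ q ⊕ cy ⩽ yp ⇒ xp ⩽ q ⊕ cx ⇒ ⊢ cy ⊕ x ⩽ cx ⊕ y)
      (rk ρ P ∷ rk ρ (Y ∪ P) ∷ rk ρ (X ∪ P) ∷ rk ρ X ∷ rk ρ Y ∷ rk σ X ∷ rk σ Y ∷ [])
      (submodular ρ {C = Y ∪ P} {X ∪ P} {Y} {X}
        (set 3 (λ X Y P → ⊢ Y ⊔ P ⋐ (X ⊔ P) ⊔ Y) (X ∷ Y ∷ P ∷ []))
        (set 3 (λ X Y P → X ⋐ Y ⇒ ⊢ X ⋐ (X ⊔ P) ⊓ Y) (X ∷ Y ∷ P ∷ []) X⊆Y))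
      (≤-reflexive (sym (rk-contract ρ P Y))) (≤-reflexive (rk-contract ρ P X)))
    (lin 4 (λ r rp q c → r ⩽ rp ⇒ rp ⩽ q ⊕ c ⇒ q ⩽ lit 1 ⇒ ⊢ r ⩽ lit 1 ⊕ c)
      (rk ρ R ∷ rk ρ (R ∪ P) ∷ rk ρ P ∷ rk σ R ∷ []) (rk-mono ρ (p⊆p∪q P))
      (≤-reflexive (rk-contract ρ P R)) (rk-⁅⁆ ρ p))
    -- R may contain p, which has become a loop of σ and is split off at no cost.
    (split P
      (subst (λ r → r + rk σ (R ─ P) ≤ rk σ R) (sym p-loop) (rk-mono σ (p─q⊆p R P)))
      (flat p-loop)
      (coloopFree⇒cd*≤ c
        (λ {x} x∈ → ℕ.∸-monoˡ-≤ (rk ρ P) (≤-trans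
          (rk-mono ρ (set 2 (λ S P → P ⋐ S ⇒ ⊢ (S ∖ P) ⊔ P ⋐ S) (S ∷ P ∷ []) (∈⇒⁅⁆⊆ p∈S)))
          (≤-trans (free (p─q⊆p S P x∈))
            (rk-mono ρ (set 3 (λ S P X → ⊢ S ∖ X ⋐ ((S ∖ P) ∖ X) ⊔ P) (S ∷ P ∷ ⁅ x ⁆ ∷ []))))))
        (set 3 (λ S P R → R ⋐ S ⇒ ⊢ R ∖ P ⋐ S ∖ P) (S ∷ P ∷ R ∷ []) R⊆S)))
  where
  P = ⁅ p ⁆
  σ = contract P ρ
  p-loop : rk σ (R ∩ P) ≡ 0
  p-loop = ℕ.m≤n⇒m∸n≡0 (rk-mono ρ (set 2 (λ R P → ⊢ R ⊓ P ⊔ P ⋐ P) (R ∷ P ∷ [])))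

-- A coloop is a direct summand of rank at most one, for which depth 1 suffices; this is why the
-- bound is a successor. Once all coloops of S are split off, `coloopFree⇒cd*≤` applies to the
-- remaining summand.
cd≤⇒cd*≤ : ∀ {ρ : RankFunction n} {S d} → Acc _<_ (∣ S ∣) → Cd≤ ρ S (suc (suc d)) →
           ∀ {R} → R ⊆ S → Cd*≤ ρ R (suc d)
cd≤⇒cd*≤ {ρ = ρ} {S} (acc rs) c {R} R⊆S
  with Fin.any? (λ x → (x ∈? S) ×-dec (rk ρ (S ─ ⁅ x ⁆) ℕ.<? rk ρ S))
... | no ¬coloop = coloopFree⇒cd*≤ c (λ x∈S → ≮⇒≥ λ lt → ¬coloop (_ , x∈S , lt)) R⊆S
... | yes (x , x∈S , coloop) = split ⁅ x ⁆ (Separates-⊆ ρ sep R⊆S) (cd*≤-∩⁅⁆ ρ R x)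
  (cd≤⇒cd*≤ (rs (x∈p⇒∣p-x∣<∣p∣ x∈S)) (Cd≤-─ sep c)
    (set 3 (λ S X R → R ⋐ S ⇒ ⊢ R ∖ X ⋐ S ∖ X) (S ∷ ⁅ x ⁆ ∷ R ∷ []) R⊆S))
  where
  sep : Separates ρ S ⁅ x ⁆
  sep = ≤-trans (+-monoˡ-≤ _ (≤-trans (rk-mono ρ (p∩q⊆q S ⁅ x ⁆)) (rk-⁅⁆ ρ x))) coloop

-- Transport of contraction-depth along injections

module _ (φ : Fin n → Fin m) where

  preimage-∩ : ∀ X Y → preimage φ (X ∩ Y) ≡ preimage φ X ∩ preimage φ Y
  preimage-∩ X Y = ⊆-antisym
    (λ p → let p₁ , p₂ = x∈p∩q⁻ X Y (∈-preimage⁻ φ p) in x∈p∩q⁺ (∈-preimage⁺ φ p₁ , ∈-preimage⁺ φ p₂))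
    (λ p → let p₁ , p₂ = x∈p∩q⁻ _ _ p in ∈-preimage⁺ φ {X ∩ Y} (x∈p∩q⁺ (∈-preimage⁻ φ p₁ , ∈-preimage⁻ φ p₂)))

  preimage-∪ : ∀ X Y → preimage φ (X ∪ Y) ≡ preimage φ X ∪ preimage φ Y
  preimage-∪ X Y = ⊆-antisym
    (λ p → x∈p∪q⁺ ([ inj₁ ∘ ∈-preimage⁺ φ , inj₂ ∘ ∈-preimage⁺ φ ]′ (x∈p∪q⁻ X Y (∈-preimage⁻ φ p))))
    (λ p → ∈-preimage⁺ φ {X ∪ Y} (x∈p∪q⁺ ([ inj₁ ∘ ∈-preimage⁻ φ , inj₂ ∘ ∈-preimage⁻ φ ]′ (x∈p∪q⁻ _ _ p))))

  preimage-─ : ∀ X Y → preimage φ (X ─ Y) ≡ preimage φ X ─ preimage φ Y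
  preimage-─ X Y = ⊆-antisym
    (λ p → let q = ∈-preimage⁻ φ p in
      x∈p∧x∉q⇒x∈p─q (∈-preimage⁺ φ (p─q⊆p X Y q)) (x∈p─q⇒x∉q X Y q ∘ ∈-preimage⁻ φ))
    (λ p → ∈-preimage⁺ φ {X ─ Y} (x∈p∧x∉q⇒x∈p─q (∈-preimage⁻ φ (p─q⊆p _ _ p))
      (x∈p─q⇒x∉q (preimage φ X) (preimage φ Y) p ∘ ∈-preimage⁺ φ)))

  -- In the applications ρ belongs to `M ∣ S` or `M / e` with its renumbered elements, and σ to the
  -- original ground set, on which restriction and contraction rename nothing.
  Represents : RankFunction n → RankFunction m → Subset m → Set
  Represents ρ σ S = ∀ {Z} → Z ⊆ S → rk σ Z ≡ rk ρ (preimage φ Z)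

  InImage : Subset m → Set
  InImage S = ∀ {j} → j ∈ S → ∃[ i ] φ i ≡ j

  separates-preimage : ∀ {ρ σ} → Represents ρ σ S → Separates σ S A →
                       Separates ρ (preimage φ S) (preimage φ A)
  separates-preimage {S = S} {A} {ρ} rep sep = subst₂ _≤_
    (cong₂ _+_ (trans (rep (p∩q⊆p S A)) (cong (rk ρ) (preimage-∩ S A)))
               (trans (rep (p─q⊆p S A)) (cong (rk ρ) (preimage-─ S A)))) (rep id) sep

  module _ (inj : Injective _≡_ _≡_ φ) where

    preimage-image : ∀ X → preimage φ (imageˢ φ X) ≡ X
    preimage-image X = ⊆-antisym (∈-image⁻′ φ inj ∘ ∈-preimage⁻ φ) (∈-preimage⁺ φ ∘ ∈-image⁺ φ)

    preimage-⁅⁆ : ∀ i → preimage φ ⁅ φ i ⁆ ≡ ⁅ i ⁆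
    preimage-⁅⁆ i = ⊆-antisym
      (λ p → subst (_∈ ⁅ i ⁆) (sym (inj (x∈⁅y⁆⇒x≡y (φ i) (∈-preimage⁻ φ p)))) (x∈⁅x⁆ i))
      (λ p → ∈-preimage⁺ φ (subst (λ j → φ j ∈ ⁅ φ i ⁆) (sym (x∈⁅y⁆⇒x≡y i p)) (x∈⁅x⁆ (φ i))))

    represents-contract : ∀ {ρ σ i} → φ i ∈ S → Represents ρ σ S →
                          Represents (contract ⁅ i ⁆ ρ) (contract ⁅ φ i ⁆ σ) (S ─ ⁅ φ i ⁆)
    represents-contract {S = S} {ρ} {σ} {i} i∈S rep {Z} Z⊆ = cong₂ _∸_
      (trans (rep (set 3 (λ Z S P → Z ⋐ S ∖ P ⇒ P ⋐ S ⇒ ⊢ Z ⊔ P ⋐ S) (Z ∷ S ∷ ⁅ φ i ⁆ ∷ []) Z⊆ (∈⇒⁅⁆⊆ i∈S)))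
        (cong (rk ρ) (trans (preimage-∪ Z ⁅ φ i ⁆) (cong (preimage φ Z ∪_) (preimage-⁅⁆ i)))))
      (trans (rep (∈⇒⁅⁆⊆ i∈S)) (cong (rk ρ) (preimage-⁅⁆ i)))

    separates-image : ∀ {ρ σ} → Represents ρ σ S → Separates ρ (preimage φ S) A →
                      Separates σ S (imageˢ φ A)
    separates-image {S = S} {A} {ρ} rep sep = subst₂ _≤_ (sym (cong₂ _+_
      (trans (rep (p∩q⊆p S _)) (cong (rk ρ) (trans (preimage-∩ S _) (cong (preimage φ S ∩_) (preimage-image A)))))
      (trans (rep (p─q⊆p S _)) (cong (rk ρ) (trans (preimage-─ S _) (cong (preimage φ S ─_) (preimage-image A)))))))
      (sym (rep id)) sep

    -- The equation for T takes the place of a `subst` on the derivation: recursive calls receive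
    -- the subderivations as they are, so that termination is evident.
    cd≤-image : ∀ {ρ σ T} → T ≡ preimage φ S → InImage S → Represents ρ σ S → Cd≤ ρ T k → Cd≤ σ S k
    cd≤-image refl im rep (point sub) = point λ p q →
      let i , ei = im p
          j , ej = im q
      in trans (sym ei) (trans (cong φ (sub (∈-preimage⁺ φ (subst (_∈ _) (sym ei) p))
        (∈-preimage⁺ φ (subst (_∈ _) (sym ej) q)))) ej)
    cd≤-image {S = S} {ρ = ρ} {σ} refl im rep (sum A sep c d) = sum (imageˢ φ A)
      (separates-image {ρ = ρ} {σ} rep sep)
      (cd≤-image (sym (trans (preimage-∩ S _) (cong (preimage φ S ∩_) (preimage-image A))))
        (im ∘ p∩q⊆p S _) (λ {Z} Z⊆ → rep (⊆-trans {_} {Z} Z⊆ (p∩q⊆p S _))) c)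
      (cd≤-image (sym (trans (preimage-─ S _) (cong (preimage φ S ─_) (preimage-image A))))
        (im ∘ p─q⊆p S _) (λ {Z} Z⊆ → rep (⊆-trans {_} {Z} Z⊆ (p─q⊆p S _))) d)
    cd≤-image {S = S} {ρ = ρ} {σ} refl im rep (contraction {p = p} p∈ c) = contraction (∈-preimage⁻ φ p∈)
      (cd≤-image (sym (trans (preimage-─ S _) (cong (preimage φ S ─_) (preimage-⁅⁆ p))))
        (im ∘ p─q⊆p S _) (represents-contract {ρ = ρ} {σ} (∈-preimage⁻ φ p∈) rep) c)

    cd≤-preimage : ∀ {ρ σ} → InImage S → Represents ρ σ S → Cd≤ σ S k → Cd≤ ρ (preimage φ S) k
    cd≤-preimage im rep (point sub) = point λ p q → inj (sub (∈-preimage⁻ φ p) (∈-preimage⁻ φ q))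
    cd≤-preimage {S = S} {ρ = ρ} {σ} im rep (sum A sep c d) = sum (preimage φ A)
      (separates-preimage {ρ = ρ} {σ} rep sep)
      (subst (λ T → Cd≤ ρ T _) (preimage-∩ S A)
        (cd≤-preimage (im ∘ p∩q⊆p S _) (λ {Z} Z⊆ → rep (⊆-trans {_} {Z} Z⊆ (p∩q⊆p S _))) c))
      (subst (λ T → Cd≤ ρ T _) (preimage-─ S A)
        (cd≤-preimage (im ∘ p─q⊆p S _) (λ {Z} Z⊆ → rep (⊆-trans {_} {Z} Z⊆ (p─q⊆p S _))) d))
    cd≤-preimage {S = S} {ρ = ρ} {σ} im rep (contraction {p = p} p∈ c) with im p∈
    ... | i , refl = contraction (∈-preimage⁺ φ p∈)
      (subst (λ T → Cd≤ (contract ⁅ i ⁆ ρ) T _)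
        (trans (preimage-─ S _) (cong (preimage φ S ─_) (preimage-⁅⁆ i)))
        (cd≤-preimage (im ∘ p─q⊆p S _) (represents-contract {ρ = ρ} {σ} p∈ rep) c))

-- Connectedness: separations and circuits

-- Connectedness of the restriction to S, in terms of the rank.
Inseparable : RankFunction n → Subset n → Set
Inseparable ρ S = ∀ A → Separates ρ S A → Empty (S ∩ A) ⊎ Empty (S ─ A)

Splitting : RankFunction n → Subset n → Subset n → Set
Splitting ρ S A = Separates ρ S A × Nonempty (S ∩ A) × Nonempty (S ─ A)

inseparable? : ∀ (ρ : RankFunction n) S → Inseparable ρ S ⊎ ∃ (Splitting ρ S)
inseparable? ρ S with anySubset? (λ A → (rk ρ (S ∩ A) + rk ρ (S ─ A) ℕ.≤? rk ρ S)
    ×-dec nonempty? (S ∩ A) ×-dec nonempty? (S ─ A))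
... | yes splitting = inj₂ splitting
... | no ¬splitting = inj₁ λ A sep → [ inj₁ , (λ ne → inj₂ λ ne′ → ¬splitting (A , sep , ne , ne′)) ]′
  (emptyOr (nonempty? (S ∩ A)))
  where
  emptyOr : ∀ {X} → Dec (Nonempty X) → Empty X ⊎ Nonempty X
  emptyOr (yes ne) = inj₂ ne
  emptyOr (no e)   = inj₁ e

Free : RankFunction n → Subset n → Set
Free ρ X = ∣ X ∣ ≤ rk ρ X

free-⊆ : ∀ (ρ : RankFunction n) → X ⊆ Y → Free ρ Y → Free ρ X
free-⊆ {X = X} {Y} ρ X⊆Y free = lin 6 (λ x y z r s t → y ⩽ s ⇒ s ⩽ r ⊕ t ⇒ t ⩽ z ⇒ x ⊕ z ⩽ y ⇒ ⊢ x ⩽ r)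
  (∣ X ∣ ∷ ∣ Y ∣ ∷ ∣ Y ─ X ∣ ∷ rk ρ X ∷ rk ρ Y ∷ rk ρ (Y ─ X) ∷ []) free
  (subadditive ρ (set 2 (λ X Y → ⊢ Y ⋐ X ⊔ (Y ∖ X)) (X ∷ Y ∷ [])))
  (rk≤∣∣ ρ (Y ─ X))
  (∣∣-disjoint (set 2 (λ X Y → X ⋐ Y ⇒ ⊢ X ⊔ (Y ∖ X) ⋐ Y) (X ∷ Y ∷ []) X⊆Y)
    (set 2 (λ X Y → ⊢ X ⊓ (Y ∖ X) ⋐ ∅) (X ∷ Y ∷ [])))

IsCircuit : RankFunction n → Subset n → Set
IsCircuit ρ C = rk ρ C < ∣ C ∣ × (∀ {c} → c ∈ C → Free ρ (C ─ ⁅ c ⁆))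

-- Tutte: an element of an inseparable set can be deleted or contracted without
-- separating it.
module _ (ρ : RankFunction n) {S e} (e∈S : e ∈ S) (insep : Inseparable ρ S) where

  private
    E S′ : Subset n
    E  = ⁅ e ⁆
    S′ = S ─ E

  module _ (A B : Subset n)
           (sepA : rk ρ (S′ ∩ A) + rk ρ (S′ ─ A) ≤ rk ρ S)
           (sepB : rk ρ (S′ ∩ B ∪ E) + rk ρ ((S′ ─ B) ∪ E) ≤ suc (rk ρ S)) where

    separated : ∀ Z → Z ⊆ S′ → Nonempty Z → suc (rk ρ S) ≤ rk ρ Z + rk ρ (S ─ Z)
    separated Z Z⊆S′ (z , z∈Z) = ≰⇒> λ sep → [ (λ empty → empty (z , x∈p∩q⁺ (p─q⊆p S E (Z⊆S′ z∈Z) , z∈Z)))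
      , (λ empty → empty (e , x∈p∧x∉q⇒x∈p─q e∈S λ e∈Z → x∈p─q⇒x∉q S E (Z⊆S′ e∈Z) (x∈⁅x⁆ e))) ]′
      (insep Z (≤-trans (+-monoˡ-≤ _ (rk-mono ρ (p∩q⊆q S Z))) sep))

    -- A and B cut S′ into four quadrants. Submodularity bounds the total connectivity of two
    -- opposite quadrants by that of the two given separations, whose excess is at most one; two
    -- non-empty quadrants would each contribute an excess of one, as S is inseparable.
    uncross : Empty ((S′ ∩ A) ∩ B) ⊎ Empty ((S′ ─ A) ─ B)
    uncross with nonempty? ((S′ ∩ A) ∩ B) | nonempty? ((S′ ─ A) ─ B)
    ... | no empty | _        = inj₁ empty
    ... | yes _    | no empty = inj₂ empty
    ... | yes ne   | yes ne′  = contradiction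
      (lin 9 (λ a a′ b b′ s z cz z′ cz′ →
          a ⊕ a′ ⩽ s ⇒ b ⊕ b′ ⩽ lit 1 ⊕ s ⇒ cz′ ⊕ z ⩽ a ⊕ b ⇒ cz ⊕ z′ ⩽ a′ ⊕ b′ ⇒
          lit 1 ⊕ s ⩽ z ⊕ cz ⇒ lit 1 ⊕ s ⩽ z′ ⊕ cz′ ⇒ ⊢ lit 1 ⩽ lit 0)
        (rk ρ (S′ ∩ A) ∷ rk ρ (S′ ─ A) ∷ rk ρ (S′ ∩ B ∪ E) ∷ rk ρ ((S′ ─ B) ∪ E) ∷ rk ρ S ∷
         rk ρ Z₁ ∷ rk ρ (S ─ Z₁) ∷ rk ρ Z₂ ∷ rk ρ (S ─ Z₂) ∷ []) sepA sepB
        (submodular ρ {C = S ─ Z₂} {S′ ∩ A} {S′ ∩ B ∪ E} {Z₁}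
          (set 4 (λ S E A B → ⊢ S ∖ (((S ∖ E) ∖ A) ∖ B) ⋐ (S ∖ E) ⊓ A ⊔ ((S ∖ E) ⊓ B ⊔ E)) (S ∷ E ∷ A ∷ B ∷ []))
          (set 4 (λ S E A B → ⊢ ((S ∖ E) ⊓ A) ⊓ B ⋐ ((S ∖ E) ⊓ A) ⊓ ((S ∖ E) ⊓ B ⊔ E)) (S ∷ E ∷ A ∷ B ∷ [])))
        (submodular ρ {C = S ─ Z₁} {S′ ─ A} {(S′ ─ B) ∪ E} {Z₂}
          (set 4 (λ S E A B → ⊢ S ∖ (((S ∖ E) ⊓ A) ⊓ B) ⋐ ((S ∖ E) ∖ A) ⊔ (((S ∖ E) ∖ B) ⊔ E)) (S ∷ E ∷ A ∷ B ∷ []))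
          (set 4 (λ S E A B → ⊢ ((S ∖ E) ∖ A) ∖ B ⋐ ((S ∖ E) ∖ A) ⊓ (((S ∖ E) ∖ B) ⊔ E)) (S ∷ E ∷ A ∷ B ∷ [])))
        (separated Z₁ (set 3 (λ T A B → ⊢ (T ⊓ A) ⊓ B ⋐ T) (S′ ∷ A ∷ B ∷ [])) ne)
        (separated Z₂ (set 3 (λ T A B → ⊢ (T ∖ A) ∖ B ⋐ T) (S′ ∷ A ∷ B ∷ [])) ne′)) λ ()
      where
      Z₁ = (S′ ∩ A) ∩ B
      Z₂ = (S′ ─ A) ─ B

  -- Uncrossing with B and with its complement empties one quadrant of each opposite pair. Two such
  -- quadrants together form a whole side of A or of B, which was supposed to be non-empty.
  deletion-or-contraction : ∃ (Splitting ρ S′) → ¬ ∃ (Splitting (contract E ρ) S′)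
  deletion-or-contraction (A , sepA , (a , a∈) , (a′ , a′∈)) (B , sepB , (b , b∈) , (b′ , b′∈)) =
    [ (λ 11∅ → [ (λ 12∅ → clash (set 3 (λ T A B → (T ⊓ A) ⊓ B ⋐ ∅ ⇒ (T ⊓ A) ⊓ (T ∖ B) ⋐ ∅ ⇒ ⊢ T ⊓ A ⋐ ∅)
                            (S′ ∷ A ∷ B ∷ []) (Empty⇒⊆⊥ 11∅) (Empty⇒⊆⊥ 12∅) a∈))
              , (λ 21∅ → clash (set 3 (λ T A B → (T ⊓ A) ⊓ B ⋐ ∅ ⇒ (T ∖ A) ∖ (T ∖ B) ⋐ ∅ ⇒ ⊢ T ⊓ B ⋐ ∅)
                            (S′ ∷ A ∷ B ∷ []) (Empty⇒⊆⊥ 11∅) (Empty⇒⊆⊥ 21∅) b∈)) ]′ second)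
    , (λ 22∅ → [ (λ 12∅ → clash (set 3 (λ T A B → (T ∖ A) ∖ B ⋐ ∅ ⇒ (T ⊓ A) ⊓ (T ∖ B) ⋐ ∅ ⇒ ⊢ T ∖ B ⋐ ∅)
                            (S′ ∷ A ∷ B ∷ []) (Empty⇒⊆⊥ 22∅) (Empty⇒⊆⊥ 12∅) b′∈))
              , (λ 21∅ → clash (set 3 (λ T A B → (T ∖ A) ∖ B ⋐ ∅ ⇒ (T ∖ A) ∖ (T ∖ B) ⋐ ∅ ⇒ ⊢ T ∖ A ⋐ ∅)
                            (S′ ∷ A ∷ B ∷ []) (Empty⇒⊆⊥ 22∅) (Empty⇒⊆⊥ 21∅) a′∈)) ]′ second) ]′
    (uncross A B sepA′ sepB′)
    where
    clash : ∀ {x} → x ∈ ⊥ → ∀ {P : Set} → P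
    clash x∈⊥ = contradiction x∈⊥ ∉⊥

    sepA′ : rk ρ (S′ ∩ A) + rk ρ (S′ ─ A) ≤ rk ρ S
    sepA′ = ≤-trans sepA (rk-mono ρ (p─q⊆p S E))

    sepB′ : rk ρ (S′ ∩ B ∪ E) + rk ρ ((S′ ─ B) ∪ E) ≤ suc (rk ρ S)
    sepB′ = lin 8 (λ e c₁ c₂ c p q s t → c₁ ⊕ c₂ ⩽ c ⇒ p ⩽ e ⊕ c₁ ⇒ q ⩽ e ⊕ c₂ ⇒ e ⊕ c ⩽ t ⇒ t ⩽ s ⇒ e ⩽ lit 1 ⇒
        ⊢ p ⊕ q ⩽ lit 1 ⊕ s)
      (rk ρ E ∷ rk σ (S′ ∩ B) ∷ rk σ (S′ ─ B) ∷ rk σ S′ ∷ rk ρ (S′ ∩ B ∪ E) ∷ rk ρ ((S′ ─ B) ∪ E) ∷ rk ρ S ∷ rk ρ (S′ ∪ E) ∷ [])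
      sepB (≤-reflexive (rk-contract ρ E (S′ ∩ B))) (≤-reflexive (rk-contract ρ E (S′ ─ B)))
      (≤-reflexive (sym (rk-contract ρ E S′)))
      (rk-mono ρ (set 2 (λ S E → E ⋐ S ⇒ ⊢ (S ∖ E) ⊔ E ⋐ S) (S ∷ E ∷ []) (∈⇒⁅⁆⊆ e∈S))) (rk-⁅⁆ ρ e)
      where σ = contract E ρ

    second : Empty ((S′ ∩ A) ∩ (S′ ─ B)) ⊎ Empty ((S′ ─ A) ─ (S′ ─ B))
    second = uncross A (S′ ─ B) sepA′ (≤-trans (≤-reflexive (+-comm (rk ρ (S′ ∩ (S′ ─ B) ∪ E)) _))
      (≤-trans (+-mono-≤
        (rk-mono ρ (set 3 (λ T B E → ⊢ (T ∖ (T ∖ B)) ⊔ E ⋐ T ⊓ B ⊔ E) (S′ ∷ B ∷ E ∷ [])))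
        (rk-mono ρ (set 3 (λ T B E → ⊢ T ⊓ (T ∖ B) ⊔ E ⋐ (T ∖ B) ⊔ E) (S′ ∷ B ∷ E ∷ [])))) sepB′))

-- By Tutte's argument an element other than x and y can be removed, and a circuit
-- of a contraction lifts.
inseparable⇒circuit : ∀ (ρ : RankFunction n) {S x y} → Acc _<_ (∣ S ∣) → Inseparable ρ S → x ≢ y →
                      x ∈ S → y ∈ S → ∃[ C ] C ⊆ S × IsCircuit ρ C × x ∈ C × y ∈ C
inseparable⇒circuit ρ {S} {x} {y} (acc rs) insep x≢y x∈S y∈S
  with Fin.any? (λ e → (e ∈? S) ×-dec ¬? (e Fin.≟ x) ×-dec ¬? (e Fin.≟ y))
-- S consists of x and y alone and is the circuit itself: inseparability makes its rank smaller than
-- the sum of the ranks of x and y.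
... | no none = S , id , (dependent , free) , x∈S , y∈S
  where
  ⁅x⁆ = ⁅ x ⁆
  ⁅y⁆ = ⁅ y ⁆
  S⊆ : S ⊆ ⁅x⁆ ∪ ⁅y⁆
  S⊆ {z} z∈S with z Fin.≟ x | z Fin.≟ y
  ... | yes refl | _        = x∈p∪q⁺ (inj₁ (x∈⁅x⁆ x))
  ... | no _     | yes refl = x∈p∪q⁺ (inj₂ (x∈⁅x⁆ y))
  ... | no z≢x   | no z≢y   = contradiction (z , z∈S , z≢x , z≢y) none
  disjoint : ⁅x⁆ ∩ ⁅y⁆ ⊆ ⊥
  disjoint p = contradiction (trans (sym (x∈⁅y⁆⇒x≡y x (p∩q⊆p ⁅x⁆ ⁅y⁆ p))) (x∈⁅y⁆⇒x≡y y (p∩q⊆q ⁅x⁆ ⁅y⁆ p))) x≢y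
  rk-S : suc (rk ρ S) ≤ rk ρ ⁅x⁆ + rk ρ ⁅y⁆
  rk-S = ≰⇒> λ le → [ (λ e → e (x , x∈p∩q⁺ (x∈S , x∈⁅x⁆ x))) , (λ e → e (y , x∈p∧x∉q⇒x∈p─q y∈S (x≢y ∘ sym ∘ x∈⁅y⁆⇒x≡y x))) ]′
    (insep ⁅x⁆ (≤-trans (+-mono-≤ (rk-mono ρ (p∩q⊆q S ⁅x⁆))
      (rk-mono ρ (set 3 (λ S X Y → S ⋐ X ⊔ Y ⇒ ⊢ S ∖ X ⋐ Y) (S ∷ ⁅x⁆ ∷ ⁅y⁆ ∷ []) S⊆))) le))
  dependent : rk ρ S < ∣ S ∣
  dependent = ≤-trans rk-S (≤-trans (+-mono-≤ (≤-trans (rk-⁅⁆ ρ x) (≤-reflexive (sym (∣⁅x⁆∣≡1 x))))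
    (≤-trans (rk-⁅⁆ ρ y) (≤-reflexive (sym (∣⁅x⁆∣≡1 y)))))
    (∣∣-disjoint (set 3 (λ S X Y → X ⋐ S ⇒ Y ⋐ S ⇒ ⊢ X ⊔ Y ⋐ S) (S ∷ ⁅x⁆ ∷ ⁅y⁆ ∷ []) (∈⇒⁅⁆⊆ x∈S) (∈⇒⁅⁆⊆ y∈S)) disjoint))
  free-⁅⁆ : ∀ {z} → 1 ≤ rk ρ ⁅ z ⁆ → Free ρ ⁅ z ⁆
  free-⁅⁆ {z} le = ≤-trans (≤-reflexive (∣⁅x⁆∣≡1 z)) le
  free : ∀ {c} → c ∈ S → Free ρ (S ─ ⁅ c ⁆)
  free {c} c∈S with x∈p∪q⁻ ⁅x⁆ ⁅y⁆ (S⊆ c∈S)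
  ... | inj₁ c∈⁅x⁆ rewrite x∈⁅y⁆⇒x≡y x c∈⁅x⁆ = free-⊆ ρ
    (set 3 (λ S X Y → S ⋐ X ⊔ Y ⇒ ⊢ S ∖ X ⋐ Y) (S ∷ ⁅x⁆ ∷ ⁅y⁆ ∷ []) S⊆)
    (free-⁅⁆ (lin 3 (λ s p q → lit 1 ⊕ s ⩽ p ⊕ q ⇒ p ⩽ s ⇒ ⊢ lit 1 ⩽ q) (rk ρ S ∷ rk ρ ⁅x⁆ ∷ rk ρ ⁅y⁆ ∷ [])
      rk-S (rk-mono ρ (∈⇒⁅⁆⊆ x∈S))))
  ... | inj₂ c∈⁅y⁆ rewrite x∈⁅y⁆⇒x≡y y c∈⁅y⁆ = free-⊆ ρ
    (set 3 (λ S X Y → S ⋐ X ⊔ Y ⇒ ⊢ S ∖ Y ⋐ X) (S ∷ ⁅x⁆ ∷ ⁅y⁆ ∷ []) S⊆)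
    (free-⁅⁆ (lin 3 (λ s p q → lit 1 ⊕ s ⩽ p ⊕ q ⇒ q ⩽ s ⇒ ⊢ lit 1 ⩽ p) (rk ρ S ∷ rk ρ ⁅x⁆ ∷ rk ρ ⁅y⁆ ∷ [])
      rk-S (rk-mono ρ (∈⇒⁅⁆⊆ y∈S))))
... | yes (e , e∈S , e≢x , e≢y) = by-deletion (inseparable? ρ S′)
  where
  E S′ : Subset _
  E  = ⁅ e ⁆
  S′ = S ─ E
  σ = contract E ρ
  x∈S′ : x ∈ S′
  x∈S′ = x∈p∧x≢y⇒x∈p-y x∈S (e≢x ∘ sym)
  y∈S′ : y ∈ S′
  y∈S′ = x∈p∧x≢y⇒x∈p-y y∈S (e≢y ∘ sym)
  rk-S : suc (rk ρ S) ≤ rk ρ E + rk ρ S′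
  rk-S = ≰⇒> λ le → [ (λ em → em (e , x∈p∩q⁺ (e∈S , x∈⁅x⁆ e))) , (λ em → em (x , x∈S′)) ]′
    (insep E (≤-trans (+-monoˡ-≤ _ (rk-mono ρ (p∩q⊆q S E))) le))
  rk-e : 1 ≤ rk ρ E
  rk-e = lin 3 (λ s p q → lit 1 ⊕ s ⩽ p ⊕ q ⇒ q ⩽ s ⇒ ⊢ lit 1 ⩽ p) (rk ρ S ∷ rk ρ E ∷ rk ρ S′ ∷ [])
    rk-S (rk-mono ρ (p─q⊆p S E))
  smaller : ∣ S′ ∣ < ∣ S ∣
  smaller = x∈p⇒∣p-x∣<∣p∣ e∈S

  -- If C is dependent in ρ, it is a circuit there as well. Otherwise its dependence is due to e,
  -- and C together with e is a circuit. In both cases e is not a loop, by `rk-e`.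
  lift : ∀ {C} → C ⊆ S′ → IsCircuit σ C → x ∈ C → y ∈ C → ∃[ C ] C ⊆ S × IsCircuit ρ C × x ∈ C × y ∈ C
  lift {C} C⊆S′ (dep , free) x∈C y∈C = go (∣ C ∣ ℕ.≤? rk ρ C)
    where
    C∩E : C ∩ E ⊆ ⊥
    C∩E = set 3 (λ C S E → C ⋐ S ∖ E ⇒ ⊢ C ⊓ E ⋐ ∅) (C ∷ S ∷ E ∷ []) C⊆S′
    free-∪ : ∀ {c} → c ∈ C → Free ρ ((C ─ ⁅ c ⁆) ∪ E)
    free-∪ {c} c∈C = lin 6 (λ d u r p e q → d ⩽ q ⇒ p ⊕ q ⩽ r ⇒ u ⩽ d ⊕ e ⇒ e ⩽ p ⇒ ⊢ u ⩽ r)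
      (∣ C ─ ⁅ c ⁆ ∣ ∷ ∣ (C ─ ⁅ c ⁆) ∪ E ∣ ∷ rk ρ ((C ─ ⁅ c ⁆) ∪ E) ∷ rk ρ E ∷ ∣ E ∣ ∷ rk σ (C ─ ⁅ c ⁆) ∷ [])
      (free c∈C) (≤-reflexive (sym (rk-contract ρ E (C ─ ⁅ c ⁆))))
      (subadditive (cardinality _) {C = (C ─ ⁅ c ⁆) ∪ E} id)
      (≤-trans (≤-reflexive (∣⁅x⁆∣≡1 e)) rk-e)
    go : Dec (∣ C ∣ ≤ rk ρ C) → ∃[ C ] C ⊆ S × IsCircuit ρ C × x ∈ C × y ∈ C
    go (no ¬free) = C , ⊆-trans {_} {C} C⊆S′ (p─q⊆p S E) ,
      (≰⇒> ¬free , λ c∈C → free-⊆ ρ (p⊆p∪q E) (free-∪ c∈C)) , x∈C , y∈C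
    go (yes freeC) = C ∪ E ,
      set 3 (λ C S E → C ⋐ S ∖ E ⇒ E ⋐ S ⇒ ⊢ C ⊔ E ⋐ S) (C ∷ S ∷ E ∷ []) C⊆S′ (∈⇒⁅⁆⊆ e∈S) ,
      (dependent , free′) , x∈p∪q⁺ (inj₁ x∈C) , x∈p∪q⁺ (inj₁ y∈C)
      where
      dependent : rk ρ (C ∪ E) < ∣ C ∪ E ∣
      dependent = lin 6 (λ r q p c e u → lit 1 ⊕ q ⩽ c ⇒ r ⩽ p ⊕ q ⇒ p ⩽ e ⇒ c ⊕ e ⩽ u ⇒ ⊢ lit 1 ⊕ r ⩽ u)
        (rk ρ (C ∪ E) ∷ rk σ C ∷ rk ρ E ∷ ∣ C ∣ ∷ ∣ E ∣ ∷ ∣ C ∪ E ∣ ∷ [])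
        dep (≤-reflexive (rk-contract ρ E C)) (rk≤∣∣ ρ E) (∣∣-disjoint id C∩E)
      free′ : ∀ {c} → c ∈ C ∪ E → Free ρ ((C ∪ E) ─ ⁅ c ⁆)
      free′ {c} c∈ with x∈p∪q⁻ C E c∈
      ... | inj₁ c∈C = free-⊆ ρ (set 3 (λ C E X → ⊢ (C ⊔ E) ∖ X ⋐ (C ∖ X) ⊔ E) (C ∷ E ∷ ⁅ c ⁆ ∷ [])) (free-∪ c∈C)
      ... | inj₂ c∈E rewrite x∈⁅y⁆⇒x≡y e c∈E = free-⊆ ρ (set 2 (λ C E → ⊢ (C ⊔ E) ∖ E ⋐ C) (C ∷ E ∷ [])) freeC

  by-contraction : Inseparable σ S′ ⊎ ∃ (Splitting σ S′) → ∃ (Splitting ρ S′) →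
                   ∃[ C ] C ⊆ S × IsCircuit ρ C × x ∈ C × y ∈ C
  by-contraction (inj₁ insep′) _ with inseparable⇒circuit σ (rs smaller) insep′ x≢y x∈S′ y∈S′
  ... | C , C⊆ , circ , x∈C , y∈C = lift C⊆ circ x∈C y∈C
  by-contraction (inj₂ spl) spl′ = contradiction spl
    (deletion-or-contraction ρ e∈S insep spl′)

  by-deletion : Inseparable ρ S′ ⊎ ∃ (Splitting ρ S′) → ∃[ C ] C ⊆ S × IsCircuit ρ C × x ∈ C × y ∈ C
  by-deletion (inj₁ insep′) with inseparable⇒circuit ρ (rs smaller) insep′ x≢y x∈S′ y∈S′
  ... | C , C⊆ , circ , x∈C , y∈C = C , ⊆-trans {_} {C} C⊆ (p─q⊆p S E) , circ , x∈C , y∈C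
  by-deletion (inj₂ spl) = by-contraction (inseparable? σ S′) spl

-- A circuit through both sides of a separation would be cut into two proper, hence free, parts
-- whose ranks add up, and so would be free itself.
circuits⇒inseparable : ∀ (ρ : RankFunction n) {S} →
  (∀ {x y} → x ∈ S → y ∈ S → x ≢ y → ∃[ C ] C ⊆ S × IsCircuit ρ C × x ∈ C × y ∈ C) → Inseparable ρ S
circuits⇒inseparable ρ {S} circuits A sep with nonempty? (S ∩ A) | nonempty? (S ─ A)
... | no empty | _        = inj₁ empty
... | yes _    | no empty = inj₂ empty
... | yes (x , x∈) | yes (y , y∈)
  with circuits (p∩q⊆p S A x∈) (p─q⊆p S A y∈) (λ { refl → x∈p─q⇒x∉q S A y∈ (p∩q⊆q S A x∈) })
... | C , C⊆S , (dep , free) , x∈C , y∈C = contradiction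
  (lin 6 (λ c r a b ra rb → lit 1 ⊕ r ⩽ c ⇒ ra ⊕ rb ⩽ r ⇒ a ⩽ ra ⇒ b ⩽ rb ⇒ c ⩽ a ⊕ b ⇒ ⊢ lit 1 ⩽ lit 0)
    (∣ C ∣ ∷ rk ρ C ∷ ∣ C ∩ A ∣ ∷ ∣ C ─ A ∣ ∷ rk ρ (C ∩ A) ∷ rk ρ (C ─ A) ∷ []) dep
    (Separates-⊆ ρ sep C⊆S)
    (free-⊆ ρ (set 3 (λ C A Y → Y ⊓ A ⋐ ∅ ⇒ ⊢ C ⊓ A ⋐ C ∖ Y) (C ∷ A ∷ ⁅ y ⁆ ∷ []) (∉⇒⁅⁆∩⊆⊥ (x∈p─q⇒x∉q S A y∈))) (free y∈C))
    (free-⊆ ρ (set 3 (λ C A X → X ⋐ A ⇒ ⊢ C ∖ A ⋐ C ∖ X) (C ∷ A ∷ ⁅ x ⁆ ∷ []) (∈⇒⁅⁆⊆ (p∩q⊆q S A x∈))) (free x∈C))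
    (subadditive (cardinality _) {C = C} (⊆∩∪─ C A))) λ ()

-- Extensions of small contraction-depth

-- The elements outside S become loops.
record Extension (ρ : RankFunction n) (S : Subset n) (k : ℕ) : Set where
  field
    {size}    : ℕ
    extended  : RankFunction size
    old       : Fin n → Fin size
    injective : Injective _≡_ _≡_ old
    agrees    : ∀ Z → rk extended (Z ∩ imageˢ old ⊤) ≡ rk ρ (preimage old Z ∩ S)
    cd≤       : Cd≤ extended ⊤ k

open Extension

module _ {m n : ℕ} where

  private
    l : Fin m → Fin (m + n)
    l i = i ↑ˡ n
    r : Fin n → Fin (m + n)
    r i = m ↑ʳ i

    l-injective : Injective _≡_ _≡_ l
    l-injective = Fin.↑ˡ-injective n _ _
    r-injective : Injective _≡_ _≡_ r
    r-injective = Fin.↑ʳ-injective m _ _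

    L : Subset (m + n)
    L = imageˢ l ⊤

    l≢r : ∀ {i j} → l i ≢ r j
    l≢r {i} {j} eq with trans (sym (Fin.splitAt-↑ˡ m i n)) (trans (cong (splitAt m) eq) (Fin.splitAt-↑ʳ m n j))
    ... | ()

    r∉L : ∀ {i} → r i ∉ L
    r∉L r∈ with ∈-image⁻ l r∈
    ... | i , _ , eq = l≢r eq

    l∈L : ∀ {i} → l i ∈ L
    l∈L = ∈-image⁺ l ∈⊤

    ∉L⇒r : ∀ {j} → j ∉ L → ∃[ i ] r i ≡ j
    ∉L⇒r {j} j∉ with splitAt m j in eq
    ... | inj₁ i = contradiction (subst (_∈ L) (Fin.splitAt⁻¹-↑ˡ eq) l∈L) j∉
    ... | inj₂ i = i , Fin.splitAt⁻¹-↑ʳ eq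

  module _ (ρ : RankFunction m) (σ : RankFunction n) where

    disjointSum : RankFunction (m + n)
    disjointSum = directSum L (pushforward l l-injective ρ) (pushforward r r-injective σ)

    rk-disjointSum : ∀ Z → rk disjointSum Z ≡ rk ρ (preimage l Z) + rk σ (preimage r Z)
    rk-disjointSum Z = cong₂ (λ X Y → rk ρ X + rk σ Y)
      (⊆-antisym (λ p → ∈-preimage⁺ l (p∩q⊆p Z L (∈-preimage⁻ l p)))
                 (λ p → ∈-preimage⁺ l {Z ∩ L} (x∈p∩q⁺ (∈-preimage⁻ l p , l∈L))))
      (⊆-antisym (λ p → ∈-preimage⁺ r (p─q⊆p Z L (∈-preimage⁻ r p)))
                 (λ p → ∈-preimage⁺ r {Z ─ L} (x∈p∧x∉q⇒x∈p─q (∈-preimage⁻ r p) r∉L)))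

    cd≤-disjointSum : ∀ {k} → Cd≤ ρ ⊤ k → Cd≤ σ ⊤ k → Cd≤ disjointSum ⊤ k
    cd≤-disjointSum c d = sum L separates
      (cd≤-image l l-injective {ρ = ρ} (⊆-antisym (λ _ → ∈-preimage⁺ l {⊤ ∩ L} (x∈p∩q⁺ (∈⊤ , l∈L))) ⊆⊤)
        (λ j∈ → let i , _ , eq = ∈-image⁻ l (p∩q⊆q ⊤ L j∈) in i , eq) rep-l c)
      (cd≤-image r r-injective {ρ = σ} (⊆-antisym (λ _ → ∈-preimage⁺ r {⊤ ─ L} (x∈p∧x∉q⇒x∈p─q ∈⊤ r∉L)) ⊆⊤)
        (λ j∈ → ∉L⇒r (x∈p─q⇒x∉q ⊤ L j∈)) rep-r d)
      where
      rep-l : ∀ {Z} → Z ⊆ ⊤ ∩ L → rk disjointSum Z ≡ rk ρ (preimage l Z)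
      rep-l {Z} Z⊆ = trans (rk-disjointSum Z) (trans (cong (rk ρ (preimage l Z) +_)
        (rk-⊆⊥ σ λ p → contradiction (p∩q⊆q ⊤ L (Z⊆ (∈-preimage⁻ r p))) r∉L)) (+-identityʳ _))
      rep-r : ∀ {Z} → Z ⊆ ⊤ ─ L → rk disjointSum Z ≡ rk σ (preimage r Z)
      rep-r {Z} Z⊆ = trans (rk-disjointSum Z) (cong (_+ rk σ (preimage r Z))
        (rk-⊆⊥ ρ λ p → contradiction l∈L (x∈p─q⇒x∉q ⊤ L (Z⊆ (∈-preimage⁻ l p)))))
      separates : Separates disjointSum ⊤ L
      separates = ≤-reflexive (trans (cong₂ _+_ (rep-l id) (rep-r id)) (trans (cong₂ _+_
        (cong (rk ρ) (⊆-antisym (λ p → ∈-preimage⁺ l (p∩q⊆p ⊤ L (∈-preimage⁻ l p)))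
                 (λ p → ∈-preimage⁺ l {⊤ ∩ L} (x∈p∩q⁺ (∈⊤ , l∈L)))))
        (cong (rk σ) (⊆-antisym (λ p → ∈-preimage⁺ r (p─q⊆p ⊤ L (∈-preimage⁻ r p)))
                 (λ p → ∈-preimage⁺ r {⊤ ─ L} (x∈p∧x∉q⇒x∈p─q ∈⊤ r∉L)))))
        (sym (rk-disjointSum ⊤))))

  module _ {o} (A : Subset o) (f : Fin o → Fin m) (g : Fin o → Fin n)
           (f-injective : Injective _≡_ _≡_ f) (g-injective : Injective _≡_ _≡_ g) where

    -- Each of the two extensions contains a copy of every old element. An element is represented by
    -- its copy on its own side of A; in the application the other copies are loops.
    glue : Fin o → Fin (m + n)
    glue x = if does (x ∈? A) then l (f x) else r (g x)

    glue-∈ : ∀ {x} → x ∈ A → glue x ≡ l (f x)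
    glue-∈ {x} x∈A rewrite dec-true (x ∈? A) x∈A = refl

    glue-∉ : ∀ {x} → x ∉ A → glue x ≡ r (g x)
    glue-∉ {x} x∉A rewrite dec-false (x ∈? A) x∉A = refl

    glue-injective : Injective _≡_ _≡_ glue
    glue-injective {x} {y} eq with x ∈? A | y ∈? A
    ... | yes _ | yes _ = f-injective (l-injective eq)
    ... | no _  | no _  = g-injective (r-injective eq)
    ... | yes _ | no _  = contradiction eq l≢r
    ... | no _  | yes _ = contradiction (sym eq) l≢r

    preimage-l : ∀ Z → preimage l (Z ∩ imageˢ glue ⊤) ≡ (preimage l Z ∩ imageˢ f A) ∩ imageˢ f ⊤
    preimage-l Z = ⊆-antisym to from
      where
      to : preimage l (Z ∩ imageˢ glue ⊤) ⊆ (preimage l Z ∩ imageˢ f A) ∩ imageˢ f ⊤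
      to p with x∈p∩q⁻ Z _ (∈-preimage⁻ l p)
      ... | p₁ , p₂ with ∈-image⁻ glue p₂
      ... | x , _ , eq with x ∈? A
      ... | no _ = contradiction (sym eq) l≢r
      ... | yes x∈A = x∈p∩q⁺ (x∈p∩q⁺ (∈-preimage⁺ l p₁ , subst (_∈ _) (l-injective eq) (∈-image⁺ f x∈A)) ,
                              subst (_∈ _) (l-injective eq) (∈-image⁺ f ∈⊤))
      from : (preimage l Z ∩ imageˢ f A) ∩ imageˢ f ⊤ ⊆ preimage l (Z ∩ imageˢ glue ⊤)
      from p with x∈p∩q⁻ (preimage l Z) _ (p∩q⊆p (preimage l Z ∩ imageˢ f A) _ p)
      ... | p₁ , p₂ with ∈-image⁻ f p₂
      ... | x , x∈A , refl = ∈-preimage⁺ l {Z ∩ imageˢ glue ⊤} (x∈p∩q⁺ (∈-preimage⁻ l p₁ ,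
        subst (_∈ _) (glue-∈ x∈A) (∈-image⁺ glue ∈⊤)))

    preimage-r : ∀ Z → preimage r (Z ∩ imageˢ glue ⊤) ≡ (preimage r Z ∩ imageˢ g (∁ A)) ∩ imageˢ g ⊤
    preimage-r Z = ⊆-antisym to from
      where
      to : preimage r (Z ∩ imageˢ glue ⊤) ⊆ (preimage r Z ∩ imageˢ g (∁ A)) ∩ imageˢ g ⊤
      to p with x∈p∩q⁻ Z _ (∈-preimage⁻ r p)
      ... | p₁ , p₂ with ∈-image⁻ glue p₂
      ... | x , _ , eq with x ∈? A
      ... | yes _  = contradiction eq l≢r
      ... | no x∉A = x∈p∩q⁺ (x∈p∩q⁺ (∈-preimage⁺ r p₁ , subst (_∈ _) (r-injective eq) (∈-image⁺ g (x∉p⇒x∈∁p x∉A))) ,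
                              subst (_∈ _) (r-injective eq) (∈-image⁺ g ∈⊤))
      from : (preimage r Z ∩ imageˢ g (∁ A)) ∩ imageˢ g ⊤ ⊆ preimage r (Z ∩ imageˢ glue ⊤)
      from p with x∈p∩q⁻ (preimage r Z) _ (p∩q⊆p (preimage r Z ∩ imageˢ g (∁ A)) _ p)
      ... | p₁ , p₂ with ∈-image⁻ g p₂
      ... | x , x∈∁A , refl = ∈-preimage⁺ r {Z ∩ imageˢ glue ⊤} (x∈p∩q⁺ (∈-preimage⁻ r p₁ ,
        subst (_∈ _) (glue-∉ (x∈∁p⇒x∉p x∈∁A)) (∈-image⁺ glue ∈⊤)))

    preimage-f : ∀ S Z → preimage f (preimage l Z ∩ imageˢ f A) ∩ (S ∩ A) ≡ (preimage glue Z ∩ S) ∩ A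
    preimage-f S Z = ⊆-antisym
      (λ p → let p₁ , p₂ = x∈p∩q⁻ _ (S ∩ A) p
                 x∈S , x∈A = x∈p∩q⁻ S A p₂
             in x∈p∩q⁺ (x∈p∩q⁺ (∈-preimage⁺ glue {Z} (subst (_∈ Z) (sym (glue-∈ x∈A))
                  (∈-preimage⁻ l (p∩q⊆p (preimage l Z) _ (∈-preimage⁻ f p₁)))) , x∈S) , x∈A))
      (λ p → let p₁ , x∈A = x∈p∩q⁻ _ A p
                 x∈Z , x∈S = x∈p∩q⁻ _ S p₁
             in x∈p∩q⁺ (∈-preimage⁺ f {preimage l Z ∩ imageˢ f A} (x∈p∩q⁺ (∈-preimage⁺ l
                  (subst (_∈ Z) (glue-∈ x∈A) (∈-preimage⁻ glue x∈Z)) , ∈-image⁺ f x∈A)) , x∈p∩q⁺ (x∈S , x∈A)))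

    preimage-g : ∀ S Z → preimage g (preimage r Z ∩ imageˢ g (∁ A)) ∩ (S ─ A) ≡ (preimage glue Z ∩ S) ─ A
    preimage-g S Z = ⊆-antisym
      (λ p → let p₁ , p₂ = x∈p∩q⁻ _ (S ─ A) p
                 x∉A = x∈p─q⇒x∉q S A p₂
             in x∈p∧x∉q⇒x∈p─q (x∈p∩q⁺ (∈-preimage⁺ glue {Z} (subst (_∈ Z) (sym (glue-∉ x∉A))
                  (∈-preimage⁻ r (p∩q⊆p (preimage r Z) _ (∈-preimage⁻ g p₁)))) , p─q⊆p S A p₂)) x∉A)
      (λ p → let p₁ = p─q⊆p _ A p
                 x∉A = x∈p─q⇒x∉q (preimage glue Z ∩ S) A p
                 x∈Z , x∈S = x∈p∩q⁻ _ S p₁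
             in x∈p∩q⁺ (∈-preimage⁺ g {preimage r Z ∩ imageˢ g (∁ A)} (x∈p∩q⁺ (∈-preimage⁺ r
                  (subst (_∈ Z) (glue-∉ x∉A) (∈-preimage⁻ glue x∈Z)) , ∈-image⁺ g (x∉p⇒x∈∁p x∉A))) ,
                x∈p∧x∉q⇒x∈p─q x∈S x∉A))

-- The new element zero is contracted to leave the extension of the quotient; it is
-- added by a Higgs lift towards the matroid in which all new elements are free.
module _ {ρ σ : RankFunction n} {S : Subset n} {k : ℕ} (q : ρ ↠[ S ] σ) (ρ≤σ : rk ρ S ≤ suc (rk σ S))
         (E : Extension σ S k) where

  private
    φ : Fin n → Fin (suc (size E))
    φ = suc ∘ old E

    φ-injective : Injective _≡_ _≡_ φ
    φ-injective = injective E ∘ Fin.suc-injective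

    I : Subset (suc (size E))
    I = imageˢ φ ⊤

    -- `loops` is the given extension of σ with zero added as a loop. In `free`, the old elements
    -- carry ρ restricted to S and all others are coloops.
    free loops : RankFunction (suc (size E))
    free  = directSum I (pushforward φ φ-injective (restrict S ρ)) (cardinality _)
    loops = pushforward suc Fin.suc-injective (extended E)

    preimage-φ-∩ : ∀ Z → preimage φ (Z ∩ I) ≡ preimage φ Z
    preimage-φ-∩ Z = ⊆-antisym (λ p → ∈-preimage⁺ φ (p∩q⊆p Z I (∈-preimage⁻ φ p)))
      (λ p → ∈-preimage⁺ φ {Z ∩ I} (x∈p∩q⁺ (∈-preimage⁻ φ p , ∈-image⁺ φ ∈⊤)))

    rk-free : ∀ Z → rk free Z ≡ rk ρ (preimage φ Z ∩ S) + ∣ Z ─ I ∣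
    rk-free Z = cong (λ X → rk ρ (X ∩ S) + ∣ Z ─ I ∣) (preimage-φ-∩ Z)

    rk-loops : ∀ Z → rk loops (Z ∩ I) ≡ rk σ (preimage φ Z ∩ S)
    rk-loops Z = trans (cong (rk (extended E)) (⊆-antisym to from))
      (trans (agrees E (preimage suc Z)) (cong (λ X → rk σ (X ∩ S)) (⊆-antisym
        (∈-preimage⁺ φ {Z} ∘ ∈-preimage⁻ suc ∘ ∈-preimage⁻ (old E))
        (∈-preimage⁺ (old E) ∘ ∈-preimage⁺ suc {Z} ∘ ∈-preimage⁻ φ))))
      where
      to : preimage suc (Z ∩ I) ⊆ preimage suc Z ∩ imageˢ (old E) ⊤
      to p with x∈p∩q⁻ Z I (∈-preimage⁻ suc p)
      ... | p₁ , p₂ with ∈-image⁻ φ p₂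
      ... | x , _ , refl = x∈p∩q⁺ (∈-preimage⁺ suc {Z} p₁ , ∈-image⁺ (old E) ∈⊤)
      from : preimage suc Z ∩ imageˢ (old E) ⊤ ⊆ preimage suc (Z ∩ I)
      from p with x∈p∩q⁻ (preimage suc Z) _ p
      ... | p₁ , p₂ with ∈-image⁻ (old E) p₂
      ... | x , _ , refl = ∈-preimage⁺ suc {Z ∩ I} (x∈p∩q⁺ (∈-preimage⁻ suc p₁ , ∈-image⁺ φ ∈⊤))

    -- New elements raise `free` by their full number, the most by which they can raise `loops`; on
    -- the old elements the claim is the hypothesis `q`.
    free↠loops : free ↠ loops
    free↠loops {X} {Y} X⊆Y = subst₂ _≤_
      (cong (rk loops Y +_) (sym (rk-free X))) (cong (rk loops X +_) (sym (rk-free Y)))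
      (lin 7 (λ y ρx x ρy c cx cy → y ⊕ ρx ⩽ x ⊕ (ρy ⊕ c) ⇒ cx ⊕ c ⩽ cy ⇒ ⊢ y ⊕ (ρx ⊕ cx) ⩽ x ⊕ (ρy ⊕ cy))
        (rk loops Y ∷ rk ρ Xˢ ∷ rk loops X ∷ rk ρ Yˢ ∷ ∣ (Y ─ I) ─ X ∣ ∷ ∣ X ─ I ∣ ∷ ∣ Y ─ I ∣ ∷ [])
        old-part (∣∣-disjoint (set 3 (λ X Y I → X ⋐ Y ⇒ ⊢ (X ∖ I) ⊔ ((Y ∖ I) ∖ X) ⋐ Y ∖ I) (X ∷ Y ∷ I ∷ []) X⊆Y)
          (set 3 (λ X Y I → ⊢ (X ∖ I) ⊓ ((Y ∖ I) ∖ X) ⋐ ∅) (X ∷ Y ∷ I ∷ []))))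
      where
      Xˢ Yˢ : Subset n
      Xˢ = preimage φ X ∩ S
      Yˢ = preimage φ Y ∩ S
      Xˢ⊆Yˢ : Xˢ ⊆ Yˢ
      Xˢ⊆Yˢ p = x∈p∩q⁺ (∈-preimage⁺ φ {Y} (X⊆Y (∈-preimage⁻ φ (p∩q⊆p _ S p))) , p∩q⊆q (preimage φ X) S p)
      old-part : rk loops Y + rk ρ Xˢ ≤ rk loops X + (rk ρ Yˢ + ∣ (Y ─ I) ─ X ∣)
      old-part = lin 10
        (λ u xi yi x y c σx σy ρx ρy → u ⊕ xi ⩽ x ⊕ yi ⇒ y ⩽ u ⊕ c ⇒ σx ⩽ xi ⇒ yi ⩽ σy ⇒ σy ⊕ ρx ⩽ σx ⊕ ρy ⇒
          ⊢ y ⊕ ρx ⩽ x ⊕ (ρy ⊕ c))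
        (rk loops (X ∪ Y ∩ I) ∷ rk loops (X ∩ I) ∷ rk loops (Y ∩ I) ∷ rk loops X ∷ rk loops Y ∷
         ∣ (Y ─ I) ─ X ∣ ∷ rk σ Xˢ ∷ rk σ Yˢ ∷ rk ρ Xˢ ∷ rk ρ Yˢ ∷ [])
        (submodular loops {C = X ∪ Y ∩ I} {X} {Y ∩ I} {X ∩ I} id
          (set 3 (λ X Y I → X ⋐ Y ⇒ ⊢ X ⊓ I ⋐ X ⊓ (Y ⊓ I)) (X ∷ Y ∷ I ∷ []) X⊆Y))
        (≤-trans (subadditive loops {A = X ∪ Y ∩ I} {(Y ─ I) ─ X}
          (set 3 (λ X Y I → ⊢ Y ⋐ (X ⊔ Y ⊓ I) ⊔ ((Y ∖ I) ∖ X)) (X ∷ Y ∷ I ∷ [])))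
          (+-monoʳ-≤ _ (rk≤∣∣ loops ((Y ─ I) ─ X))))
        (≤-reflexive (sym (rk-loops X))) (≤-reflexive (rk-loops Y))
        (q {Xˢ} {Yˢ} Xˢ⊆Yˢ (p∩q⊆q (preimage φ Y) S))

    lift : RankFunction (suc (size E))
    lift = higgs free loops free↠loops 1

    zero∉I : zero ∉ I
    zero∉I p with ∈-image⁻ φ p
    ... | _ , _ , ()

    Z₀ : Subset (suc (size E))
    Z₀ = ⁅ zero ⁆

    ∣Z₀─I∣ : 1 ≤ ∣ Z₀ ─ I ∣
    ∣Z₀─I∣ = ≤-trans (≤-reflexive (sym (∣⁅x⁆∣≡1 {suc (size E)} zero))) (p⊆q⇒∣p∣≤∣q∣
      (set 2 (λ Z I → Z ⊓ I ⋐ ∅ ⇒ ⊢ Z ⋐ Z ∖ I) (Z₀ ∷ I ∷ []) (∉⇒⁅⁆∩⊆⊥ zero∉I)))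

    loops-zero : ∀ Z → rk loops (Z ∪ Z₀) ≡ rk loops Z
    loops-zero Z = cong (rk (extended E)) (⊆-antisym
      (λ p → [ ∈-preimage⁺ suc {Z} , (λ z → contradiction (x∈⁅y⁆⇒x≡y zero z) λ ()) ]′ (x∈p∪q⁻ Z Z₀ (∈-preimage⁻ suc p)))
      (λ p → ∈-preimage⁺ suc {Z ∪ Z₀} (x∈p∪q⁺ (inj₁ (∈-preimage⁻ suc p)))))

    -- Zero is a coloop of `free` and a loop of `loops`, so once it is added the minimum is attained
    -- by the second term. Contracting zero then subtracts the 1 of the lift and leaves `loops`.
    rk-lift : ∀ {Z} → Z ∩ Z₀ ⊆ ⊥ → rk lift (Z ∪ Z₀) ≡ suc (rk loops Z)
    rk-lift {Z} Z∌ = trans (ℕ.m≥n⇒m⊓n≡n (lin 8 (λ q l f cz cu c₀ ρz ρu →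
          q ⩽ l ⇒ l ⩽ ρz ⊕ cz ⇒ ρz ⩽ ρu ⇒ cz ⊕ c₀ ⩽ cu ⇒ lit 1 ⩽ c₀ ⇒ ρu ⊕ cu ⩽ f ⇒ ⊢ q ⊕ lit 1 ⩽ f)
        (rk loops (Z ∪ Z₀) ∷ rk loops Z ∷ rk free (Z ∪ Z₀) ∷ ∣ Z ─ I ∣ ∷ ∣ (Z ∪ Z₀) ─ I ∣ ∷ ∣ Z₀ ─ I ∣ ∷
         rk ρ (preimage φ Z ∩ S) ∷ rk ρ (preimage φ (Z ∪ Z₀) ∩ S) ∷ [])
        (≤-reflexive (loops-zero Z))
        (≤-trans (↠⇒≤ free loops free↠loops Z) (≤-reflexive (rk-free Z)))
        (rk-mono ρ λ p → let p₁ , p₂ = x∈p∩q⁻ _ S p in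
          x∈p∩q⁺ (∈-preimage⁺ φ {Z ∪ Z₀} (x∈p∪q⁺ (inj₁ (∈-preimage⁻ φ p₁))) , p₂))
        (∣∣-disjoint (set 3 (λ Z P I → ⊢ (Z ∖ I) ⊔ (P ∖ I) ⋐ (Z ⊔ P) ∖ I) (Z ∷ Z₀ ∷ I ∷ []))
          (set 3 (λ Z P I → Z ⊓ P ⋐ ∅ ⇒ ⊢ (Z ∖ I) ⊓ (P ∖ I) ⋐ ∅) (Z ∷ Z₀ ∷ I ∷ []) Z∌))
        ∣Z₀─I∣ (≤-reflexive (sym (rk-free (Z ∪ Z₀))))))
      (trans (+-comm _ 1) (cong suc (loops-zero Z)))

    represents : ∀ {Z} → Z ⊆ ⊤ ─ Z₀ → rk (contract Z₀ lift) Z ≡ rk (extended E) (preimage suc Z)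
    represents {Z} Z⊆ = cong₂ _∸_
      (rk-lift (set 2 (λ Z P → Z ⋐ Z ∖ P ⇒ ⊢ Z ⊓ P ⋐ ∅) (Z ∷ Z₀ ∷ [])
        (λ p → x∈p∧x∉q⇒x∈p─q p (x∈p─q⇒x∉q ⊤ Z₀ (Z⊆ p)))))
      (trans (cong (rk lift) (⊆-antisym (q⊆p∪q ⊥ Z₀) (set 1 (λ P → ⊢ ∅ ⊔ P ⋐ P) (Z₀ ∷ []))))
        (trans (rk-lift {⊥} (p∩q⊆p ⊥ Z₀)) (cong suc (rk-⊥ loops))))

  lift-extension : Extension ρ S (suc k)
  lift-extension = record
    { extended  = lift
    ; old       = φ
    ; injective = φ-injective
    -- On old elements ρ exceeds σ by at most one, so that the minimum defining `lift` is its first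
    -- term and the lift restricts to ρ.
    ; agrees    = λ Z → trans (ℕ.m≤n⇒m⊓n≡m (agrees-bound Z)) (agrees-free Z)
    ; cd≤       = contraction {p = zero} ∈⊤ (cd≤-image suc Fin.suc-injective {ρ = extended E}
        (⊆-antisym (λ {x} _ → ∈-preimage⁺ suc {⊤ ─ Z₀} (x∈p∧x∉q⇒x∈p─q ∈⊤ λ p → contradiction (x∈⁅y⁆⇒x≡y zero p) λ ())) ⊆⊤)
        in-image represents (cd≤ E))
    }
    where
    in-image : ∀ {j} → j ∈ ⊤ ─ Z₀ → ∃[ i ] suc i ≡ j
    in-image {zero}  p = contradiction (x∈⁅x⁆ zero) (x∈p─q⇒x∉q ⊤ Z₀ p)
    in-image {suc i} p = i , refl
    agrees-free : ∀ Z → rk free (Z ∩ I) ≡ rk ρ (preimage φ Z ∩ S)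
    agrees-free Z = trans (rk-free (Z ∩ I)) (trans (cong₂ (λ X c → rk ρ (X ∩ S) + c) (preimage-φ-∩ Z)
      (rk-⊆⊥ (cardinality _) (set 2 (λ Z I → ⊢ (Z ⊓ I) ∖ I ⋐ ∅) (Z ∷ I ∷ [])))) (+-identityʳ _))
    agrees-bound : ∀ Z → rk free (Z ∩ I) ≤ rk loops (Z ∩ I) + 1
    agrees-bound Z = subst₂ _≤_ (sym (agrees-free Z)) (cong (_+ 1) (sym (rk-loops Z)))
      (lin 4 (λ a b c d → a ⊕ b ⩽ c ⊕ d ⇒ d ⩽ lit 1 ⊕ a ⇒ ⊢ b ⩽ c ⊕ lit 1)
        (rk σ S ∷ rk ρ (preimage φ Z ∩ S) ∷ rk σ (preimage φ Z ∩ S) ∷ rk ρ S ∷ [])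
        (q (p∩q⊆q (preimage φ Z) S) id) ρ≤σ)

extension : ∀ {ρ : RankFunction n} {S d} → Cd*≤ ρ S d → Extension ρ S (suc d)
-- Rank zero costs no edge, while a set of loops has contraction-depth 1: this is the source of the
-- offset.
extension {n} {ρ} {S} (flat z) = record
  { extended  = restrict S ρ
  ; old       = id
  ; injective = id
  ; agrees    = λ Z → cong (λ X → rk ρ (X ∩ S)) (⊆-antisym
      (λ p → ∈-preimage⁺ id (p∩q⊆p Z _ p))
      (λ p → x∈p∩q⁺ (∈-preimage⁻ id p , ∈-image⁺ id ∈⊤)))
  ; cd≤       = Cd≤-mono (s≤s z≤n) (discrete⇒cd≤ (restrict S ρ) ⊤
      (λ {x} _ → ≤-trans (≤-reflexive (cong₂ _+_ (loop (⊤ ∩ ⁅ x ⁆)) (loop (⊤ ─ ⁅ x ⁆)))) z≤n)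
      (<-wellFounded _))
  }
  where
  loop : ∀ X → rk ρ (X ∩ S) ≡ 0
  loop X = ℕ.n≤0⇒n≡0 (≤-trans (rk-mono ρ (p∩q⊆q X S)) (≤-reflexive z))
extension {n} {ρ} {S} (split A sep k l) = record
  { extended  = disjointSum ρ₁ ρ₂
  ; old       = φ
  ; injective = glue-injective A (old E₁) (old E₂) (injective E₁) (injective E₂)
  ; agrees    = agreement
  ; cd≤       = cd≤-disjointSum ρ₁ ρ₂ (cd≤ E₁) (cd≤ E₂)
  }
  where
  E₁ = extension k
  E₂ = extension l
  ρ₁ = extended E₁
  ρ₂ = extended E₂
  φ = glue A (old E₁) (old E₂) (injective E₁) (injective E₂)

  agreement : ∀ Z → rk (disjointSum ρ₁ ρ₂) (Z ∩ imageˢ φ ⊤) ≡ rk ρ (preimage φ Z ∩ S)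
  agreement Z = trans (rk-disjointSum ρ₁ ρ₂ (Z ∩ imageˢ φ ⊤)) (trans (cong₂ _+_
      (trans (cong (rk ρ₁) (preimage-l A (old E₁) (old E₂) (injective E₁) (injective E₂) Z))
        (trans (agrees E₁ _) (cong (rk ρ) (preimage-f A (old E₁) (old E₂) (injective E₁) (injective E₂) S Z))))
      (trans (cong (rk ρ₂) (preimage-r A (old E₁) (old E₂) (injective E₁) (injective E₂) Z))
        (trans (agrees E₂ _) (cong (rk ρ) (preimage-g A (old E₁) (old E₂) (injective E₁) (injective E₂) S Z)))))
    (≤-antisym (Separates-⊆ ρ sep (p∩q⊆q (preimage φ Z) S))
      (subadditive ρ (⊆∩∪─ (preimage φ Z ∩ S) A))))
extension (quotient σ q ρ≤σ k) = lift-extension q ρ≤σ (extension k)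

-- Rank functions of matroids

∈-subsets : ∀ (S : Subset n) → S ∈ₗ subsets n
∈-subsets []            = here refl
∈-subsets (inside  ∷ S) = ∈ₗ.∈-++⁺ˡ (∈ₗ.∈-map⁺ (inside ∷_) (∈-subsets S))
∈-subsets {suc n} (outside ∷ S) =
  ∈ₗ.∈-++⁺ʳ (map (inside ∷_) (subsets n)) (∈ₗ.∈-map⁺ (outside ∷_) (∈-subsets S))

module _ (M : Matroid n) where

  private
    candidate? : ∀ X Y → Dec (Y ⊆ X × Indep M Y)
    candidate? X Y = (Y ⊆? X) ×-dec indep? M Y

  ∣∣≤rank : Y ⊆ X → Indep M Y → ∣ Y ∣ ≤ rank M X
  ∣∣≤rank {Y} {X} Y⊆X i = v≤max⁺ 0 (map ∣_∣ (filter (candidate? X) (subsets n)))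
    (inj₂ (lose (∈ₗ.∈-map⁺ ∣_∣ (∈ₗ.∈-filter⁺ (candidate? X) (∈-subsets Y) ((λ {x} → Y⊆X {x}) , i))) ≤-refl))

  rank-attained : ∀ X → ∃[ Y ] Y ⊆ X × Indep M Y × rank M X ≤ ∣ Y ∣
  rank-attained X with argmax-sel id 0 (map ∣_∣ (filter (candidate? X) (subsets n)))
  ... | inj₁ eq = ⊥ , ⊥⊆ , ⊥-indep M , ≤-trans (≤-reflexive eq) z≤n
  ... | inj₂ m∈ with ∈ₗ.∈-map⁻ ∣_∣ {xs = filter (candidate? X) (subsets n)} m∈
  ... | Y , Y∈ , eq with ∈ₗ.∈-filter⁻ (candidate? X) {xs = subsets n} Y∈
  ... | _ , Y⊆X , i = Y , Y⊆X , i , ≤-reflexive eq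

  -- The fuel bounds the number of augmentations still possible.
  extend : ∀ fuel {I} → I ⊆ Z → Indep M I → rank M Z ≤ fuel + ∣ I ∣ →
           ∃[ J ] I ⊆ J × J ⊆ Z × Indep M J × rank M Z ≤ ∣ J ∣
  extend zero {I} I⊆Z i le = I , id , I⊆Z , i , le
  extend {Z} (suc fuel) {I} I⊆Z i le with rank M Z ℕ.≤? ∣ I ∣ | rank-attained Z
  ... | yes full | _ = I , id , I⊆Z , i , full
  ... | no ¬full | Y , Y⊆Z , iY , rank≤ with augment M i iY (ℕ.<-≤-trans (≰⇒> ¬full) rank≤)
  ... | y , y∈Y , y∉I , i′ with extend fuel {I ∪ ⁅ y ⁆}
        (λ x∈ → [ I⊆Z , (λ x∈y → subst (_∈ Z) (sym (x∈⁅y⁆⇒x≡y y x∈y)) (Y⊆Z y∈Y)) ]′ (x∈p∪q⁻ I ⁅ y ⁆ x∈)) i′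
        (≤-trans le (≤-trans (≤-reflexive (sym (+-suc fuel ∣ I ∣))) (+-monoʳ-≤ fuel
          (p⊂q⇒∣p∣<∣q∣ (p⊆p∪q _ , y , x∈p∪q⁺ (inj₂ (x∈⁅x⁆ y)) , y∉I)))))
  ... | J , I⊆J , rest = J , I⊆J ∘ p⊆p∪q _ , rest

  -- Abstract, as with-abstraction would otherwise unfold these proofs.
  abstract
    rank-isRankFunction : IsRankFunction (rank M)
    rank-isRankFunction = zero-⊥ , unit , mono , sub
      where
      zero-⊥ : rank M ⊥ ≡ 0
      zero-⊥ = let Y , Y⊆⊥ , _ , le = rank-attained ⊥ in
        ℕ.n≤0⇒n≡0 (≤-trans le (≤-trans (p⊆q⇒∣p∣≤∣q∣ Y⊆⊥) (≤-reflexive (∣⊥∣≡0 n))))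
      unit : ∀ x → rank M ⁅ x ⁆ ≤ 1
      unit x = let Y , Y⊆ , _ , le = rank-attained ⁅ x ⁆ in
        ≤-trans le (≤-trans (p⊆q⇒∣p∣≤∣q∣ Y⊆) (≤-reflexive (∣⁅x⁆∣≡1 x)))
      mono : ∀ X Y → X ⊆ Y → rank M X ≤ rank M Y
      mono X Y X⊆Y = let Z , Z⊆ , i , le = rank-attained X in
        ≤-trans le (∣∣≤rank (⊆-trans {_} {Z} Z⊆ X⊆Y) i)
      sub : ∀ X Y → rank M (X ∪ Y) + rank M (X ∩ Y) ≤ rank M X + rank M Y
      -- I spans the intersection and extends to J, which spans the union. The independent sets
      -- `J ∩ X` and `J ∩ Y` cover J and both contain I, so their sizes add up to at least those of
      -- J and I.
      sub X Y with rank-attained (X ∩ Y)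
      ... | I , I⊆ , iI , leI with extend (rank M (X ∪ Y)) {I} (λ x∈ → x∈p∪q⁺ (inj₁ (p∩q⊆p X Y (I⊆ x∈)))) iI (ℕ.m≤m+n _ _)
      ... | J , I⊆J , J⊆ , iJ , leJ = lin 8 (λ u v i j x y a b → u ⩽ j ⇒ v ⩽ i ⇒ j ⊕ i ⩽ a ⊕ b ⇒ a ⩽ x ⇒ b ⩽ y ⇒ ⊢ u ⊕ v ⩽ x ⊕ y)
        (rank M (X ∪ Y) ∷ rank M (X ∩ Y) ∷ ∣ I ∣ ∷ ∣ J ∣ ∷ rank M X ∷ rank M Y ∷ ∣ J ∩ X ∣ ∷ ∣ J ∩ Y ∣ ∷ [])
        leJ leI
        (submodular (cardinality n) {C = J} {J ∩ X} {J ∩ Y} {I}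
          (set 3 (λ J X Y → J ⋐ X ⊔ Y ⇒ ⊢ J ⋐ J ⊓ X ⊔ J ⊓ Y) (J ∷ X ∷ Y ∷ []) J⊆)
          (set 4 (λ I J X Y → I ⋐ J ⇒ I ⋐ X ⊓ Y ⇒ ⊢ I ⋐ (J ⊓ X) ⊓ (J ⊓ Y)) (I ∷ J ∷ X ∷ Y ∷ []) I⊆J I⊆))
        (∣∣≤rank (p∩q⊆q J X) (⊆-indep M (p∩q⊆p J X) iJ))
        (∣∣≤rank (p∩q⊆q J Y) (⊆-indep M (p∩q⊆p J Y) iJ))

  rankFunction : RankFunction n
  rankFunction = fromRank rank-isRankFunction

  indep⇒free : Indep M X → Free rankFunction X
  indep⇒free = ∣∣≤rank id

  free⇒indep : Free rankFunction X → Indep M X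
  free⇒indep {X} free with rank-attained X
  ... | Y , Y⊆X , i , le = ⊆-indep M (⊆∧∣∣≤⇒⊇ Y⊆X (≤-trans free le)) i

  isCircuit⇒circuit : ∀ {C} → IsCircuit rankFunction C → Circuit M C
  isCircuit⇒circuit (dep , free) = (λ i → ℕ.<⇒≱ dep (indep⇒free i)) ,
    λ D (D⊆C , c , c∈C , c∉D) → free⇒indep (free-⊆ rankFunction
      (λ x∈D → x∈p∧x≢y⇒x∈p-y (D⊆C x∈D) λ { refl → c∉D x∈D }) (free c∈C))

  circuit⇒isCircuit : ∀ {C} → Circuit M C → IsCircuit rankFunction C
  circuit⇒isCircuit (dep , min) = ≰⇒> (dep ∘ free⇒indep) , λ c∈C → indep⇒free (min _ (x∈p⇒p-x⊂p c∈C))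

  connected⇒inseparable : Connected M → Inseparable rankFunction ⊤
  connected⇒inseparable conn = circuits⇒inseparable rankFunction λ {x} {y} _ _ x≢y →
    let C , circ , x∈ , y∈ = conn x y x≢y in C , ⊆⊤ , circuit⇒isCircuit circ , x∈ , y∈

  inseparable⇒connected : Inseparable rankFunction ⊤ → Connected M
  inseparable⇒connected insep x y x≢y =
    let C , _ , circ , x∈ , y∈ = inseparable⇒circuit rankFunction (<-wellFounded _) insep x≢y ∈⊤ ∈⊤
    in C , isCircuit⇒circuit circ , x∈ , y∈

-- Restrictions and contractions of matroids

-- The enumeration of S by which M ∣ S renumbers its elements.
element : (S : Subset n) → Fin ∣ S ∣ → Fin n
element (inside  ∷ S) zero    = zero
element (inside  ∷ S) (suc i) = suc (element S i)
element (outside ∷ S) i       = suc (element S i)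

element-injective : ∀ (S : Subset n) → Injective _≡_ _≡_ (element S)
element-injective (inside  ∷ S) {zero}  {zero}  eq = refl
element-injective (inside  ∷ S) {suc i} {suc j} eq = cong suc (element-injective S (Fin.suc-injective eq))
element-injective (outside ∷ S) eq = element-injective S (Fin.suc-injective eq)

element-∈ : ∀ (S : Subset n) i → element S i ∈ S
element-∈ (inside  ∷ S) zero    = here
element-∈ (inside  ∷ S) (suc i) = there (element-∈ S i)
element-∈ (outside ∷ S) i       = there (element-∈ S i)

element-index : ∀ (S : Subset n) {x} (p : x ∈ S) → element S (index S p) ≡ x
element-index (inside  ∷ S) here      = refl
element-index (inside  ∷ S) (there p) = cong suc (element-index S p)
element-index (outside ∷ S) (there p) = cong suc (element-index S p)

embed-preimage : ∀ (S Z : Subset n) → embed S (preimage (element S) Z) ≡ Z ∩ S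
embed-preimage []            []      = refl
embed-preimage (inside  ∷ S) (z ∷ Z) = cong₂ _∷_ (sym (Bool.∧-identityʳ z)) (embed-preimage S Z)
embed-preimage (outside ∷ S) (z ∷ Z) = cong₂ _∷_ (sym (Bool.∧-zeroʳ z)) (embed-preimage S Z)

preimage-embed : ∀ (S : Subset n) X → preimage (element S) (embed S X) ≡ X
preimage-embed []            []      = refl
preimage-embed (inside  ∷ S) (x ∷ X) = cong (x ∷_) (preimage-embed S X)
preimage-embed (outside ∷ S) X       = preimage-embed S X

preimage-element : ∀ (S : Subset n) → preimage (element S) S ≡ ⊤
preimage-element S = ⊆-antisym ⊆⊤ (λ {i} _ → ∈-preimage⁺ (element S) (element-∈ S i))

rank-∣ : ∀ (M : Matroid n) S X → rank (M ∣ S) X ≡ rank M (embed S X)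
rank-∣ M S X = ≤-antisym
  (let Y , Y⊆ , i , le = rank-attained (M ∣ S) X in
    ≤-trans le (≤-trans (≤-reflexive (sym (embed-size S Y))) (∣∣≤rank M (embed-⊆ S Y⊆) i)))
  (let Y , Y⊆ , i , le = rank-attained M (embed S X)
       Y′ , eq = unembed S Y (λ {x} x∈Y → embed-⊆S S X (Y⊆ x∈Y))
   in ≤-trans le (≤-trans (≤-reflexive (trans (cong ∣_∣ eq) (embed-size S Y′)))
     (∣∣≤rank (M ∣ S) (embed-⊆⁻ S (λ x∈ → Y⊆ (subst (_ ∈_) (sym eq) x∈))) (subst (Indep M) eq i))))
  where
  embed-⊆S : ∀ {n} (S : Subset n) X → embed S X ⊆ S
  embed-⊆S (inside  ∷ S) (_ ∷ X) here      = here
  embed-⊆S (inside  ∷ S) (_ ∷ X) (there p) = there (embed-⊆S S X p)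
  embed-⊆S (outside ∷ S) X       (there p) = there (embed-⊆S S X p)

represents-∣ : ∀ (M : Matroid n) S → Represents (element S)
               (rankFunction (M ∣ S)) (rankFunction M) S
represents-∣ M S {Z} Z⊆S = trans (cong (rank M) (trans (sym (⊆⇒∩≡ Z⊆S)) (sym (embed-preimage S Z))))
  (sym (rank-∣ M S (preimage (element S) Z)))

inImage-∣ : ∀ (S : Subset n) → InImage (element S) S
inImage-∣ S p = index S p , element-index S p

insertAt-preimage : ∀ e (Z : Subset (suc n)) → insertAt (preimage (punchIn e) Z) e inside ≡ Z ∪ ⁅ e ⁆
insertAt-preimage zero (z ∷ Z) = cong₂ _∷_ (sym (Bool.∨-zeroʳ z))
  (trans (Vec.tabulate∘lookup Z) (sym (∪-identityʳ Z)))
insertAt-preimage {suc n} (suc e) (z ∷ Z) = cong₂ _∷_ (sym (Bool.∨-identityʳ z)) (insertAt-preimage e Z)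

insertAt-⊆⁻ : ∀ {X Y : Subset n} e b → insertAt X e b ⊆ insertAt Y e inside → X ⊆ Y
insertAt-⊆⁻ {X = X} {Y} e b p {x} x∈ = Vec.lookup⇒[]= x Y (trans (sym (Vec.insertAt-punchIn Y e inside x))
  (Vec.[]=⇒lookup (p (Vec.lookup⇒[]= (punchIn e x) _ (trans (Vec.insertAt-punchIn X e b x) (Vec.[]=⇒lookup x∈))))))

∈-insertAt : ∀ (X : Subset n) e → e ∈ insertAt X e inside
∈-insertAt X e = Vec.lookup⇒[]= e _ (Vec.insertAt-lookup X e inside)

insertAt-inside : ∀ (X : Subset n) e b → insertAt X e b ⊆ insertAt X e inside
insertAt-inside X       e       inside  p         = p
insertAt-inside X       zero    outside (there p) = there p
insertAt-inside (_ ∷ X) (suc e) outside here      = here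
insertAt-inside (_ ∷ X) (suc e) outside (there p) = there (insertAt-inside X e outside p)

-- `M / e` inserts e only if it is not a loop, whence the two cases. If e is independent, it is
-- first extended to a maximal independent subset of `X⁺` and then removed; if e is a loop, no
-- independent set contains it. The equation passed to `go` resolves the bit inside `M / e`.
rank-/ : ∀ (M : Matroid (suc n)) e X → rank (M / e) X ≡ rank M (insertAt X e inside) ∸ rank M ⁅ e ⁆
rank-/ {n} M e X = go (indep? M ⁅ e ⁆) refl
  where
  ρ = rankFunction M
  X⁺ = insertAt X e inside

  remove : ∀ {J b} → lookup J e ≡ b → insertAt (removeAt J e) e b ≡ J
  remove {J = J} refl = Vec.insertAt-removeAt J e

  bound : ∀ {J b} → (∀ {Y} → Indep M (insertAt Y e b) → Indep (M / e) Y) → J ⊆ X⁺ → Indep M J →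
          lookup J e ≡ b → ∣ J ∣ ≡ ∣ b ∷ removeAt J e ∣ × ∣ removeAt J e ∣ ≤ rank (M / e) X
  bound {J} {b} indep-/ J⊆ iJ eq =
    trans (cong ∣_∣ (sym (remove {J} eq))) (insertAt-size (removeAt J e) e b) ,
    ∣∣≤rank (M / e) (insertAt-⊆⁻ e b (λ p → J⊆ (subst (_ ∈_) (remove {J} eq) p)))
      (indep-/ (subst (Indep M) (sym (remove {J} eq)) iJ))

  go : (d : Dec (Indep M ⁅ e ⁆)) → indep? M ⁅ e ⁆ ≡ d →
       rank (M / e) X ≡ rank M X⁺ ∸ rank M ⁅ e ⁆
  go (yes i) eq = ≤-antisym
    (let Y , Y⊆X , iY , le = rank-attained (M / e) X in
      ≤-trans le (ℕ.m+n≤o⇒m≤o∸n (∣ Y ∣) (lin 3 (λ y r z → lit 1 ⊕ y ⩽ z ⇒ r ⩽ lit 1 ⇒ ⊢ y ⊕ r ⩽ z)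
        (∣ Y ∣ ∷ rank M ⁅ e ⁆ ∷ rank M X⁺ ∷ [])
        (≤-trans (≤-reflexive (sym (insertAt-size Y e inside)))
          (∣∣≤rank M (insertAt-⊆ e inside Y⊆X) (subst (λ d → Indep M (insertAt Y e (does d))) eq iY)))
        (rk-⁅⁆ ρ e))))
    (let J , e⊆J , J⊆ , iJ , le = extend M (rank M X⁺) {⁅ e ⁆} (∈⇒⁅⁆⊆ (∈-insertAt X e)) i (ℕ.m≤m+n _ _)
         ∣J∣ , ≤rank = bound {J} {inside} (λ {Y} → subst (λ d → Indep M (insertAt Y e (does d))) (sym eq))
                                 J⊆ iJ (Vec.[]=⇒lookup (e⊆J (x∈⁅x⁆ e)))
     in ℕ.m≤n+o⇒m∸n≤o _ (rank M ⁅ e ⁆) (≤-trans le (≤-trans (≤-reflexive ∣J∣)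
       (+-mono-≤ (≤-trans (≤-reflexive (sym (∣⁅x⁆∣≡1 e))) (∣∣≤rank M id i)) ≤rank))))
  go (no ¬i) eq = ≤-antisym
    (let Y , Y⊆X , iY , le = rank-attained (M / e) X in
      ≤-trans le (ℕ.m+n≤o⇒m≤o∸n (∣ Y ∣) (lin 3 (λ y r z → y ⩽ z ⇒ r ⩽ lit 0 ⇒ ⊢ y ⊕ r ⩽ z)
        (∣ Y ∣ ∷ rank M ⁅ e ⁆ ∷ rank M X⁺ ∷ [])
        (≤-trans (≤-reflexive (sym (insertAt-size Y e outside)))
          (∣∣≤rank M (λ p → insertAt-inside X e outside (insertAt-⊆ e outside Y⊆X p))
            (subst (λ d → Indep M (insertAt Y e (does d))) eq iY)))
        loop)))
    (let J , J⊆ , iJ , le = rank-attained M X⁺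
         ∣J∣ , ≤rank = bound {J} {outside} (λ {Y} → subst (λ d → Indep M (insertAt Y e (does d))) (sym eq))
                                 J⊆ iJ (e∉J iJ)
     in ℕ.m≤n+o⇒m∸n≤o _ (rank M ⁅ e ⁆) (≤-trans le (≤-trans (≤-reflexive ∣J∣)
       (≤-trans ≤rank (ℕ.m≤n+m _ _)))))
    where
    loop : rank M ⁅ e ⁆ ≤ 0
    loop = ℕ.≤-pred (≤-trans (≰⇒> (¬i ∘ free⇒indep M)) (≤-reflexive (∣⁅x⁆∣≡1 e)))
    e∉J : ∀ {J} → Indep M J → lookup J e ≡ outside
    e∉J {J} iJ with lookup J e in eq
    ... | outside = refl
    ... | inside  = contradiction (⊆-indep M (∈⇒⁅⁆⊆ (Vec.lookup⇒[]= e J eq)) iJ) ¬i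

represents-/ : ∀ (M : Matroid (suc n)) e → Represents (punchIn e)
               (rankFunction (M / e)) (contract ⁅ e ⁆ (rankFunction M)) (⊤ ─ ⁅ e ⁆)
represents-/ M e {Z} _ = sym (trans (rank-/ M e (preimage (punchIn e) Z))
  (cong (λ X → rank M X ∸ rank M ⁅ e ⁆) (insertAt-preimage e Z)))

inImage-/ : ∀ (e : Fin (suc n)) → InImage (punchIn e) (⊤ ─ ⁅ e ⁆)
inImage-/ e {j} p = punchOut e≢j , Fin.punchIn-punchOut e≢j
  where
  e≢j : e ≢ j
  e≢j refl = x∈p─q⇒x∉q ⊤ ⁅ e ⁆ p (x∈⁅x⁆ e)

preimage-punchIn : ∀ (e : Fin (suc n)) → preimage (punchIn e) (⊤ ─ ⁅ e ⁆) ≡ ⊤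
preimage-punchIn e = ⊆-antisym ⊆⊤ λ {i} _ → ∈-preimage⁺ (punchIn e)
  (x∈p∧x∉q⇒x∈p─q ∈⊤ λ p → Fin.punchInᵢ≢i e i (x∈⁅y⁆⇒x≡y e p))

module _ (φ : Fin n → Fin m) (inj : Injective _≡_ _≡_ φ) {ρ : RankFunction n} {σ : RankFunction m} {S : Subset m}
         (im : InImage φ S) (rep : Represents φ ρ σ S) where

  inseparable-image : Inseparable ρ (preimage φ S) → Inseparable σ S
  inseparable-image insep A sep = [ inj₁ ∘ (λ e → pull e (preimage-∩ φ S A) (p∩q⊆p S A))
                                  , inj₂ ∘ (λ e → pull e (preimage-─ φ S A) (p─q⊆p S A)) ]′
    (insep (preimage φ A) (separates-preimage φ {ρ = ρ} {σ} rep sep))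
    where
    pull : ∀ {X Y} → Empty Y → preimage φ X ≡ Y → X ⊆ S → Empty X
    pull e eq X⊆S (j , j∈) with im (X⊆S j∈)
    ... | i , refl = e (i , subst (i ∈_) eq (∈-preimage⁺ φ j∈))

  inseparable-preimage : Inseparable σ S → Inseparable ρ (preimage φ S)
  inseparable-preimage insep A sep = [ inj₁ ∘ (λ e (i , i∈) → e (φ i , x∈p∩q⁺
        (∈-preimage⁻ φ (p∩q⊆p _ A i∈) , ∈-image⁺ φ (p∩q⊆q (preimage φ S) A i∈))))
    , inj₂ ∘ (λ e (i , i∈) → e (φ i , x∈p∧x∉q⇒x∈p─q (∈-preimage⁻ φ (p─q⊆p _ A i∈))
        (λ p → x∈p─q⇒x∉q (preimage φ S) A i∈ (∈-image⁻′ φ inj p)))) ]′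
    (insep (imageˢ φ A) (separates-image φ inj {ρ = ρ} {σ} rep sep))

module _ (M : Matroid n) where

  private
    ρ = rankFunction M

  connected-∣⇒inseparable : ∀ S → Connected (M ∣ S) → Inseparable ρ S
  connected-∣⇒inseparable S conn = inseparable-image (element S) (element-injective S)
    {rankFunction (M ∣ S)} {rankFunction M} (inImage-∣ S) (represents-∣ M S)
    (subst (Inseparable (rankFunction (M ∣ S))) (sym (preimage-element S)) (connected⇒inseparable (M ∣ S) conn))

  inseparable⇒connected-∣ : ∀ S → Inseparable ρ S → Connected (M ∣ S)
  inseparable⇒connected-∣ S insep = inseparable⇒connected (M ∣ S)
    (subst (Inseparable (rankFunction (M ∣ S))) (preimage-element S)
      (inseparable-preimage (element S) (element-injective S) {rankFunction (M ∣ S)} {rankFunction M} (inImage-∣ S) (represents-∣ M S) insep))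

  cd≤-∣⁺ : ∀ S → Cd≤ (rankFunction (M ∣ S)) ⊤ k → Cd≤ ρ S k
  cd≤-∣⁺ S = cd≤-image (element S) (element-injective S) (sym (preimage-element S)) (inImage-∣ S) (represents-∣ M S)

  cd≤-∣⁻ : ∀ S → Cd≤ ρ S k → Cd≤ (rankFunction (M ∣ S)) ⊤ k
  cd≤-∣⁻ S c = subst (λ T → Cd≤ (rankFunction (M ∣ S)) T _) (preimage-element S)
    (cd≤-preimage (element S) (element-injective S) (inImage-∣ S) (represents-∣ M S) c)

-- Components and the recursion of contraction-depth

Separates-within : ∀ (ρ : RankFunction n) {R S A} → S ⊆ R → Separates ρ R S → Separates ρ S A →
                   Separates ρ R (S ∩ A) × Separates ρ R (S ─ A)
Separates-within ρ {R} {S} {A} S⊆R sepR sepS = outer (S ∩ A) (≤-trans (+-monoʳ-≤ _ (rk-mono ρ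
    (set 2 (λ S A → ⊢ S ∖ (S ⊓ A) ⋐ S ∖ A) (S ∷ A ∷ [])))) sepS)
  , outer (S ─ A) (≤-trans (+-monoʳ-≤ _ (rk-mono ρ
    (set 2 (λ S A → ⊢ S ∖ (S ∖ A) ⋐ S ⊓ A) (S ∷ A ∷ []))))
    (≤-trans (≤-reflexive (+-comm (rk ρ (S ─ A)) _)) sepS))
  where
  outer : ∀ Z → rk ρ Z + rk ρ (S ─ Z) ≤ rk ρ S → Separates ρ R Z
  outer Z sep = lin 7 (λ s t r z w u v → s ⊕ t ⩽ r ⇒ z ⊕ w ⩽ s ⇒ u ⩽ w ⊕ t ⇒ v ⩽ z ⇒ ⊢ v ⊕ u ⩽ r)
    (rk ρ S ∷ rk ρ (R ─ S) ∷ rk ρ R ∷ rk ρ Z ∷ rk ρ (S ─ Z) ∷ rk ρ (R ─ Z) ∷ rk ρ (R ∩ Z) ∷ [])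
    (≤-trans (+-monoˡ-≤ _ (rk-mono ρ (set 2 (λ S R → S ⋐ R ⇒ ⊢ S ⋐ R ⊓ S) (S ∷ R ∷ []) S⊆R))) sepR) sep
    (subadditive ρ (set 3 (λ S R Z → ⊢ R ∖ Z ⋐ (S ∖ Z) ⊔ (R ∖ S)) (S ∷ R ∷ Z ∷ [])))
    (rk-mono ρ (p∩q⊆q R Z))

∩-smaller : ∀ (S A : Subset n) → Nonempty (S ─ A) → ∣ S ∩ A ∣ < ∣ S ∣
∩-smaller S A (y , y∈) = p⊂q⇒∣p∣<∣q∣ (p∩q⊆p S A , y , p─q⊆p S A y∈ , λ y∈∩ → x∈p─q⇒x∉q S A y∈ (p∩q⊆q S A y∈∩))

─-smaller : ∀ (S A : Subset n) → Nonempty (S ∩ A) → ∣ S ─ A ∣ < ∣ S ∣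
─-smaller S A = p∩q≢∅⇒∣p─q∣<∣p∣ S A

-- The list stores the proof found by `P?`, which may differ from the given one; hence the
-- existential.
∈-decided : ∀ {A : Set} {P : A → Set} (P? : ∀ a → Dec (P a)) {a xs} → a ∈ₗ xs → P a →
            ∃[ p ] (a , p) ∈ₗ mapMaybe (λ a → Maybe.map (a ,_) (dec⇒maybe (P? a))) xs
∈-decided P? {a} (here refl) p with P? a
... | yes p′ = p′ , here refl
... | no ¬p  = contradiction p ¬p
∈-decided P? {xs = x ∷ xs} (there a∈) p with ∈-decided P? a∈ p | P? x
... | p′ , q | yes _ = p′ , there q
... | p′ , q | no _  = p′ , q

separates-whole : ∀ (ρ : RankFunction n) → Separates ρ S S
separates-whole {S = S} ρ = ≤-trans (+-mono-≤ {v = 0} (rk-mono ρ (p∩q⊆p S S))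
  (≤-reflexive (rk-⊆⊥ ρ (set 1 (λ S → ⊢ S ∖ S ⋐ ∅) (S ∷ []))))) (≤-reflexive (+-identityʳ _))

-- A direct summand S around C is shrunk: as long as S splits, C lies on one side, being
-- inseparable, and that side is again a summand. When S is inseparable, maximality gives `S ≡ C`.
maximal⇒separates : ∀ (ρ : RankFunction n) {C} → Inseparable ρ C → (∀ S → C ⊂ S → ¬ Inseparable ρ S) →
                    ∀ S → Acc _<_ (∣ S ∣) → C ⊆ S → Separates ρ ⊤ S → Separates ρ ⊤ C
maximal⇒separates ρ {C} insep maximal S (acc rs) C⊆S sep with inseparable? ρ S
... | inj₁ insepS with Fin.any? (λ x → (x ∈? S) ×-dec ¬? (x ∈? C))
... | yes (x , x∈S , x∉C) = contradiction insepS (maximal S (C⊆S , x , x∈S , x∉C))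
... | no none = subst (Separates ρ ⊤)
  (⊆-antisym (λ {x} x∈S → decidable-stable (x ∈? C) λ x∉C → none (x , x∈S , x∉C)) C⊆S) sep
maximal⇒separates ρ {C} insep maximal S (acc rs) C⊆S sep | inj₂ (A , sepA , ne , ne′) =
  [ (λ empty → maximal⇒separates ρ insep maximal (S ─ A) (rs (─-smaller S A ne))
      (set 3 (λ C S A → C ⋐ S ⇒ C ⊓ A ⋐ ∅ ⇒ ⊢ C ⋐ S ∖ A) (C ∷ S ∷ A ∷ []) C⊆S (Empty⇒⊆⊥ empty))
      (proj₂ (Separates-within ρ {⊤} {S} {A} ⊆⊤ sep sepA)))
  , (λ empty → maximal⇒separates ρ insep maximal (S ∩ A) (rs (∩-smaller S A ne′))
      (set 3 (λ C S A → C ⋐ S ⇒ C ∖ A ⋐ ∅ ⇒ ⊢ C ⋐ S ⊓ A) (C ∷ S ∷ A ∷ []) C⊆S (Empty⇒⊆⊥ empty))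
      (proj₁ (Separates-within ρ {⊤} {S} {A} ⊆⊤ sep sepA))) ]′
  (insep A (Separates-⊆ ρ sepA C⊆S))

summands⇒cd≤ : ∀ (ρ : RankFunction n) {k} →
  (∀ {S} → Nonempty S → Separates ρ ⊤ S → Inseparable ρ S → Cd≤ ρ S k) →
  ∀ S → Acc _<_ (∣ S ∣) → Nonempty S → Separates ρ ⊤ S → Cd≤ ρ S k
summands⇒cd≤ ρ summand S (acc rs) ne sep with inseparable? ρ S
... | inj₁ insep = summand ne sep insep
... | inj₂ (A , sepA , ne∩ , ne─) = sum A sepA
  (summands⇒cd≤ ρ summand (S ∩ A) (rs (∩-smaller S A ne─)) ne∩ (proj₁ (Separates-within ρ {⊤} {S} {A} ⊆⊤ sep sepA)))
  (summands⇒cd≤ ρ summand (S ─ A) (rs (─-smaller S A ne∩)) ne─ (proj₂ (Separates-within ρ {⊤} {S} {A} ⊆⊤ sep sepA)))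

module _ (M : Matroid n) where

  private
    ρ = rankFunction M

  component⇒separates : ∀ {C} → Component M C → Separates ρ ⊤ C
  component⇒separates {C} (_ , conn , maximal) = maximal⇒separates ρ (connected-∣⇒inseparable M C conn)
    (λ S C⊂S insep → maximal S C⊂S (inseparable⇒connected-∣ M S insep)) ⊤ (<-wellFounded _) ⊆⊤ (separates-whole ρ)

  inseparable⇒component : ∀ {S} → Nonempty S → Separates ρ ⊤ S → Inseparable ρ S → Component M S
  inseparable⇒component {S} (x , x∈S) sep insep = (x , x∈S) , inseparable⇒connected-∣ M S insep ,
    λ S′ (S⊆S′ , y , y∈S′ , y∉S) conn → [ (λ e → e (x , x∈p∩q⁺ (S⊆S′ x∈S , x∈S)))
      , (λ e → e (y , x∈p∧x∉q⇒x∈p─q y∈S′ y∉S)) ]′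
      (connected-∣⇒inseparable M S′ conn S (Separates-⊆ ρ sep ⊆⊤))

  ∈-components : ∀ {S} → Component M S → ∃[ c ] (S , c) ∈ₗ components M
  ∈-components {S} = ∈-decided (component? M) (∈-subsets S)

min-attained : ∀ {A : Set} (f : A → ℕ) x xs → ∃[ y ] min (f x) (map f xs) ≡ f y
min-attained f x xs with argmin-sel id (f x) (map f xs)
... | inj₁ eq = x , eq
... | inj₂ m∈ with ∈ₗ.∈-map⁻ f m∈
... | y , _ , eq = y , eq

-- Sums with an empty summand are skipped.
inseparable⇒contraction : ∀ (ρ : RankFunction n) {S T k x y} → T ≡ S → Inseparable ρ S → x ∈ S → y ∈ S → x ≢ y →
  Cd≤ ρ T k → ∃[ p ] ∃[ j ] p ∈ S × k ≡ suc j × Cd≤ (contract ⁅ p ⁆ ρ) (S ─ ⁅ p ⁆) j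
inseparable⇒contraction ρ refl insep x∈ y∈ x≢y (point sub)         = contradiction (sub x∈ y∈) x≢y
inseparable⇒contraction ρ refl insep x∈ y∈ x≢y (contraction p∈S c) = _ , _ , p∈S , refl , c
inseparable⇒contraction ρ {S} refl insep x∈ y∈ x≢y (sum A sep c d) with insep A sep
... | inj₁ empty = inseparable⇒contraction ρ
  (⊆-antisym (p─q⊆p S A) (set 2 (λ S A → S ⊓ A ⋐ ∅ ⇒ ⊢ S ⋐ S ∖ A) (S ∷ A ∷ []) (Empty⇒⊆⊥ empty)))
  insep x∈ y∈ x≢y d
... | inj₂ empty = inseparable⇒contraction ρ
  (⊆-antisym (p∩q⊆p S A) (set 2 (λ S A → S ∖ A ⋐ ∅ ⇒ ⊢ S ⋐ S ⊓ A) (S ∷ A ∷ []) (Empty⇒⊆⊥ empty)))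
  insep x∈ y∈ x≢y c

module _ {n} (rs : ∀ {m} → m < suc (suc n) → Acc _<_ m) (M : Matroid (suc (suc n))) where

  contracted : Fin (suc (suc n)) → ℕ
  contracted e = cdAcc (rs (ℕ.n<1+n (suc n))) (M / e)

  restricted : ¬ Connected M → ∃ (Component M) → ℕ
  restricted ¬conn (S , comp) = cdAcc (rs (component-< M ¬conn comp)) (M ∣ S)

  -- A copy of the body of `cdAcc`, whose local functions cannot be named from outside; proofs can
  -- then distinguish cases on the decision alone.
  value : Dec (Connected M) → ℕ
  value (yes _)    = suc (min (contracted zero) (map contracted (allFin (suc (suc n)))))
  value (no ¬conn) = max 0 (map (restricted ¬conn) (components M))

  cdAcc-value : cdAcc (acc rs) M ≡ value (connected? M)
  cdAcc-value with connected? M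
  ... | yes _ = refl
  ... | no _  = refl

cd-complete : ∀ {n} (rec : Acc _<_ n) (M : Matroid n) → 1 ≤ n → Cd≤ (rankFunction M) ⊤ (cdAcc rec M)
cd-complete {suc zero} _ M _ = point λ { {zero} {zero} _ _ → refl }
cd-complete {suc (suc n)} (acc rs) M _ = subst (Cd≤ ρ ⊤) (sym (cdAcc-value rs M)) (go (connected? M))
  where
  ρ = rankFunction M

  attained : ∀ {c} → ∃[ e ] c ≡ contracted rs M e → Cd≤ ρ ⊤ (suc c)
  attained (e , refl) = contraction {p = e} ∈⊤ (cd≤-image (punchIn e) (Fin.punchIn-injective e _ _)
    {ρ = rankFunction (M / e)} (sym (preimage-punchIn e)) (inImage-/ e) (represents-/ M e)
    (cd-complete (rs (ℕ.n<1+n (suc n))) (M / e) (s≤s z≤n)))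

  component : ∀ ¬conn {S} → Nonempty S → Component M S → Cd≤ ρ S (value rs M (no ¬conn))
  component ¬conn {S} (x , x∈S) comp = bound (∈-components M comp)
    where
    bound : ∃[ c ] (S , c) ∈ₗ components M → Cd≤ ρ S (value rs M (no ¬conn))
    bound (c , c∈) = Cd≤-mono
      (v≤max⁺ 0 (map (restricted rs M ¬conn) (components M)) (inj₂ (lose (∈ₗ.∈-map⁺ (restricted rs M ¬conn) c∈) ≤-refl)))
      (cd≤-∣⁺ M S (cd-complete (rs (component-< M ¬conn c)) (M ∣ S)
        (≤-trans (≤-reflexive (sym (∣⁅x⁆∣≡1 x))) (p⊆q⇒∣p∣≤∣q∣ (∈⇒⁅⁆⊆ x∈S)))))

  go : ∀ d → Cd≤ ρ ⊤ (value rs M d)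
  go (yes _)    = attained (min-attained (contracted rs M) zero (allFin (suc (suc n))))
  go (no ¬conn) = summands⇒cd≤ ρ
    (λ ne sep insep → component ¬conn ne (inseparable⇒component M ne sep insep))
    ⊤ (<-wellFounded _) (zero , ∈⊤) (separates-whole ρ)

-- If M is connected, a derivation can only start with a contraction, up to sums with an empty part,
-- and `cd` minimises over these. If not, the derivation restricts to every component, as components
-- are direct summands.
cd-sound : ∀ {n k} (rec : Acc _<_ n) (M : Matroid n) → Cd≤ (rankFunction M) ⊤ k → cdAcc rec M ≤ k
cd-sound {zero} _ M _ = z≤n
cd-sound {suc zero} _ M c = Cd≤-positive c
cd-sound {suc (suc n)} {k} (acc rs) M c = subst (_≤ k) (sym (cdAcc-value rs M)) (go (connected? M))
  where
  ρ = rankFunction M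

  contractible : ∃[ p ] ∃[ j ] p ∈ ⊤ × k ≡ suc j × Cd≤ (contract ⁅ p ⁆ ρ) (⊤ ─ ⁅ p ⁆) j →
                 suc (min (contracted rs M zero) (map (contracted rs M) (allFin (suc (suc n))))) ≤ k
  contractible (p , j , _ , refl , c′) = s≤s (min≤v⁺ (contracted rs M zero) (map (contracted rs M) (allFin (suc (suc n))))
    (inj₂ (lose (∈ₗ.∈-map⁺ (contracted rs M) (∈ₗ.∈-allFin p)) (cd-sound (rs (ℕ.n<1+n (suc n))) (M / p)
      (subst (λ T → Cd≤ (rankFunction (M / p)) T j) (preimage-punchIn p)
        (cd≤-preimage (punchIn p) (Fin.punchIn-injective p _ _) (inImage-/ p) (represents-/ M p) c′))))))

  component : ∀ {S} → Component M S → Cd≤ ρ S k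
  component {S} comp = subst (λ T → Cd≤ ρ T k) (⊆-antisym (p∩q⊆q ⊤ S) λ x∈S → x∈p∩q⁺ (∈⊤ , x∈S))
    (Cd≤-∩ (component⇒separates M comp) c)

  go : ∀ d → value rs M d ≤ k
  go (yes conn) = contractible (inseparable⇒contraction ρ refl (connected⇒inseparable M conn)
    (∈⊤ {x = zero}) (∈⊤ {x = suc zero}) (λ ()) c)
  go (no ¬conn) = max≤v⁺ {xs = map (restricted rs M ¬conn) (components M)} z≤n
    (All.map⁺ (All.tabulate λ {(S , comp)} _ → cd-sound (rs (component-< M ¬conn comp)) (M ∣ S) (cd≤-∣⁻ M S (component comp))))

-- Isomorphic restrictions, and matroids given by rank functions

∣preimage∣ : ∀ (φ : Fin n → Fin m) (inj : Injective _≡_ _≡_ φ) → InImage φ Z → ∣ preimage φ Z ∣ ≡ ∣ Z ∣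
-- Both inequalities are instances of `rk≤∣∣`, for the cardinality transported along φ in either
-- direction.
∣preimage∣ {Z = Z} φ inj im = ≤-antisym (rk≤∣∣ (pushforward φ inj (cardinality _)) Z)
  (≤-trans (p⊆q⇒∣p∣≤∣q∣ Z⊆) (rk≤∣∣ (pullback φ inj (cardinality _)) (preimage φ Z)))
  where
  Z⊆ : Z ⊆ imageˢ φ (preimage φ Z)
  Z⊆ j∈Z with im j∈Z
  ... | i , refl = ∈-image⁺ φ (∈-preimage⁺ φ j∈Z)

image-preimage : ∀ (φ : Fin n → Fin m) (inj : Injective _≡_ _≡_ φ) → InImage φ Z → imageˢ φ (preimage φ Z) ≡ Z
image-preimage φ inj im = ⊆-antisym
  (λ p → let i , i∈ , eq = ∈-image⁻ φ p in subst (_∈ _) eq (∈-preimage⁻ φ i∈))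
  (λ {j} j∈Z → let i , eq = im j∈Z in subst (_∈ imageˢ φ _) eq (∈-image⁺ φ (∈-preimage⁺ φ (subst (_∈ _) (sym eq) j∈Z))))

module _ (φ : Fin n → Fin m) (inj : Injective _≡_ _≡_ φ) where

  cd*≤-preimage : ∀ {ρ σ d} → InImage φ S → Represents φ ρ σ S → Cd*≤ σ S d → Cd*≤ ρ (preimage φ S) d
  cd*≤-preimage im rep (flat z) = flat (trans (sym (rep id)) z)
  cd*≤-preimage {S = S} {ρ = ρ} {σ} im rep (split A sep k l) = split (preimage φ A)
    (separates-preimage φ {ρ = ρ} {σ} rep sep)
    (subst (λ T → Cd*≤ ρ T _) (preimage-∩ φ S A)
      (cd*≤-preimage (im ∘ p∩q⊆p S _) (λ {Z} Z⊆ → rep (⊆-trans {_} {Z} Z⊆ (p∩q⊆p S _))) k))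
    (subst (λ T → Cd*≤ ρ T _) (preimage-─ φ S A)
      (cd*≤-preimage (im ∘ p─q⊆p S _) (λ {Z} Z⊆ → rep (⊆-trans {_} {Z} Z⊆ (p─q⊆p S _))) l))
  cd*≤-preimage {S = S} {ρ = ρ} {σ} im rep (quotient τ q σ≤τ k) = quotient (pullback φ inj τ)
    (λ {X} {Y} X⊆Y Y⊆ → subst₂ _≤_ (cong (rk τ (imageˢ φ Y) +_) (rk-image (⊆-trans {_} {X} X⊆Y Y⊆)))
      (cong (rk τ (imageˢ φ X) +_) (rk-image Y⊆)) (q (image-mono X⊆Y) (image⊆S Y⊆)))
    (subst₂ (λ a b → a ≤ suc b) (rep id) (cong (rk τ) (sym (image-preimage φ inj im))) σ≤τ)
    (cd*≤-preimage im (λ {Z} Z⊆S → cong (rk τ) (sym (image-preimage φ inj (im ∘ Z⊆S)))) k)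
    where
    image-mono : ∀ {X Y} → X ⊆ Y → imageˢ φ X ⊆ imageˢ φ Y
    image-mono X⊆Y p = let i , i∈ , eq = ∈-image⁻ φ p in subst (_∈ _) eq (∈-image⁺ φ (X⊆Y i∈))
    image⊆S : ∀ {X} → X ⊆ preimage φ S → imageˢ φ X ⊆ S
    image⊆S X⊆ p = let i , i∈ , eq = ∈-image⁻ φ p in subst (_∈ S) eq (∈-preimage⁻ φ (X⊆ i∈))
    rk-image : ∀ {X} → X ⊆ preimage φ S → rk σ (imageˢ φ X) ≡ rk ρ X
    rk-image {X} X⊆ = trans (rep (image⊆S X⊆)) (cong (rk ρ) (preimage-image φ inj X))

preimage-∘ : ∀ {o} (ψ : Fin m → Fin o) (φ : Fin n → Fin m) Z → preimage (ψ ∘ φ) Z ≡ preimage φ (preimage ψ Z)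
preimage-∘ ψ φ Z = ⊆-antisym (∈-preimage⁺ φ {preimage ψ Z} ∘ ∈-preimage⁺ ψ {Z} ∘ ∈-preimage⁻ (ψ ∘ φ))
  (∈-preimage⁺ (ψ ∘ φ) {Z} ∘ ∈-preimage⁻ ψ ∘ ∈-preimage⁻ φ)

rank-≅ : ∀ (M : Matroid n) (N : Matroid m) (iso : M ≅ N) Y → rank N Y ≡ rank M (preimage (Bijection.to (proj₁ iso)) Y)
rank-≅ M N (β , indep⇔) Y = ≤-antisym
  (let Z , Z⊆ , i , le = rank-attained N Y in
    ≤-trans le (≤-trans (≤-reflexive (sym (∣preimage∣ {Z = Z} β.to β.injective (λ {j} _ → onto j))))
      (∣∣≤rank M (∈-preimage⁺ β.to ∘ Z⊆ ∘ ∈-preimage⁻ β.to) (Equivalence.from (indep⇔ Z) i))))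
  (let X , X⊆ , i , le = rank-attained M (preimage β.to Y)
       X′ = imageˢ β.to X
       eq = preimage-image β.to β.injective X
   in ≤-trans le (≤-trans (≤-reflexive (trans (cong ∣_∣ (sym eq)) (∣preimage∣ {Z = X′} β.to β.injective (λ {j} _ → onto j))))
     (∣∣≤rank N {Y = X′} (λ p → let i , i∈ , e = ∈-image⁻ β.to p in subst (_∈ Y) e (∈-preimage⁻ β.to (X⊆ i∈)))
       (Equivalence.to (indep⇔ X′) (subst (Indep M) (sym eq) i)))))
  where
  module β = Bijection β
  onto : ∀ j → ∃[ i ] β.to i ≡ j
  onto j = let i , eq = β.surjective j in i , eq refl

module Restriction {M : Matroid n} {M′ : Matroid m} (S : Subset m) (iso : M ≅ M′ ∣ S) where

  private
    module β = Bijection (proj₁ iso)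

  inclusion : Fin n → Fin m
  inclusion = element S ∘ β.to

  inclusion-injective : Injective _≡_ _≡_ inclusion
  inclusion-injective = β.injective ∘ element-injective S

  inImage : InImage inclusion S
  inImage {j} j∈S = let i , eq = β.surjective (index S j∈S) in
    i , trans (cong (element S) (eq refl)) (element-index S j∈S)

  preimage-S : preimage inclusion S ≡ ⊤
  preimage-S = ⊆-antisym ⊆⊤ λ {i} _ → ∈-preimage⁺ inclusion (element-∈ S (β.to i))

  represents : Represents inclusion (rankFunction M) (rankFunction M′) S
  represents {Z} Z⊆S = trans (represents-∣ M′ S Z⊆S) (trans (rank-≅ M (M′ ∣ S) iso (preimage (element S) Z))
    (cong (rank M) (sym (preimage-∘ (element S) β.to Z))))

matroid : RankFunction n → Matroid n
matroid {n} ρ = record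
  { Indep   = Free ρ
  ; indep?  = λ X → ∣ X ∣ ℕ.≤? rk ρ X
  ; ⊥-indep = ≤-trans (≤-reflexive (∣⊥∣≡0 n)) z≤n
  ; ⊆-indep = free-⊆ ρ
  ; augment = λ {X} {Y} → augmentation X Y
  }
  where
  augmentation : ∀ X Y → Free ρ X → Free ρ Y → ∣ X ∣ < ∣ Y ∣ → ∃[ y ] y ∈ Y × y ∉ X × Free ρ (X ∪ ⁅ y ⁆)
  augmentation X Y freeX freeY lt with Fin.any? (λ y → (y ∈? Y) ×-dec ¬? (y ∈? X) ×-dec (∣ X ∪ ⁅ y ⁆ ∣ ℕ.≤? rk ρ (X ∪ ⁅ y ⁆)))
  ... | yes found = found
  -- If no element of Y can be added, Y lies in the closure of X and its rank is at most the size of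
  -- X.
  ... | no none = contradiction (≤-trans (≤-trans freeY (rk-mono ρ (q⊆p∪q X Y)))
    (≤-trans (rk-closure ρ stuck) (rk≤∣∣ ρ X))) (ℕ.<⇒≱ lt)
    where
    stuck : ∀ {y} → y ∈ Y → rk ρ (X ∪ ⁅ y ⁆) ≤ rk ρ X
    stuck {y} y∈Y with y ∈? X
    ... | yes y∈X = rk-mono ρ (set 2 (λ X P → P ⋐ X ⇒ ⊢ X ⊔ P ⋐ X) (X ∷ ⁅ y ⁆ ∷ []) (∈⇒⁅⁆⊆ y∈X))
    ... | no  y∉X = ≮⇒≥ λ grows → none (y , y∈Y , y∉X , ≤-trans
      (rk-∪⁅⁆ (cardinality _) X y) (≤-trans (s≤s freeX) grows))

rank-matroid : ∀ (ρ : RankFunction n) X → rank (matroid ρ) X ≡ rk ρ X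
rank-matroid ρ X = ≤-antisym
  (let Y , Y⊆X , free , le = rank-attained (matroid ρ) X in ≤-trans le (≤-trans free (rk-mono ρ Y⊆X)))
  (let Y , Y⊆X , free , le = spanning X in ≤-trans le (∣∣≤rank (matroid ρ) Y⊆X free))
  where
  spanning : ∀ X → ∃[ Y ] Y ⊆ X × Free ρ Y × rk ρ X ≤ ∣ Y ∣
  spanning = subset-induction _ (⊥ , id , ⊥-indep (matroid ρ) , rk≤∣∣ ρ ⊥) λ {X} {x} x∉X (Y , Y⊆X , free , le) →
    grow X x x∉X Y Y⊆X free le (rk ρ (X ∪ ⁅ x ⁆) ℕ.≤? rk ρ X)
    where
    grow : ∀ X x → x ∉ X → ∀ Y → Y ⊆ X → Free ρ Y → rk ρ X ≤ ∣ Y ∣ → Dec (rk ρ (X ∪ ⁅ x ⁆) ≤ rk ρ X) →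
           ∃[ Y ] Y ⊆ X ∪ ⁅ x ⁆ × Free ρ Y × rk ρ (X ∪ ⁅ x ⁆) ≤ ∣ Y ∣
    grow X x x∉X Y Y⊆X free le (yes same) = Y , p⊆p∪q _ ∘ Y⊆X , free , ≤-trans same le
    -- The rank grows when x joins X; by submodularity it grows as well when x joins the smaller set
    -- Y, which therefore remains free.
    grow X x x∉X Y Y⊆X free le (no more) = Y ∪ ⁅ x ⁆ ,
      set 3 (λ X Y P → Y ⋐ X ⇒ ⊢ Y ⊔ P ⋐ X ⊔ P) (X ∷ Y ∷ ⁅ x ⁆ ∷ []) Y⊆X ,
      lin 6 (λ yx y r rx ryx ry → yx ⩽ lit 1 ⊕ y ⇒ y ⩽ ry ⇒ lit 1 ⊕ r ⩽ rx ⇒ rx ⊕ ry ⩽ r ⊕ ryx ⇒ ⊢ yx ⩽ ryx)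
        (∣ Y ∪ ⁅ x ⁆ ∣ ∷ ∣ Y ∣ ∷ rk ρ X ∷ rk ρ (X ∪ ⁅ x ⁆) ∷ rk ρ (Y ∪ ⁅ x ⁆) ∷ rk ρ Y ∷ [])
        (rk-∪⁅⁆ (cardinality _) Y x) free (≰⇒> more)
        (submodular ρ {C = X ∪ ⁅ x ⁆} {X} {Y ∪ ⁅ x ⁆} {Y}
          (set 3 (λ X Y P → ⊢ X ⊔ P ⋐ X ⊔ (Y ⊔ P)) (X ∷ Y ∷ ⁅ x ⁆ ∷ []))
          (set 3 (λ X Y P → Y ⋐ X ⇒ ⊢ Y ⋐ X ⊓ (Y ⊔ P)) (X ∷ Y ∷ ⁅ x ⁆ ∷ []) Y⊆X)) ,
      ≤-trans (rk-∪⁅⁆ ρ X x) (≤-trans (s≤s le) (≤-trans (≤-reflexive (trans (+-comm 1 ∣ Y ∣)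
        (cong (∣ Y ∣ +_) (sym (∣⁅x⁆∣≡1 x))))) (∣∣-disjoint id
          (set 3 (λ X Y P → Y ⋐ X ⇒ P ⊓ X ⋐ ∅ ⇒ ⊢ Y ⊓ P ⋐ ∅) (X ∷ Y ∷ ⁅ x ⁆ ∷ []) Y⊆X (∉⇒⁅⁆∩⊆⊥ x∉X)))))

module _ (M : Matroid n) {k} (E : Extension (rankFunction M) ⊤ k) where

  private
    M′ = matroid (extended E)
    I  = imageˢ (old E) ⊤

    to : Fin n → Fin ∣ I ∣
    to x = index I (∈-image⁺ (old E) {⊤} {x} ∈⊤)

    element-to : ∀ x → element I (to x) ≡ (old E) x
    element-to x = element-index I (∈-image⁺ (old E) {⊤} {x} ∈⊤)

    to-injective : Injective _≡_ _≡_ to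
    to-injective {x} {y} eq = injective E (trans (sym (element-to x)) (trans (cong (element I) eq) (element-to y)))

    to-onto : ∀ j → ∃[ x ] to x ≡ j
    to-onto j = let x , _ , eq = ∈-image⁻ (old E) (element-∈ I j) in
      x , element-injective I (trans (element-to x) eq)

    preimage-to : ∀ Y → preimage (old E) (embed I Y) ≡ preimage to Y
    preimage-to Y = ⊆-antisym
      (λ {x} p → ∈-preimage⁺ to (subst (_ ∈_) (preimage-embed I Y)
        (∈-preimage⁺ (element I) (subst (_∈ embed I Y) (sym (element-to x)) (∈-preimage⁻ (old E) p)))))
      (λ {x} p → ∈-preimage⁺ (old E) (subst (_∈ embed I Y) (element-to x)
        (∈-preimage⁻ (element I) (subst (to x ∈_) (sym (preimage-embed I Y)) (∈-preimage⁻ to p)))))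

    rk-embed : ∀ Y → rk (extended E) (embed I Y) ≡ rank M (preimage to Y)
    rk-embed Y = trans (cong (rk (extended E)) (trans (cong (embed I) (sym (preimage-embed I Y)))
        (embed-preimage I (embed I Y))))
      (trans (agrees E (embed I Y)) (cong (rank M) (trans (⊆⇒∩≡ ⊆⊤) (preimage-to Y))))

    size≡ : ∀ Y → ∣ embed I Y ∣ ≡ ∣ preimage to Y ∣
    size≡ Y = trans (embed-size I Y) (sym (∣preimage∣ {Z = Y} to to-injective (λ {j} _ → to-onto j)))

  extension-⊒ : M ⊑ M′
  extension-⊒ = I , mk⤖ (to-injective , strictlySurjective⇒surjective to-onto) , λ Y → mk⇔
    (λ i → subst₂ _≤_ (sym (size≡ Y)) (sym (rk-embed Y)) (indep⇒free M i))
    (λ free → free⇒indep M (subst₂ _≤_ (size≡ Y) (rk-embed Y) free))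

  cd-extension : cd M′ ≤ k
  cd-extension = cd-sound (<-wellFounded (size E)) M′ (Cd≤-cong (λ {X} _ → sym (rank-matroid (extended E) X)) (cd≤ E))

-- Loops and coloops in terms of the rank

module _ (M : Matroid n) where

  private
    ρ = rankFunction M

  loop⇒rank : ∀ {x} → Loop M x → rank M ⁅ x ⁆ ≡ 0
  loop⇒rank {x} (dep , _) = ℕ.n<1⇒n≡0 (≤-trans (≰⇒> (dep ∘ free⇒indep M)) (≤-reflexive (∣⁅x⁆∣≡1 x)))

  rank⇒loop : ∀ {x} → rank M ⁅ x ⁆ ≡ 0 → Loop M x
  rank⇒loop {x} z = isCircuit⇒circuit M
    ( subst₂ _<_ (sym z) (sym (∣⁅x⁆∣≡1 x)) (s≤s z≤n)
    , λ {c} c∈ → ≤-trans (p⊆q⇒∣p∣≤∣q∣ (set 2 (λ P C → P ⋐ C ⇒ ⊢ P ∖ C ⋐ ∅) (⁅ x ⁆ ∷ ⁅ c ⁆ ∷ [])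
        (λ y∈ → subst (_∈ ⁅ c ⁆) (trans (x∈⁅y⁆⇒x≡y x c∈) (sym (x∈⁅y⁆⇒x≡y x y∈))) (x∈⁅x⁆ c))))
      (≤-trans (≤-reflexive (∣⊥∣≡0 n)) z≤n))

  onlyLoops⇒rank : OnlyLoops M → rank M ⊤ ≡ 0
  onlyLoops⇒rank loops = ℕ.n≤0⇒n≡0 (≤-trans (rk-mono ρ (q⊆p∪q ⊥ ⊤)) (≤-trans
    (rk-closure ρ λ {y} _ → ≤-trans (rk-mono ρ (set 1 (λ P → ⊢ ∅ ⊔ P ⋐ P) (⁅ y ⁆ ∷ [])))
      (≤-trans (≤-reflexive (loop⇒rank (loops y))) z≤n))
    (≤-reflexive (rk-⊥ ρ))))

  rank⇒onlyLoops : rank M ⊤ ≡ 0 → OnlyLoops M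
  rank⇒onlyLoops z x = rank⇒loop (ℕ.n≤0⇒n≡0 (≤-trans (rk-mono ρ ⊆⊤) (≤-reflexive z)))

  discrete⇒onlyLoopsOrColoops : Discrete ρ ⊤ → OnlyLoopsOrColoops M
  discrete⇒onlyLoopsOrColoops disc x with rank M ⁅ x ⁆ ℕ.≟ 0
  ... | yes z = inj₁ (rank⇒loop z)
  ... | no ≢0 = inj₂ coloop
    where
    coloop : Coloop M x
    -- As a direct summand of rank one, x can be added to every independent set that avoids it, and
    -- a basis admits no addition.
    coloop B (indep , maximal) = decidable-stable (x ∈? B) λ x∉B → maximal (B ∪ ⁅ x ⁆)
      (p⊆p∪q _ , x , x∈p∪q⁺ (inj₂ (x∈⁅x⁆ x)) , x∉B)
      (free⇒indep M (lin 5 (λ b u q s e → u ⩽ lit 1 ⊕ b ⇒ b ⩽ q ⇒ lit 1 ⩽ e ⇒ e ⊕ q ⩽ s ⇒ ⊢ u ⩽ s)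
        (∣ B ∣ ∷ ∣ B ∪ ⁅ x ⁆ ∣ ∷ rank M B ∷ rank M (B ∪ ⁅ x ⁆) ∷ rank M ⁅ x ⁆ ∷ [])
        (rk-∪⁅⁆ (cardinality _) B x) (indep⇒free M indep) (ℕ.n≢0⇒n>0 ≢0)
        (≤-trans (+-mono-≤
          (rk-mono ρ (set 2 (λ B P → ⊢ P ⋐ (B ⊔ P) ⊓ P) (B ∷ ⁅ x ⁆ ∷ [])))
          (rk-mono ρ (set 2 (λ B P → P ⊓ B ⋐ ∅ ⇒ ⊢ B ⋐ (B ⊔ P) ∖ P) (B ∷ ⁅ x ⁆ ∷ []) (∉⇒⁅⁆∩⊆⊥ x∉B))))
          (Separates-⊆ ρ (disc {x} ∈⊤) ⊆⊤))))

  onlyLoopsOrColoops⇒discrete : OnlyLoopsOrColoops M → Discrete ρ ⊤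
  onlyLoopsOrColoops⇒discrete only {x} _ with only x
  ... | inj₁ loop = +-mono-≤ {y = 0}
    (≤-trans (rk-mono ρ (p∩q⊆q ⊤ ⁅ x ⁆)) (≤-reflexive (loop⇒rank loop))) (rk-mono ρ (p─q⊆p ⊤ ⁅ x ⁆))
  ... | inj₂ coloop = ≤-trans (+-monoˡ-≤ _ (≤-trans (rk-mono ρ (p∩q⊆q ⊤ ⁅ x ⁆)) (rk-⁅⁆ ρ x)))
    -- If deleting x kept the rank, a maximal independent set avoiding x would be a basis, contrary
    -- to x being a coloop.
    (≰⇒> λ ≤hyperplane →
      let J , J⊆ , i , le = rank-attained M (⊤ ─ ⁅ x ⁆) in
      x∈p─q⇒x∉q ⊤ ⁅ x ⁆ (J⊆ (coloop J (i , λ Y J⊂Y iY → ℕ.<⇒≱ (p⊂q⇒∣p∣<∣q∣ J⊂Y)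
        (≤-trans (∣∣≤rank M {X = ⊤} ⊆⊤ iY) (≤-trans ≤hyperplane le))))) (x∈⁅x⁆ x))

cd*≤0⇒rank : ∀ {ρ : RankFunction n} {S} → Cd*≤ ρ S 0 → rk ρ S ≡ 0
cd*≤0⇒rank (flat z) = z
cd*≤0⇒rank {ρ = ρ} {S} (split A _ k l) = ℕ.n≤0⇒n≡0 (≤-trans
  (subadditive ρ {A = S ∩ A} {S ─ A} (⊆∩∪─ S A))
  (≤-reflexive (cong₂ _+_ (cd*≤0⇒rank k) (cd*≤0⇒rank l))))

-- The equality of the two minima, and the exceptional case

positive : .{{NonZero n}} → 1 ≤ n
positive {suc n} = s≤s z≤n

cd-positive : ∀ (M : Matroid n) → 1 ≤ n → 1 ≤ cd M
cd-positive {n} M 1≤n = Cd≤-positive (cd-complete (<-wellFounded n) M 1≤n)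

isContraction*Depth : ∀ (M : Matroid n) {d} → IsMinimum (Cd*≤ (rankFunction M) ⊤) d → IsContraction*Depth M d
isContraction*Depth M {d} (k , least) = attained (decomposition M (rankFunction M) (λ _ → refl) k) , λ { _ (D , refl) →
  least _ (cd*≤-depth M (rankFunction M) (λ _ → refl) D) }
  where
  attained : Σ[ D ∈ Contraction*Decomposition M ] depth (tree D) ≤ d →
             Σ[ D ∈ Contraction*Decomposition M ] depth (tree D) ≡ d
  attained (D , le) = D , ≤-antisym le (least _ (cd*≤-depth M (rankFunction M) (λ _ → refl) D))

-- The exceptional case is excluded because there cd M′ may be 1, while a coloop
-- needs an edge.
extension-bound : ∀ (M : Matroid n) (M′ : Matroid m) → 1 ≤ n → (¬ OnlyLoopsOrColoops M) ⊎ OnlyLoops M →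
                  M ⊑ M′ → ∃[ c ] cd M′ ≡ suc c × Cd*≤ (rankFunction M) ⊤ c
extension-bound {n} {m} M M′ 1≤n cases (S , iso) =
  go (cd M′) refl (cd-positive M′ 1≤m) (cd-complete (<-wellFounded m) M′ 1≤m)
  where
  open Restriction {M = M} {M′} S iso

  1≤m : 1 ≤ m
  1≤m = ≤-trans (≤-trans 1≤n (≤-reflexive (trans (sym (∣⊤∣≡n n)) (trans (cong ∣_∣ (sym preimage-S))
    (∣preimage∣ inclusion inclusion-injective inImage))))) (∣p∣≤n S)

  go : ∀ c → cd M′ ≡ c → 1 ≤ c → Cd≤ (rankFunction M′) ⊤ c → ∃[ c ] cd M′ ≡ suc c × Cd*≤ (rankFunction M) ⊤ c
  go (suc c) eq _ bound = c , eq , [ nonexceptional c bound , (λ loops → flat (onlyLoops⇒rank M loops)) ]′ cases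
    where
    nonexceptional : ∀ c → Cd≤ (rankFunction M′) ⊤ (suc c) → ¬ OnlyLoopsOrColoops M → Cd*≤ (rankFunction M) ⊤ c
    nonexceptional zero b ¬only = contradiction (discrete⇒onlyLoopsOrColoops M λ {x} _ →
      subst₂ (Separates (rankFunction M)) preimage-S (preimage-⁅⁆ inclusion inclusion-injective x)
        (separates-preimage inclusion {ρ = rankFunction M} {rankFunction M′} represents
          (Separates-⊆ (rankFunction M′) (cd≤⇒discrete (rankFunction M′) b {inclusion x} ∈⊤) (⊆⊤ {p = S})))) ¬only
    nonexceptional (suc c) b _ = subst (λ T → Cd*≤ (rankFunction M) T (suc c)) preimage-S
      (cd*≤-preimage inclusion inclusion-injective inImage represents (cd≤⇒cd*≤ (<-wellFounded _) b (⊆⊤ {p = S})))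

theorem1 : ∀ (n : ℕ) → .{{NonZero n}} → (M : Matroid n) →
    ((¬ OnlyLoopsOrColoops M) ⊎ OnlyLoops M →
    ∃[ d ] IsContraction*Depth M d × IsMinimumExtensionDepth M (suc d))
    × (OnlyLoopsOrColoops M × (¬ OnlyLoops M) →
    ∃[ d ] IsContraction*Depth M d × cd M ≡ d × (d ≡ 0 ⊎ d ≡ 1))
theorem1 n M = regular (least-cd* (rankFunction M) ⊤) , exceptional (least-cd* (rankFunction M) ⊤)
  where
  ρ = rankFunction M

  lower-bound : ∀ {d} → (∀ c → Cd*≤ ρ ⊤ c → d ≤ c) → (¬ OnlyLoopsOrColoops M) ⊎ OnlyLoops M →
                ∀ {m} (M′ : Matroid m) → M ⊑ M′ → suc d ≤ cd M′
  lower-bound least cases M′ M⊑M′ = let c , eq , k = extension-bound M M′ positive cases M⊑M′ in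
    subst (_ ≤_) (sym eq) (s≤s (least c k))

  regular : ∃ (IsMinimum (Cd*≤ ρ ⊤)) → (¬ OnlyLoopsOrColoops M) ⊎ OnlyLoops M →
            ∃[ d ] IsContraction*Depth M d × IsMinimumExtensionDepth M (suc d)
  regular (d , k , least) cases = d , isContraction*Depth M (k , least) ,
    ( (_ , matroid (extended E) , extension-⊒ M E ,
        ≤-antisym (cd-extension M E) (lower-bound least cases _ (extension-⊒ M E)))
    , λ { _ (_ , M′ , M⊑M′ , refl) → lower-bound least cases M′ M⊑M′ })
    where
    E = extension k

  exceptional : ∃ (IsMinimum (Cd*≤ ρ ⊤)) → OnlyLoopsOrColoops M × (¬ OnlyLoops M) →
                ∃[ d ] IsContraction*Depth M d × cd M ≡ d × (d ≡ 0 ⊎ d ≡ 1)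
  -- Contraction*-depth zero means rank zero, hence only loops; the common value in the exceptional
  -- case is thus 1.
  exceptional (zero , k , _) (_ , ¬loops) = contradiction (rank⇒onlyLoops M (cd*≤0⇒rank k)) ¬loops
  exceptional (suc d , k , least) (only , _) = suc d , isContraction*Depth M (k , least) ,
    trans (≤-antisym (cd-sound (<-wellFounded n) M (discrete⇒cd≤ ρ ⊤ disc (<-wellFounded _))) (cd-positive M positive))
      (sym d≡1) ,
    inj₂ d≡1
    where
    disc : Discrete ρ ⊤
    disc = onlyLoopsOrColoops⇒discrete M only
    d≡1 : suc d ≡ 1
    d≡1 = ≤-antisym (least 1 (discrete⇒cd*≤ ρ ⊤ disc (<-wellFounded _))) (s≤s z≤n)
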